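{- Let $p$ be a prime with $p\equiv 1\pmod 3$. Then for $M=(p-1)/3$ and also for $M=p-1$, $$\sum_{k=0}^{M}(-1)^k(6k+1)\frac{(\frac13)_k^3}{k!^3}\equiv p+\frac{p^3}{9}E_{p-3}\left(\tfrac13\right)\pmod{p^4}.$$
   Context: $(x)_k=x(x+1)\cdots(x+k-1)$ is the Pochhammer symbol, with $(x)_0=1$. The Euler polynomials $E_n(x)$ are defined by $\sum_{n\ge 0}E_n(x)\frac{t^n}{n!}=\frac{2e^{xt}}{e^t+1}$. A congruence modulo $p^4$ between rational numbers whose denominators are prime to $p$ means that the difference lies in $p^4\mathbb{Z}_p$, where $\mathbb{Z}_p$ is the ring of $p$-adic integers. -}

module Defs where

open import Algebra.Definitions.RawSemiring using (sum)
open import Data.Fin.Base using (toℕ)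
open import Data.Integer.Base using (+_)
open import Data.Nat.Base as ℕ using (ℕ; zero; suc; _∸_; _!)
open import Data.Nat.Divisibility using (_∤_)
open import Data.Nat.Properties using (_!≢0; m^n≢0)
open import Data.Product.Base using (Σ-syntax; _×_)
open import Data.Rational.Base
open import Data.Rational.Literals using (fromℤ)
open import Data.Rational.Properties
open import Relation.Binary.PropositionalEquality using (_≡_; cong; cong₂; trans; module ≡-Reasoning)

open import Algebra.Definitions.RawSemiring +-*-rawSemiring public using (_^_)

fromℕ : ℕ → ℚ
fromℕ n = fromℤ (+ n)

infix 5 ∑[0⋯_]_

-- Both bounds are inclusive.
∑[0⋯_]_ : ℕ → (ℕ → ℚ) → ℚ
∑[0⋯ n ] f = sum +-*-rawSemiring {suc n} (λ i → f (toℕ i))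

pochhammer : ℚ → ℕ → ℚ
pochhammer x zero    = 1ℚ
pochhammer x (suc k) = pochhammer x k * (x + fromℕ k)

-- Formal power series in t over ℚ, given by their coefficients.
Series : Set
Series = ℕ → ℚ

infixl 6 _+ₛ_
infixl 7 _·ₛ_ _*ₛ_ _÷ₛ_

1ₛ : Series
1ₛ zero    = 1ℚ
1ₛ (suc _) = 0ℚ

_+ₛ_ : Series → Series → Series
(f +ₛ g) n = f n + g n

_·ₛ_ : ℚ → Series → Series
(c ·ₛ f) n = c * f n

_*ₛ_ : Series → Series → Series
(f *ₛ g) n = ∑[0⋯ n ] (λ i → f i * g (n ∸ i))

-- Long division: after the leading coefficient c = f₀ / g₀, the quotient
-- continues with the quotient of (f - c g) / t by g.
_÷ₛ_ : (f g : Series) .{{_ : NonZero (g 0)}} → Series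
(f ÷ₛ g) zero    = f 0 ÷ g 0
(f ÷ₛ g) (suc n) = ((λ m → f (suc m) - (f 0 ÷ g 0) * g (suc m)) ÷ₛ g) n

÷ₛ-*ₛ-cancel : ∀ f g .{{_ : NonZero (g 0)}} n → ((f ÷ₛ g) *ₛ g) n ≡ f n
÷ₛ-*ₛ-cancel f g zero = begin
  f 0 * 1/ g 0 * g 0 + 0ℚ   ≡⟨ +-identityʳ _ ⟩
  f 0 * 1/ g 0 * g 0        ≡⟨ *-assoc (f 0) _ _ ⟩
  f 0 * (1/ g 0 * g 0)      ≡⟨ cong (f 0 *_) (*-inverseˡ (g 0)) ⟩
  f 0 * 1ℚ                  ≡⟨ *-identityʳ (f 0) ⟩
  f 0                       ∎
  where open ≡-Reasoning
÷ₛ-*ₛ-cancel f g (suc n) = begin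
  c + ((r ÷ₛ g) *ₛ g) n     ≡⟨ cong (_+_ c) (÷ₛ-*ₛ-cancel r g n) ⟩
  c + (f (suc n) - c)       ≡⟨ +-comm c _ ⟩
  f (suc n) - c + c         ≡⟨ +-assoc (f (suc n)) (- c) c ⟩
  f (suc n) + (- c + c)     ≡⟨ cong (_+_ (f (suc n))) (+-inverseˡ c) ⟩
  f (suc n) + 0ℚ            ≡⟨ +-identityʳ _ ⟩
  f (suc n)                 ∎
  where
  open ≡-Reasoning
  c : ℚ
  c = (f 0 ÷ g 0) * g (suc n)
  r : Series
  r m = f (suc m) - (f 0 ÷ g 0) * g (suc m)

-- The series of e^{xt}.
exp : ℚ → Series
exp x n = (x ^ n ÷ fromℕ (n !)) {{n !≢0}}

-- Eₙ(x) as a function of x: n! times the coefficient of tⁿ in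
-- 2 e^{xt} / (e^t + 1).
euler : ℕ → ℚ → ℚ
euler n x = fromℕ (n !) * ((fromℕ 2 ·ₛ exp x) ÷ₛ (exp 1ℚ +ₛ 1ₛ)) n

infix 4 _∈ℤ[_] _≡_[mod_^_]

-- x lies in ℤₚ: for rational x and prime p, this says that the reduced
-- denominator of x is prime to p.
_∈ℤ[_] : ℚ → ℕ → Set
x ∈ℤ[ p ] = p ∤ ↧ₙ x

-- x - y lies in p^m ℤₚ. The cofactor of p^m is necessarily rational.
_≡_[mod_^_] : ℚ → ℚ → ℕ → ℕ → Set
x ≡ y [mod p ^ m ] = Σ[ z ∈ ℚ ] z ∈ℤ[ p ] × x - y ≡ fromℕ p ^ m * z

summand : ℕ → ℚ
summand k =
  (- 1ℚ) ^ k * fromℕ (6 ℕ.* k ℕ.+ 1)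
    * (pochhammer (+ 1 / 3) k ^ 3 ÷ fromℕ ((k !) ℕ.^ 3)) {{m^n≢0 (k !) 3 {{k !≢0}}}}

{-# OPTIONS --safe #-}
module Submission where

-- Put a = 1/3, p = 3n + 1, x = p/3 = n + a, R(u)ₖ = (a + u)ₖ / (1 - u)ₖ and ρ(u)ₖ = R(u)ₖ / R(0)ₖ, so that
-- the sum up to n is S = Σₖ tₖ with tₖ = (-1)ᵏ (6k + 1) R(0)ₖ³. Split
--   1 = ρ(-x) + ρ(-x) ρ(x) (1 - ρ(-x)) + (1 - ρ(-x)) (1 - ρ(x) ρ(-x)).
-- The Pfaff–Saalschütz theorem writes ρ(u)ₖ as a partial fraction in u with coefficients that are symmetric
-- under k ↦ n - k modulo p. Hence the last product is x³ times a symmetric function modulo p, while tₖ is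
-- antisymmetric modulo p, so that this part of the sum vanishes modulo p⁴. The sums of the other two parts
-- are evaluated exactly: well-poised sums terminated by R(-x) telescope, which gives
--   S ≡ p (rₙ - x Σⱼ rⱼ / (j + x))  (mod p⁴),  rⱼ = (a)ⱼ / j!,
-- and a recurrence in n turns the bracket into 1 + 2 x² rₙ Σⱼ (-1)ʲ / (j² - x²). Finally
-- Eₚ₋₃(1/3) ≡ 2 Σⱼ (-1)ʲ / j² (mod p) follows from Eₙ(y) + Eₙ(y + 1) = 2 yⁿ and Fermat's little theorem.
-- The terms with n < k < p are divisible by p³ and antisymmetric under k ↦ p + n - k modulo p⁴.

open import Defs
open import Data.Empty using (⊥-elim)
open import Data.Fin.Base using (toℕ)
open import Data.Integer.Base as ℤ using (+_)
import Data.Integer.Properties as ℤₚ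
open import Data.Maybe.Base using (Maybe; just; nothing)
open import Data.Nat.Base as ℕ using (ℕ; zero; suc; _∸_; _%_; z≤n; s≤s)
open import Data.Nat.Divisibility as ∣ using (_∣_; _∤_; divides)
open import Data.Nat.DivMod using (m≡m%n+[m/n]*n; m*n/n≡m; m%n<n)
open import Data.Nat.Primality using (Prime; euclidsLemma; ¬prime[0]; ¬prime[1]; prime⇒irreducible)
import Data.Nat.Properties as ℕₚ
open import Data.Nat.Tactic.RingSolver using () renaming (solve-∀ to ℕ-solve-∀)
open import Data.Product.Base using (Σ-syntax; _×_; _,_; proj₁; proj₂)
open import Data.Rational.Base using (ℚ; 0ℚ; 1ℚ; NonZero; ≢-nonZero; ↧_; -_; 1/_; _+_; _-_; _*_; _÷_; _/_)
open import Data.Rational.Literals using (fromℤ)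
open import Data.Rational.Properties
open import Data.Sum.Base using (inj₁; inj₂; [_,_]′)
open import Level using (0ℓ)
open import Relation.Binary.PropositionalEquality hiding (J)
open import Relation.Nullary using (yes; no)
open import Tactic.RingSolver using (solve-∀)
open import Tactic.RingSolver.Core.AlmostCommutativeRing using (AlmostCommutativeRing; fromCommutativeRing)

-- The split is dictated by what can be summed exactly. Termination at k = n comes from ρ(-x),
-- because a - x = -n, so both parts that are to be summed carry ρ(-x). In what remains, 1 - ρ(-x)
-- has order x, and 1 - ρ(x) ρ(-x) has order x² because its linear terms in x nearly cancel;
-- information modulo p about the cofactor of x³ is then enough. The obstacle is the middle part:
-- multiplied out, it contains ρ(-x)² ρ(x), which has more parameters than the well-poised summation
-- admits. Partial fractions remove it. They write 1 - ρ(-x) as a combination of the products (-k)ⱼ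
-- (k + a)ⱼ, and a well-poised sum with such a weight stays summable, since raising j multiplies the
-- sum by an explicit factor. Integrality matters as much as the identities: the denominators j and
-- j ± x for 1 ≤ j ≤ n, and a + i for i < n, are all units modulo p.

ring : AlmostCommutativeRing 0ℓ 0ℓ
ring = fromCommutativeRing +-*-commutativeRing isZero
  where
  isZero : ∀ x → Maybe (0ℚ ≡ x)
  isZero x with 0ℚ ≟ x
  ... | yes eq = just eq
  ... | no _   = nothing

-- To derive an equation from others by ring identities, the caller supplies
-- the multipliers of the hypotheses l ≡ r.
by : ∀ {x y} c {l r} → l ≡ r → x ≡ y + c * (l - r) → x ≡ y
by {x} {y} c {l} refl eq = trans eq (lemma y c l)
  where
  lemma : ∀ y c l → y + c * (l - l) ≡ y
  lemma = solve-∀ ring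

by₂ : ∀ {x y} c {l r} → l ≡ r → ∀ d {l′ r′} → l′ ≡ r′ →
      x ≡ y + c * (l - r) + d * (l′ - r′) → x ≡ y
by₂ c h d h′ eq = by c h (by d h′ eq)

-- Rational addition normalises a fraction, here one with denominator 1; `fromℚᵘ-toℚᵘ` undoes this
-- once the factors 1 in the numerator are removed.
fromℤ-+ : ∀ y z → fromℤ (y ℤ.+ z) ≡ fromℤ y + fromℤ z
fromℤ-+ y z = sym (trans (cong (_/ 1) (cong₂ ℤ._+_ (ℤₚ.*-identityʳ y) (ℤₚ.*-identityʳ z)))
                         (fromℚᵘ-toℚᵘ (fromℤ (y ℤ.+ z))))

fromℤ-* : ∀ y z → fromℤ (y ℤ.* z) ≡ fromℤ y * fromℤ z
fromℤ-* y z = sym (fromℚᵘ-toℚᵘ (fromℤ (y ℤ.* z)))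

fromℕ-+ : ∀ m n → fromℕ (m ℕ.+ n) ≡ fromℕ m + fromℕ n
fromℕ-+ m n = fromℤ-+ (+ m) (+ n)

fromℕ-* : ∀ m n → fromℕ (m ℕ.* n) ≡ fromℕ m * fromℕ n
fromℕ-* m n = trans (cong fromℤ (ℤₚ.pos-* m n)) (fromℤ-* (+ m) (+ n))

fromℕ-suc : ∀ n → fromℕ (suc n) ≡ fromℕ n + 1ℚ
fromℕ-suc n = trans (fromℕ-+ 1 n) (+-comm 1ℚ (fromℕ n))

fromℕ-∸ : ∀ {m n} → m ℕ.≤ n → fromℕ (n ∸ m) ≡ fromℕ n - fromℕ m
fromℕ-∸ {m} {n} m≤n = by (- 1ℚ) (trans (cong fromℕ (sym (ℕₚ.m∸n+n≡m m≤n))) (fromℕ-+ (n ∸ m) m))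
  (lemma (fromℕ (n ∸ m)) (fromℕ n) (fromℕ m))
  where
  lemma : ∀ d n m → d ≡ n - m + - 1ℚ * (n - (d + m))
  lemma = solve-∀ ring

fromℕ-≢0 : ∀ n → .{{ℕ.NonZero n}} → fromℕ n ≢ 0ℚ
fromℕ-≢0 (suc n) ()

-- The reciprocal, with inv 0 = 0.
abstract
  inv : ℚ → ℚ
  inv q with q ≟ 0ℚ
  ... | yes _   = 0ℚ
  ... | no q≢0 = (1/ q) {{≢-nonZero q≢0}}

  inv-inverse : ∀ {q} → q ≢ 0ℚ → q * inv q ≡ 1ℚ
  inv-inverse {q} q≢0 with q ≟ 0ℚ
  ... | yes q≡0 = ⊥-elim (q≢0 q≡0)
  ... | no q≢0′ = *-inverseʳ q {{≢-nonZero q≢0′}}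

*-cancelʳ-≡ : ∀ {x y} z → z ≢ 0ℚ → x * z ≡ y * z → x ≡ y
*-cancelʳ-≡ {x} {y} z z≢0 eq = by₂ (inv z) eq (y - x) (inv-inverse z≢0) (lemma x y z (inv z))
  where
  lemma : ∀ x y z i → x ≡ y + i * (x * z - y * z) + (y - x) * (z * i - 1ℚ)
  lemma = solve-∀ ring

*≡1⇒≢0 : ∀ {q q′} → q * q′ ≡ 1ℚ → q ≢ 0ℚ
*≡1⇒≢0 {q′ = q′} eq refl = 1≢0 (trans (sym eq) (*-zeroˡ q′))

inv-unique : ∀ {q q′} → q * q′ ≡ 1ℚ → inv q ≡ q′
inv-unique {q} {q′} eq = *-cancelʳ-≡ q q≢0
  (trans (trans (*-comm (inv q) q) (inv-inverse q≢0)) (trans (sym eq) (*-comm q q′)))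
  where q≢0 = *≡1⇒≢0 eq

÷-*-inv : ∀ x y .{{_ : NonZero y}} → x ÷ y ≡ x * inv y
÷-*-inv x y = cong (x *_) (sym (inv-unique (*-inverseʳ y)))

*-≢0 : ∀ {x y} → x ≢ 0ℚ → y ≢ 0ℚ → x * y ≢ 0ℚ
*-≢0 {x} {y} x≢0 y≢0 xy≡0 = y≢0 (*-cancelʳ-≡ x x≢0 (trans (*-comm y x) (trans xy≡0 (sym (*-zeroˡ x)))))

inv-* : ∀ {x y} → x ≢ 0ℚ → y ≢ 0ℚ → inv (x * y) ≡ inv x * inv y
inv-* {x} {y} x≢0 y≢0 = inv-unique
  (by₂ (y * inv y) (inv-inverse x≢0) 1ℚ (inv-inverse y≢0) (lemma x y (inv x) (inv y)))
  where
  lemma : ∀ x y i j → x * y * (i * j) ≡ 1ℚ + y * j * (x * i - 1ℚ) + 1ℚ * (y * j - 1ℚ)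
  lemma = solve-∀ ring

-- Finite sums and products, Pochhammer symbols

Σ< Π< : ℕ → (ℕ → ℚ) → ℚ
Σ< zero    f = 0ℚ
Σ< (suc n) f = Σ< n f + f n
Π< zero    f = 1ℚ
Π< (suc n) f = Π< n f * f n

Σ<-cong : ∀ n {f g} → (∀ i → i ℕ.< n → f i ≡ g i) → Σ< n f ≡ Σ< n g
Σ<-cong zero    eq = refl
Σ<-cong (suc n) eq = cong₂ _+_ (Σ<-cong n λ i i<n → eq i (ℕₚ.m<n⇒m<1+n i<n)) (eq n ℕₚ.≤-refl)

Σ<-+ : ∀ n f g → Σ< n (λ i → f i + g i) ≡ Σ< n f + Σ< n g
Σ<-+ zero    f g = refl
Σ<-+ (suc n) f g = trans (cong (_+ (f n + g n)) (Σ<-+ n f g)) (lemma (Σ< n f) (Σ< n g) (f n) (g n))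
  where
  lemma : ∀ a b c d → a + b + (c + d) ≡ a + c + (b + d)
  lemma = solve-∀ ring

Σ<-*ˡ : ∀ n c f → Σ< n (λ i → c * f i) ≡ c * Σ< n f
Σ<-*ˡ zero    c f = sym (*-zeroʳ c)
Σ<-*ˡ (suc n) c f = trans (cong (_+ (c * f n)) (Σ<-*ˡ n c f)) (sym (*-distribˡ-+ c _ _))

Σ<-linear : ∀ n c d f g → c * Σ< n f - d * Σ< n g ≡ Σ< n (λ i → c * f i - d * g i)
Σ<-linear zero    c d f g = lemma c d
  where
  lemma : ∀ c d → c * 0ℚ - d * 0ℚ ≡ 0ℚ
  lemma = solve-∀ ring
Σ<-linear (suc n) c d f g = by 1ℚ (Σ<-linear n c d f g)
  (lemma c d (Σ< n f) (Σ< n g) (f n) (g n) (Σ< n (λ i → c * f i - d * g i)))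
  where
  lemma : ∀ c d S T y z U → c * (S + y) - d * (T + z) ≡ U + (c * y - d * z) + 1ℚ * (c * S - d * T - U)
  lemma = solve-∀ ring

Σ<-0 : ∀ n {f} → (∀ i → i ℕ.< n → f i ≡ 0ℚ) → Σ< n f ≡ 0ℚ
Σ<-0 zero    eq = refl
Σ<-0 (suc n) eq = cong₂ _+_ (Σ<-0 n λ i i<n → eq i (ℕₚ.m<n⇒m<1+n i<n)) (eq n ℕₚ.≤-refl)

Σ<-swap : ∀ m n (f : ℕ → ℕ → ℚ) → Σ< m (λ i → Σ< n (f i)) ≡ Σ< n (λ j → Σ< m (λ i → f i j))
Σ<-swap zero    n f = sym (Σ<-0 n λ _ _ → refl)
Σ<-swap (suc m) n f = trans (cong (_+ Σ< n (f m)) (Σ<-swap m n f)) (sym (Σ<-+ n _ _))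

Σ<-front : ∀ n f → Σ< (suc n) f ≡ f 0 + Σ< n (λ i → f (suc i))
Σ<-front zero    f = +-comm 0ℚ (f 0)
Σ<-front (suc n) f = trans (cong (_+ f (suc n)) (Σ<-front n f)) (+-assoc (f 0) _ _)

Σ<-++ : ∀ m n f → Σ< (m ℕ.+ n) f ≡ Σ< m f + Σ< n (λ i → f (m ℕ.+ i))
Σ<-++ m zero    f = trans (cong (λ k → Σ< k f) (ℕₚ.+-identityʳ m)) (sym (+-identityʳ _))
Σ<-++ m (suc n) f = trans (cong (λ k → Σ< k f) (ℕₚ.+-suc m n))
  (trans (cong (_+ f (m ℕ.+ n)) (Σ<-++ m n f)) (+-assoc (Σ< m f) _ _))

Σ<-reverse : ∀ n f → Σ< n f ≡ Σ< n (λ i → f (n ∸ suc i))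
Σ<-reverse zero    f = refl
Σ<-reverse (suc n) f = trans (cong (_+ f n) (Σ<-reverse n f))
  (trans (+-comm _ (f n)) (sym (Σ<-front n (λ i → f (n ∸ i)))))

∑≡Σ< : ∀ n f → (∑[0⋯ n ] f) ≡ Σ< (suc n) f
∑≡Σ< n f = lemma (suc n) f
  where
  open import Algebra.Definitions.RawSemiring +-*-rawSemiring using (sum)
  lemma : ∀ n f → sum {n} (λ i → f (toℕ i)) ≡ Σ< n f
  lemma zero    f = refl
  lemma (suc n) f = trans (cong (_+_ (f 0)) (lemma n (λ i → f (suc i)))) (sym (Σ<-front n f))

Π<-cong : ∀ n {f g} → (∀ i → i ℕ.< n → f i ≡ g i) → Π< n f ≡ Π< n g
Π<-cong zero    eq = refl
Π<-cong (suc n) eq = cong₂ _*_ (Π<-cong n λ i i<n → eq i (ℕₚ.m<n⇒m<1+n i<n)) (eq n ℕₚ.≤-refl)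

Π<-* : ∀ n f g → Π< n (λ i → f i * g i) ≡ Π< n f * Π< n g
Π<-* zero    f g = refl
Π<-* (suc n) f g = trans (cong (_* (f n * g n)) (Π<-* n f g)) (lemma (Π< n f) (Π< n g) (f n) (g n))
  where
  lemma : ∀ a b c d → a * b * (c * d) ≡ a * c * (b * d)
  lemma = solve-∀ ring

Π<-≢0 : ∀ n {f} → (∀ i → i ℕ.< n → f i ≢ 0ℚ) → Π< n f ≢ 0ℚ
Π<-≢0 zero    _  = 1≢0
Π<-≢0 (suc n) ne = *-≢0 (Π<-≢0 n λ i i<n → ne i (ℕₚ.m<n⇒m<1+n i<n)) (ne n ℕₚ.≤-refl)

Π<-inv : ∀ n {f} → (∀ i → i ℕ.< n → f i ≢ 0ℚ) → Π< n f * Π< n (λ i → inv (f i)) ≡ 1ℚ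
Π<-inv zero    _  = refl
Π<-inv (suc n) {f} ne = by₂ (f n * inv (f n)) (Π<-inv n λ i i<n → ne i (ℕₚ.m<n⇒m<1+n i<n))
  1ℚ (inv-inverse (ne n ℕₚ.≤-refl)) (lemma (Π< n f) (f n) (Π< n (λ i → inv (f i))) (inv (f n)))
  where
  lemma : ∀ x y i j → x * y * (i * j) ≡ 1ℚ + y * j * (x * i - 1ℚ) + 1ℚ * (y * j - 1ℚ)
  lemma = solve-∀ ring

pochhammer-Π : ∀ x n → pochhammer x n ≡ Π< n (λ i → x + fromℕ i)
pochhammer-Π x zero    = refl
pochhammer-Π x (suc n) = cong (_* (x + fromℕ n)) (pochhammer-Π x n)

pochhammer-front : ∀ x n → pochhammer x (suc n) ≡ x * pochhammer (x + 1ℚ) n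
pochhammer-front x zero    = lemma x
  where
  lemma : ∀ x → 1ℚ * (x + 0ℚ) ≡ x * 1ℚ
  lemma = solve-∀ ring
pochhammer-front x (suc n) = by₂ (x + fromℕ (suc n)) (pochhammer-front x n)
  (x * pochhammer (x + 1ℚ) n) (fromℕ-suc n)
  (lemma x (pochhammer x (suc n)) (pochhammer (x + 1ℚ) n) (fromℕ n) (fromℕ (suc n)))
  where
  lemma : ∀ x P Q k k′ → P * (x + k′) ≡ x * (Q * (x + 1ℚ + k)) + (x + k′) * (P - x * Q) + x * Q * (k′ - (k + 1ℚ))
  lemma = solve-∀ ring

-- Read backwards, the factors x - n, ..., x - 1 are the negatives of 1 - x, ..., n - x.
pochhammer-reverse : ∀ x n → pochhammer (x - fromℕ n) n ≡ (- 1ℚ) ^ n * pochhammer (1ℚ - x) n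
pochhammer-reverse x zero    = refl
pochhammer-reverse x (suc n) = begin
  pochhammer (x - fromℕ (suc n)) (suc n)
    ≡⟨ pochhammer-front (x - fromℕ (suc n)) n ⟩
  (x - fromℕ (suc n)) * pochhammer (x - fromℕ (suc n) + 1ℚ) n
    ≡⟨ cong₂ (λ k y → (x - k) * pochhammer y n) (fromℕ-suc n)
         (trans (cong (λ k → x - k + 1ℚ) (fromℕ-suc n)) (shift x (fromℕ n))) ⟩
  (x - (fromℕ n + 1ℚ)) * pochhammer (x - fromℕ n) n
    ≡⟨ cong ((x - (fromℕ n + 1ℚ)) *_) (pochhammer-reverse x n) ⟩
  (x - (fromℕ n + 1ℚ)) * ((- 1ℚ) ^ n * pochhammer (1ℚ - x) n)
    ≡⟨ swap x (fromℕ n) ((- 1ℚ) ^ n) (pochhammer (1ℚ - x) n) ⟩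
  (- 1ℚ) ^ suc n * pochhammer (1ℚ - x) (suc n) ∎
  where
  open ≡-Reasoning
  shift : ∀ x k → x - (k + 1ℚ) + 1ℚ ≡ x - k
  shift = solve-∀ ring
  swap : ∀ x k s P → (x - (k + 1ℚ)) * (s * P) ≡ - 1ℚ * s * (P * (1ℚ - x + k))
  swap = solve-∀ ring

Π<-++ : ∀ m n f → Π< (m ℕ.+ n) f ≡ Π< m f * Π< n (λ i → f (m ℕ.+ i))
Π<-++ m zero    f = trans (cong (λ k → Π< k f) (ℕₚ.+-identityʳ m)) (sym (*-identityʳ (Π< m f)))
Π<-++ m (suc n) f = trans (cong (λ k → Π< k f) (ℕₚ.+-suc m n))
  (trans (cong (_* f (m ℕ.+ n)) (Π<-++ m n f)) (*-assoc (Π< m f) _ _))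

-1^-square : ∀ n → (- 1ℚ) ^ n * (- 1ℚ) ^ n ≡ 1ℚ
-1^-square zero    = refl
-1^-square (suc n) = trans (lemma ((- 1ℚ) ^ n)) (-1^-square n)
  where
  lemma : ∀ s → - 1ℚ * s * (- 1ℚ * s) ≡ s * s
  lemma = solve-∀ ring

-1^-+ : ∀ m n → (- 1ℚ) ^ (m ℕ.+ n) ≡ (- 1ℚ) ^ m * (- 1ℚ) ^ n
-1^-+ zero    n = sym (*-identityˡ ((- 1ℚ) ^ n))
-1^-+ (suc m) n = trans (cong (- 1ℚ *_) (-1^-+ m n)) (sym (*-assoc (- 1ℚ) ((- 1ℚ) ^ m) ((- 1ℚ) ^ n)))

-1^-∸ : ∀ {k n} → k ℕ.≤ n → (- 1ℚ) ^ (n ∸ k) ≡ (- 1ℚ) ^ n * (- 1ℚ) ^ k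
-1^-∸ {k} {n} k≤n = by₂ (- (- 1ℚ) ^ (n ∸ k)) (-1^-square k) ((- 1ℚ) ^ k)
  (trans (sym (-1^-+ (n ∸ k) k)) (cong ((- 1ℚ) ^_) (ℕₚ.m∸n+n≡m k≤n)))
  (lemma ((- 1ℚ) ^ (n ∸ k)) ((- 1ℚ) ^ k) ((- 1ℚ) ^ n))
  where
  lemma : ∀ d s t → d ≡ t * s + - d * (s * s - 1ℚ) + s * (d * s - t)
  lemma = solve-∀ ring

1+fromℕ-≢0 : ∀ i → 1ℚ + fromℕ i ≢ 0ℚ
1+fromℕ-≢0 i eq = fromℕ-≢0 (suc i) (trans (fromℕ-+ 1 i) eq)

Σ<-telescope : ∀ n (F : ℕ → ℚ) → Σ< n (λ i → F (suc i) - F i) ≡ F n - F 0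
Σ<-telescope zero    F = sym (+-inverseʳ (F 0))
Σ<-telescope (suc n) F = trans (cong (_+ (F (suc n) - F n)) (Σ<-telescope n F)) (lemma (F 0) (F n) (F (suc n)))
  where
  lemma : ∀ x y z → y - x + (z - y) ≡ z - x
  lemma = solve-∀ ring

Π<-vanish : ∀ {k n f} → k ℕ.< n → f k ≡ 0ℚ → Π< n f ≡ 0ℚ
Π<-vanish {k} {suc n} {f} k<1+n fk≡0 with k ℕₚ.≟ n
... | yes refl = trans (cong (Π< n f *_) fk≡0) (*-zeroʳ (Π< k f))
... | no k≢n   = trans (cong (_* f n) (Π<-vanish (ℕₚ.≤∧≢⇒< (ℕₚ.≤-pred k<1+n) k≢n) fk≡0)) (*-zeroˡ (f n))

-- Hypergeometric summations

-- quot α β k = (α)ₖ / (β)ₖ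
quot : ℚ → ℚ → ℕ → ℚ
quot α β k = Π< k (λ i → (α + fromℕ i) * inv (β + fromℕ i))

-- (-K)ⱼ (K + a)ⱼ
poch₂ : ℚ → ℚ → ℕ → ℚ
poch₂ a K j = Π< j (λ i → (fromℕ i - K) * (K + a + fromℕ i))

-- 1 / (j! (a)ⱼ)
weight : ℚ → ℕ → ℚ
weight a j = Π< j (λ i → inv ((1ℚ + fromℕ i) * (a + fromℕ i)))

saalschützTerm : ℚ → ℚ → ℕ → ℚ
saalschützTerm a K j = poch₂ a K j * weight a j

-- Since (-u)ⱼ / (1 - u)ⱼ = -u / (j - u), for natural K ≤ J the number
-- `1ℚ - u * saalschützSum a u J K` is the series ₃F₂(-K, K + a, -u; a, 1 - u; 1). The terms with j
-- > K vanish, so one range J serves all K ≤ J; this later allows the sums over j and k to be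
-- exchanged.
saalschützSum : ℚ → ℚ → ℕ → ℚ → ℚ
saalschützSum a u J K = Σ< J (λ i → saalschützTerm a K (suc i) * inv (1ℚ - u + fromℕ i))

module _ (a K : ℚ) where

  private
    -- A link between `poch₂` at K and at K + 1: it shares (-K)ⱼ with the former and (K + 1 + a)ⱼ
    -- with the latter. Multiplied by `weight`, it is the telescoping certificate below.
    h : ℕ → ℚ
    h j = Π< j (λ i → (fromℕ i - K) * (K + 1ℚ + a + fromℕ i))

  poch₂-h : ∀ j → poch₂ a K j * (K + a + fromℕ j) ≡ h j * (K + a)
  poch₂-h zero    = lemma K a
    where
    lemma : ∀ K a → 1ℚ * (K + a + 0ℚ) ≡ 1ℚ * (K + a)
    lemma = solve-∀ ring
  poch₂-h (suc j) = by₂ ((fromℕ j - K) * (K + a + fromℕ (suc j))) (poch₂-h j)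
    (h j * (K + a) * (fromℕ j - K)) (fromℕ-suc j)
    (lemma K a (fromℕ j) (fromℕ (suc j)) (poch₂ a K j) (h j))
    where
    lemma : ∀ K a j j′ p h → p * ((j - K) * (K + a + j)) * (K + a + j′)
      ≡ h * ((j - K) * (K + 1ℚ + a + j)) * (K + a) + (j - K) * (K + a + j′) * (p * (K + a + j) - h * (K + a))
        + h * (K + a) * (j - K) * (j′ - (j + 1ℚ))
    lemma = solve-∀ ring

  poch₂-suc-h : ∀ j → poch₂ a (K + 1ℚ) j * (fromℕ j - 1ℚ - K) ≡ h j * (- 1ℚ - K)
  poch₂-suc-h zero    = lemma K
    where
    lemma : ∀ K → 1ℚ * (0ℚ - 1ℚ - K) ≡ 1ℚ * (- 1ℚ - K)
    lemma = solve-∀ ring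
  poch₂-suc-h (suc j) = by₂ ((K + 1ℚ + a + fromℕ j) * (fromℕ (suc j) - 1ℚ - K)) (poch₂-suc-h j)
    (h j * (- 1ℚ - K) * (K + 1ℚ + a + fromℕ j)) (fromℕ-suc j)
    (lemma K a (fromℕ j) (fromℕ (suc j)) (poch₂ a (K + 1ℚ) j) (h j))
    where
    lemma : ∀ K a j j′ p h → p * ((j - (K + 1ℚ)) * (K + 1ℚ + a + j)) * (j′ - 1ℚ - K)
      ≡ h * ((j - K) * (K + 1ℚ + a + j)) * (- 1ℚ - K)
        + (K + 1ℚ + a + j) * (j′ - 1ℚ - K) * (p * (j - 1ℚ - K) - h * (- 1ℚ - K))
        + h * (- 1ℚ - K) * (K + 1ℚ + a + j) * (j′ - (j + 1ℚ))
    lemma = solve-∀ ring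

  module _ (u : ℚ) (J : ℕ) (a≢0 : ∀ i → i ℕ.< J → a + fromℕ i ≢ 0ℚ)
           (u≢ : ∀ i → i ℕ.< J → 1ℚ - u + fromℕ i ≢ 0ℚ) where

    -- Creative telescoping in K. Expressed through `h`, the two numerators combine to a multiple of
    -- 1 - u + i, so the pole cancels and a difference remains.
    saalschütz-contiguous-term : ∀ i → i ℕ.< J →
      (K + 1ℚ - u) * (a + K) * (saalschützTerm a (K + 1ℚ) (suc i) * inv (1ℚ - u + fromℕ i))
        - (a + u + K) * (K + 1ℚ) * (saalschützTerm a K (suc i) * inv (1ℚ - u + fromℕ i))
      ≡ (K + K + 1ℚ + a) * (h (suc i) * weight a (suc i) - h i * weight a i)
    saalschütz-contiguous-term i i<J =
      by ((K + 1ℚ - u) * (a + K) * (K + 1ℚ + a + I) * m * w * φ) (poch₂-suc-h i)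
        (by (- (a + u + K) * (K + 1ℚ) * (I - K) * m * w * φ) (poch₂-h i)
          (by (- (a + K) * (K + 1ℚ) * (K + K + 1ℚ + a) * h i * m * w) (inv-inverse (u≢ i i<J))
            (by (- (K + K + 1ℚ + a) * h i * m) (inv-inverse (*-≢0 (1+fromℕ-≢0 i) (a≢0 i i<J)))
              (lemma K a u I (poch₂ a (K + 1ℚ) i) (poch₂ a K i) (h i) m w φ))))
      where
      I = fromℕ i
      m = weight a i
      w = inv ((1ℚ + I) * (a + I))
      φ = inv (1ℚ - u + I)
      lemma : ∀ K a u I q′ q h m w φ →
        (K + 1ℚ - u) * (a + K) * (q′ * ((I - (K + 1ℚ)) * (K + 1ℚ + a + I)) * (m * w) * φ)
          - (a + u + K) * (K + 1ℚ) * (q * ((I - K) * (K + a + I)) * (m * w) * φ)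
        ≡ (K + K + 1ℚ + a) * (h * ((I - K) * (K + 1ℚ + a + I)) * (m * w) - h * m)
          + (K + 1ℚ - u) * (a + K) * (K + 1ℚ + a + I) * m * w * φ * (q′ * (I - 1ℚ - K) - h * (- 1ℚ - K))
          + - (a + u + K) * (K + 1ℚ) * (I - K) * m * w * φ * (q * (K + a + I) - h * (K + a))
          + - (a + K) * (K + 1ℚ) * (K + K + 1ℚ + a) * h * m * w * ((1ℚ - u + I) * φ - 1ℚ)
          + - (K + K + 1ℚ + a) * h * m * ((1ℚ + I) * (a + I) * w - 1ℚ)
      lemma = solve-∀ ring

    saalschütz-contiguous : h J ≡ 0ℚ →
      (K + 1ℚ - u) * (a + K) * (1ℚ - u * saalschützSum a u J (K + 1ℚ))
      ≡ (a + u + K) * (K + 1ℚ) * (1ℚ - u * saalschützSum a u J K)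
    saalschütz-contiguous hJ≡0 = by (- u) sums (lemma K a u (saalschützSum a u J (K + 1ℚ)) (saalschützSum a u J K))
      where
      c = (K + 1ℚ - u) * (a + K)
      d = (a + u + K) * (K + 1ℚ)
      e = K + K + 1ℚ + a
      F G H : ℕ → ℚ
      F i = saalschützTerm a (K + 1ℚ) (suc i) * inv (1ℚ - u + fromℕ i)
      G i = saalschützTerm a K (suc i) * inv (1ℚ - u + fromℕ i)
      H i = h i * weight a i
      sums : c * Σ< J F - d * Σ< J G ≡ - e
      sums = begin
        c * Σ< J F - d * Σ< J G                    ≡⟨ Σ<-linear J c d F G ⟩
        Σ< J (λ i → c * F i - d * G i)             ≡⟨ Σ<-cong J saalschütz-contiguous-term ⟩
        Σ< J (λ i → e * (H (suc i) - H i))         ≡⟨ Σ<-*ˡ J e (λ i → H (suc i) - H i) ⟩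
        e * Σ< J (λ i → H (suc i) - H i)           ≡⟨ cong (e *_) (Σ<-telescope J H) ⟩
        e * (h J * weight a J - 1ℚ * 1ℚ)           ≡⟨ cong (λ z → e * (z * weight a J - 1ℚ * 1ℚ)) hJ≡0 ⟩
        e * (0ℚ * weight a J - 1ℚ * 1ℚ)            ≡⟨ finish e (weight a J) ⟩
        - e                                        ∎
        where
        open ≡-Reasoning
        finish : ∀ e m → e * (0ℚ * m - 1ℚ * 1ℚ) ≡ - e
        finish = solve-∀ ring
      lemma : ∀ K a u S T → (K + 1ℚ - u) * (a + K) * (1ℚ - u * S)
        ≡ (a + u + K) * (K + 1ℚ) * (1ℚ - u * T)
          + - u * ((K + 1ℚ - u) * (a + K) * S - (a + u + K) * (K + 1ℚ) * T - - (K + K + 1ℚ + a))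
      lemma = solve-∀ ring

-- The Pfaff–Saalschütz summation, in partial fractions in u.
saalschütz : ∀ a u J → (∀ i → i ℕ.< J → a + fromℕ i ≢ 0ℚ) → (∀ i → i ℕ.< J → 1ℚ - u + fromℕ i ≢ 0ℚ) →
  ∀ k → k ℕ.≤ J → quot (a + u) (1ℚ - u) k ≡ quot a 1ℚ k * (1ℚ - u * saalschützSum a u J (fromℕ k))
saalschütz a u J a≢0 u≢ zero _ = trans (lemma u)
  (cong (λ S → 1ℚ * (1ℚ - u * S)) (sym (Σ<-0 J λ i _ → trans
      (cong (λ z → z * weight a (suc i) * inv (1ℚ - u + fromℕ i))
    (Π<-vanish {0} {suc i} (s≤s z≤n) (vanish a))) (zeros (weight a (suc i)) (inv (1ℚ - u + fromℕ i))))))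
  where
  vanish : ∀ a → (0ℚ - 0ℚ) * (0ℚ + a + 0ℚ) ≡ 0ℚ
  vanish = solve-∀ ring
  zeros : ∀ x y → 0ℚ * x * y ≡ 0ℚ
  zeros = solve-∀ ring
  lemma : ∀ u → 1ℚ ≡ 1ℚ * (1ℚ - u * 0ℚ)
  lemma = solve-∀ ring
saalschütz a u J a≢0 u≢ (suc k) k<J =
  by ((a + u + K) * φ) (saalschütz a u J a≢0 u≢ k (ℕₚ.<⇒≤ k<J))
    (by (- (r * L * φ * (a + u + K))) (inv-inverse (1+fromℕ-≢0 k))
      (by (r * (a + K) * ι * L′) (inv-inverse (u≢ k k<J))
        (by (- (r * φ * ι)) contiguous
          (lemma K a u (quot (a + u) (1ℚ - u) k) r L L′ φ ι))))
  where
  K = fromℕ k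
  r = quot a 1ℚ k
  φ = inv (1ℚ - u + K)
  ι = inv (1ℚ + K)
  L = 1ℚ - u * saalschützSum a u J K
  L′ = 1ℚ - u * saalschützSum a u J (fromℕ (suc k))
  contiguous : (K + 1ℚ - u) * (a + K) * L′ ≡ (a + u + K) * (K + 1ℚ) * L
  contiguous = trans (cong (λ K′ → (K + 1ℚ - u) * (a + K) * (1ℚ - u * saalschützSum a u J K′)) (fromℕ-suc k))
    -- The factor i = k of `h` is zero, which removes the upper boundary term of the telescoping
    -- sum.
    (saalschütz-contiguous a K u J a≢0 u≢ (Π<-vanish k<J
      (trans (cong (_* (K + 1ℚ + a + K)) (+-inverseʳ K)) (*-zeroˡ (K + 1ℚ + a + K)))))
  lemma : ∀ K a u R r L L′ φ ι → R * ((a + u + K) * φ)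
    ≡ r * ((a + K) * ι) * L′ + (a + u + K) * φ * (R - r * L)
      + - (r * L * φ * (a + u + K)) * ((1ℚ + K) * ι - 1ℚ)
      + r * (a + K) * ι * L′ * ((1ℚ - u + K) * φ - 1ℚ)
      + - (r * φ * ι) * ((K + 1ℚ - u) * (a + K) * L′ - (a + u + K) * (K + 1ℚ) * L)
  lemma = solve-∀ ring

poch₂-suc : ∀ a K j → poch₂ a (K + 1ℚ) j * (K + 1ℚ - fromℕ j) * (a + K) ≡ poch₂ a K j * (K + 1ℚ) * (a + K + fromℕ j)
poch₂-suc a K zero    = lemma a K
  where
  lemma : ∀ a K → 1ℚ * (K + 1ℚ - 0ℚ) * (a + K) ≡ 1ℚ * (K + 1ℚ) * (a + K + 0ℚ)
  lemma = solve-∀ ring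
poch₂-suc a K (suc j) = trans
  (cong (λ j′ → poch₂ a (K + 1ℚ) (suc j) * (K + 1ℚ - j′) * (a + K)) (fromℕ-suc j))
  (trans (by ((J - K) * (K + 1ℚ + a + J)) (poch₂-suc a K j) (lemma a K J (poch₂ a (K + 1ℚ) j) (poch₂ a K j)))
    (cong (λ j′ → poch₂ a K (suc j) * (K + 1ℚ) * (a + K + j′)) (sym (fromℕ-suc j))))
  where
  J = fromℕ j
  lemma : ∀ a K J q′ q → q′ * ((J - (K + 1ℚ)) * (K + 1ℚ + a + J)) * (K + 1ℚ - (J + 1ℚ)) * (a + K)
    ≡ q * ((J - K) * (K + a + J)) * (K + 1ℚ) * (a + K + (J + 1ℚ))
      + (J - K) * (K + 1ℚ + a + J) * (q′ * (K + 1ℚ - J) * (a + K) - q * (K + 1ℚ) * (a + K + J))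
  lemma = solve-∀ ring

poch₂-vanish : ∀ a {k j} → k ℕ.< j → poch₂ a (fromℕ k) j ≡ 0ℚ
poch₂-vanish a {k} k<j = Π<-vanish k<j (trans (cong (_* (fromℕ k + a + fromℕ k)) (+-inverseʳ (fromℕ k)))
    (*-zeroˡ (fromℕ k + a + fromℕ k)))

-- Terminating well-poised sums

module _ (a v w : ℚ) where

  -- The terms of a well-poised series with parameters a, a + v, a + w, without the factor a + 2k and
  -- weighted by (-k)ⱼ (k + a)ⱼ. Summing them for all j at once yields a two-term recurrence in j.
  wellPoised : ℕ → ℕ → ℚ
  wellPoised j k = (- 1ℚ) ^ k * quot a 1ℚ k * poch₂ a (fromℕ k) j *
      (quot (a + v) (1ℚ - v) k * quot (a + w) (1ℚ - w) k)

  wellPoisedSum : ℕ → ℕ → ℚ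
  wellPoisedSum n j = Σ< (suc n) (λ k → (a + fromℕ k + fromℕ k) * wellPoised j k)

  -- The term ratio in k, with k + 1 - j cleared from the denominator: at k + 1 = j the term itself
  -- passes from zero to a possibly nonzero value.
  wellPoised-suc : ∀ j k → 1ℚ - v + fromℕ k ≢ 0ℚ → 1ℚ - w + fromℕ k ≢ 0ℚ →
    let K = fromℕ k; M = K + 1ℚ in
    wellPoised j (suc k) * (M - fromℕ j) * (M - v) * (M - w)
    ≡ - (wellPoised j k * (a + K + fromℕ j) * (a + v + K) * (a + w + K))
  wellPoised-suc j k v≢ w≢ = begin
    - 1ℚ * s * (r * ((a + K) * ι)) * poch₂ a (fromℕ (suc k)) j
        * (V * ((a + v + K) * φ) * (W * ((a + w + K) * ψ))) * (M - J) * (M - v) * (M - w)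
      ≡⟨ cong (λ K′ → - 1ℚ * s * (r * ((a + K) * ι)) * poch₂ a K′ j
           * (V * ((a + v + K) * φ) * (W * ((a + w + K) * ψ))) * (M - J) * (M - v) * (M - w)) (fromℕ-suc k) ⟩
    - 1ℚ * s * (r * ((a + K) * ι)) * poch₂ a M j
        * (V * ((a + v + K) * φ) * (W * ((a + w + K) * ψ))) * (M - J) * (M - v) * (M - w)
      ≡⟨ cong₂ (λ y z → - 1ℚ * s * (r * ((a + K) * ι)) * poch₂ a M j
           * (V * ((a + v + K) * φ) * (W * ((a + w + K) * ψ))) * (M - J) * y * z) (swap v K) (swap w K) ⟩
    - 1ℚ * s * (r * ((a + K) * ι)) * poch₂ a M j
        * (V * ((a + v + K) * φ) * (W * ((a + w + K) * ψ))) * (M - J) * (1ℚ - v + K) * (1ℚ - w + K)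
      ≡⟨ collect (a + K) (a + v + K) (a + w + K) (M - J) (1ℚ - v + K) (1ℚ - w + K) (- 1ℚ * s) r ι (poch₂ a M j) V
          φ W ψ ⟩
    poch₂ a M j * (M - J) * (a + K) * ((1ℚ - v + K) * φ) * ((1ℚ - w + K) * ψ)
        * (- 1ℚ * s * r * ι * V * (a + v + K) * W * (a + w + K))
      ≡⟨ cong₂ (λ x y → x * y * ((1ℚ - w + K) * ψ) * (- 1ℚ * s * r * ι * V * (a + v + K) * W * (a + w + K)))
           (poch₂-suc a K j) (inv-inverse v≢) ⟩
    q * M * (a + K + J) * 1ℚ * ((1ℚ - w + K) * ψ) * (- 1ℚ * s * r * ι * V * (a + v + K) * W * (a + w + K))
      ≡⟨ cong (λ x → q * M * (a + K + J) * 1ℚ * x * (- 1ℚ * s * r * ι * V * (a + v + K) * W * (a + w + K)))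
           (inv-inverse w≢) ⟩
    q * M * (a + K + J) * 1ℚ * 1ℚ * (- 1ℚ * s * r * ι * V * (a + v + K) * W * (a + w + K))
      ≡⟨ by (- (s * r * q * (V * W) * (a + K + J) * (a + v + K) * (a + w + K))) (inv-inverse (1+fromℕ-≢0 k))
           (expand a v w K J s r ι q V W) ⟩
    - (s * r * q * (V * W) * (a + K + J) * (a + v + K) * (a + w + K)) ∎
    where
    open ≡-Reasoning
    K = fromℕ k
    J = fromℕ j
    M = K + 1ℚ
    s = (- 1ℚ) ^ k
    r = quot a 1ℚ k
    q = poch₂ a K j
    V = quot (a + v) (1ℚ - v) k
    W = quot (a + w) (1ℚ - w) k
    ι = inv (1ℚ + K)
    φ = inv (1ℚ - v + K)
    ψ = inv (1ℚ - w + K)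
    swap : ∀ v K → K + 1ℚ - v ≡ 1ℚ - v + K
    swap = solve-∀ ring
    collect : ∀ b c d m y z s r ι q′ V φ W ψ →
      s * (r * (b * ι)) * q′ * (V * (c * φ) * (W * (d * ψ))) * m * y * z
      ≡ q′ * m * b * (y * φ) * (z * ψ) * (s * r * ι * V * c * W * d)
    collect = solve-∀ ring
    expand : ∀ a v w K J s r ι q V W →
      q * (K + 1ℚ) * (a + K + J) * 1ℚ * 1ℚ * (- 1ℚ * s * r * ι * V * (a + v + K) * W * (a + w + K))
      ≡ - (s * r * q * (V * W) * (a + K + J) * (a + v + K) * (a + w + K))
        + - (s * r * q * (V * W) * (a + K + J) * (a + v + K) * (a + w + K)) * ((1ℚ + K) * ι - 1ℚ)
    expand = solve-∀ ring

  -- Gosper summation, with certificate (k - j) (k - v) (k - w).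
  wellPoised-telescope : ∀ n j → (∀ k → k ℕ.< n → 1ℚ - v + fromℕ k ≢ 0ℚ) → (∀ k → k ℕ.< n → 1ℚ - w + fromℕ k ≢ 0ℚ) →
    let N = fromℕ n; J = fromℕ j in
    Σ< (suc n) (λ k → let K = fromℕ k in
      (a + K + K) * wellPoised j k * ((J - K) * (K + a + J) - (a + v + J) * (a + w + J)))
    ≡ - (wellPoised j n * (a + N + J) * (a + v + N) * (a + w + N))
  wellPoised-telescope zero j _ _ = by (v * w) (first j) (lemma a v w J (wellPoised j 0))
    where
    J = fromℕ j
    -- At k = 0 the certificate is -j v w; it contributes nothing, because the term vanishes for j >
    -- 0.
    first : ∀ j → wellPoised j 0 * fromℕ j ≡ 0ℚ
    first zero    = refl
    first (suc j) = trans (cong (λ q → 1ℚ * 1ℚ * q * (1ℚ * 1ℚ) * fromℕ (suc j))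
        (poch₂-vanish a {0} {suc j} (s≤s z≤n))) (*-zeroˡ (fromℕ (suc j)))
    lemma : ∀ a v w J y → 0ℚ + (a + 0ℚ + 0ℚ) * y * ((J - 0ℚ) * (0ℚ + a + J) - (a + v + J) * (a + w + J))
      ≡ - (y * (a + 0ℚ + J) * (a + v + 0ℚ) * (a + w + 0ℚ))
        + (v * w) * (y * J - 0ℚ)
    lemma = solve-∀ ring
  wellPoised-telescope (suc n) j v≢ w≢ = begin
    Σ< (suc n) term + (a + fromℕ (suc n) + fromℕ (suc n)) * y′ *
        ((J - fromℕ (suc n)) * (fromℕ (suc n) + a + J) - (a + v + J) * (a + w + J))
      ≡⟨ cong₂ (λ S M → S + (a + M + M) * y′ * ((J - M) * (M + a + J) - (a + v + J) * (a + w + J)))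
           (trans (wellPoised-telescope n j (λ k k<n → v≢ k (ℕₚ.m<n⇒m<1+n k<n)) (λ k k<n → w≢ k (ℕₚ.m<n⇒m<1+n k<n)))
             (sym (wellPoised-suc j n (v≢ n ℕₚ.≤-refl) (w≢ n ℕₚ.≤-refl)))) (fromℕ-suc n) ⟩
    y′ * (M - J) * (M - v) * (M - w) + (a + M + M) * y′ * ((J - M) * (M + a + J) - (a + v + J) * (a + w + J))
      ≡⟨ lemma a v w J M y′ ⟩
    - (y′ * (a + M + J) * (a + v + M) * (a + w + M))
      ≡⟨ cong (λ M → - (y′ * (a + M + J) * (a + v + M) * (a + w + M))) (sym (fromℕ-suc n)) ⟩
    - (y′ * (a + fromℕ (suc n) + J) * (a + v + fromℕ (suc n)) * (a + w + fromℕ (suc n))) ∎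
    where
    open ≡-Reasoning
    J = fromℕ j
    M = fromℕ n + 1ℚ
    y′ = wellPoised j (suc n)
    term : ℕ → ℚ
    term k = let K = fromℕ k in (a + K + K) * wellPoised j k * ((J - K) * (K + a + J) - (a + v + J) * (a + w + J))
    lemma : ∀ a v w J M y → y * (M - J) * (M - v) * (M - w) + (a + M + M) * y *
        ((J - M) * (M + a + J) - (a + v + J) * (a + w + J))
      ≡ - (y * (a + M + J) * (a + v + M) * (a + w + M))
    lemma = solve-∀ ring

  module _ (n : ℕ) (v-terminates : a + v + fromℕ n ≡ 0ℚ)
           (v≢ : ∀ k → k ℕ.< n → 1ℚ - v + fromℕ k ≢ 0ℚ) (w≢ : ∀ k → k ℕ.< n → 1ℚ - w + fromℕ k ≢ 0ℚ) where

    -- Raising j multiplies the k-th term by (j - k) (k + a + j). Replacing this by the factor (a +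
    -- v + j) (a + w + j), free of k, costs a telescoping sum whose boundary term contains a + v + n
    -- = 0.
    wellPoisedSum-suc : ∀ j → wellPoisedSum n (suc j) ≡ (a + v + fromℕ j) * (a + w + fromℕ j) * wellPoisedSum n j
    wellPoisedSum-suc j = begin
      wellPoisedSum n (suc j)
        ≡⟨ Σ<-cong (suc n) (λ k _ → split a (fromℕ k) J c ((- 1ℚ) ^ k) (quot a 1ℚ k) (poch₂ a (fromℕ k) j)
             (quot (a + v) (1ℚ - v) k) (quot (a + w) (1ℚ - w) k)) ⟩
      Σ< (suc n) (λ k → c * F k + G k)
        ≡⟨ trans (Σ<-+ (suc n) (λ k → c * F k) G) (cong₂ _+_ (Σ<-*ˡ (suc n) c F) (wellPoised-telescope n j v≢ w≢)) ⟩
      c * wellPoisedSum n j + - (wellPoised j n * (a + fromℕ n + J) * (a + v + fromℕ n) * (a + w + fromℕ n))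
        ≡⟨ by (- (wellPoised j n * (a + fromℕ n + J) * (a + w + fromℕ n))) v-terminates
             (last (c * wellPoisedSum n j) (wellPoised j n) (a + fromℕ n + J) (a + v + fromℕ n) (a + w + fromℕ n)) ⟩
      c * wellPoisedSum n j ∎
      where
      open ≡-Reasoning
      J = fromℕ j
      c = (a + v + J) * (a + w + J)
      F G : ℕ → ℚ
      F k = (a + fromℕ k + fromℕ k) * wellPoised j k
      G k = (a + fromℕ k + fromℕ k) * wellPoised j k * ((J - fromℕ k) * (fromℕ k + a + J) - c)
      split : ∀ a K J c s r q V W → (a + K + K) * (s * r * (q * ((J - K) * (K + a + J))) * (V * W))
        ≡ c * ((a + K + K) * (s * r * q * (V * W))) + (a + K + K) * (s * r * q * (V * W)) *
            ((J - K) * (K + a + J) - c)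
      split = solve-∀ ring
      last : ∀ A y b z d → A + - (y * b * z * d) ≡ A + - (y * b * d) * (z - 0ℚ)
      last = solve-∀ ring

    wellPoisedSum-Π : ∀ j → wellPoisedSum n j
      ≡ Π< j (λ i → a + v + fromℕ i) * Π< j (λ i → a + w + fromℕ i) * wellPoisedSum n 0
    wellPoisedSum-Π zero    = sym (trans (cong (_* wellPoisedSum n 0) (*-identityˡ 1ℚ))
        (*-identityˡ (wellPoisedSum n 0)))
    wellPoisedSum-Π (suc j) = trans (wellPoisedSum-suc j) (trans
      (cong (((a + v + fromℕ j) * (a + w + fromℕ j)) *_) (wellPoisedSum-Π j))
      (lemma (a + v + fromℕ j) (a + w + fromℕ j) (Π< j (λ i → a + v + fromℕ i)) (Π< j (λ i → a + w + fromℕ i))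
          (wellPoisedSum n 0)))
      where
      lemma : ∀ b c P Q S → b * c * (P * Q * S) ≡ P * b * (Q * c) * S
      lemma = solve-∀ ring

    wellPoisedSum-n : wellPoisedSum n n ≡ (a + fromℕ n + fromℕ n) * wellPoised n n
    wellPoisedSum-n = trans (cong (_+ (a + fromℕ n + fromℕ n) * wellPoised n n)
      (Σ<-0 n λ k k<n → trans (cong (λ q → (a + fromℕ k + fromℕ k) * ((- 1ℚ) ^ k * quot a 1ℚ k * q
          * (quot (a + v) (1ℚ - v) k * quot (a + w) (1ℚ - w) k))) (poch₂-vanish a k<n))
        (lemma (a + fromℕ k + fromℕ k) ((- 1ℚ) ^ k * quot a 1ℚ k)
            (quot (a + v) (1ℚ - v) k * quot (a + w) (1ℚ - w) k))))
      (+-identityˡ ((a + fromℕ n + fromℕ n) * wellPoised n n))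
      where
      lemma : ∀ x y z → x * (y * 0ℚ * z) ≡ 0ℚ
      lemma = solve-∀ ring

    -- The recurrence in j is solved backwards from j = n, where only the term k = n survives. This
    -- means dividing by (a + v)ₙ (a + w)ₙ, whose first half is nonzero since a + v + k = k - n. Up
    -- to the factor a, the sum is the well-poised ₄F₃ at -1 with upper parameters a, 1 + a/2, -n, a
    -- + w.
    wellPoisedSum-0 : (∀ k → k ℕ.< n → a + w + fromℕ k ≢ 0ℚ) →
      wellPoisedSum n 0 ≡ (fromℕ n + a) * Π< n (λ i → (a + fromℕ i) * inv (1ℚ - w + fromℕ i))
    wellPoisedSum-0 aw≢ = *-cancelʳ-≡ (A * B) (*-≢0 (Π<-≢0 n av≢) (Π<-≢0 n aw≢)) (begin
      wellPoisedSum n 0 * (A * B)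
        ≡⟨ *-comm (wellPoisedSum n 0) (A * B) ⟩
      A * B * wellPoisedSum n 0
        ≡⟨ sym (wellPoisedSum-Π n) ⟩
      wellPoisedSum n n
        ≡⟨ wellPoisedSum-n ⟩
      (a + N + N) * (s * Π< n (λ i → (a + fromℕ i) * inv (1ℚ + fromℕ i)) * poch₂ a N n
        * (quot (a + v) (1ℚ - v) n * quot (a + w) (1ℚ - w) n))
        ≡⟨ cong₂ (λ x y → (a + N + N) * (s * x * y * (quot (a + v) (1ℚ - v) n * quot (a + w) (1ℚ - w) n)))
             (Π<-* n _ _) (Π<-* n _ _) ⟩
      (a + N + N) * (s * (P * F) * (Π< n (λ i → fromℕ i - N) * X)
        * (quot (a + v) (1ℚ - v) n * quot (a + w) (1ℚ - w) n))
        ≡⟨ cong₂ (λ x y → (a + N + N) * (s * (P * F) * (Π< n (λ i → fromℕ i - N) * X) * (x * y)))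
             (Π<-* n _ _) (Π<-* n _ _) ⟩
      (a + N + N) * (s * (P * F) * (Π< n (λ i → fromℕ i - N) * X) * (A * C * (B * D)))
        ≡⟨ cong (λ x → (a + N + N) * (s * (P * F) * (x * X) * (A * C * (B * D)))) factorial-sign ⟩
      (a + N + N) * (s * (P * F) * (s * E * X) * (A * C * (B * D)))
        ≡⟨ by (E * F * X * (a + N + N) * P * C * D * A * B) (-1^-square n)
             (by (X * (a + N + N) * P * C * D * A * B) (Π<-inv n (λ i _ → 1+fromℕ-≢0 i))
               (by (P * D * A * B * C) shift
                 (by (P * D * A * B * (N + a)) (Π<-inv n v≢)
                   (lemma a N s P F E X A B C D Y)))) ⟩
      (N + a) * (P * D) * (A * B)
        ≡⟨ cong (λ z → (N + a) * z * (A * B)) (sym (Π<-* n _ _)) ⟩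
      (N + a) * Π< n (λ i → (a + fromℕ i) * inv (1ℚ - w + fromℕ i)) * (A * B) ∎)
      where
      open ≡-Reasoning
      N = fromℕ n
      s = (- 1ℚ) ^ n
      A = Π< n (λ i → a + v + fromℕ i)
      B = Π< n (λ i → a + w + fromℕ i)
      C = Π< n (λ i → inv (1ℚ - v + fromℕ i))
      D = Π< n (λ i → inv (1ℚ - w + fromℕ i))
      P = Π< n (λ i → a + fromℕ i)
      F = Π< n (λ i → inv (1ℚ + fromℕ i))
      E = Π< n (λ i → 1ℚ + fromℕ i)
      X = Π< n (λ i → N + a + fromℕ i)
      Y = Π< n (λ i → 1ℚ - v + fromℕ i)
      av≢ : ∀ k → k ℕ.< n → a + v + fromℕ k ≢ 0ℚ
      av≢ k k<n eq = fromℕ-≢0 (n ∸ k) {{ℕ.>-nonZero (ℕₚ.m<n⇒0<n∸m k<n)}} (trans (fromℕ-∸ (ℕₚ.<⇒≤ k<n))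
        (by₂ 1ℚ v-terminates (- 1ℚ) eq (diff (a + v) N (fromℕ k))))
        where
        diff : ∀ z N K → N - K ≡ 0ℚ + 1ℚ * (z + N - 0ℚ) + - 1ℚ * (z + K - 0ℚ)
        diff = solve-∀ ring
      factorial-sign : Π< n (λ i → fromℕ i - N) ≡ s * E
      factorial-sign = begin
        Π< n (λ i → fromℕ i - N)          ≡⟨ Π<-cong n (λ i _ → flip (fromℕ i) N) ⟩
        Π< n (λ i → 0ℚ - N + fromℕ i)     ≡⟨ sym (pochhammer-Π (0ℚ - N) n) ⟩
        pochhammer (0ℚ - N) n             ≡⟨ pochhammer-reverse 0ℚ n ⟩
        s * pochhammer (1ℚ - 0ℚ) n        ≡⟨ cong (s *_) (pochhammer-Π (1ℚ - 0ℚ) n) ⟩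
        s * E                             ∎
        where
        flip : ∀ i N → i - N ≡ 0ℚ - N + i
        flip = solve-∀ ring
      v≡ : 1ℚ - v ≡ N + a + 1ℚ
      v≡ = by (- 1ℚ) v-terminates (go a v N)
        where
        go : ∀ a v N → 1ℚ - v ≡ N + a + 1ℚ + - 1ℚ * (a + v + N - 0ℚ)
        go = solve-∀ ring
      -- As 1 - v = n + a + 1, both sides are (n + a)ₙ₊₁, split off at either end.
      shift : X * (a + N + N) ≡ (N + a) * Y
      shift = begin
        X * (a + N + N)                            ≡⟨ cong₂ _*_ (sym (pochhammer-Π (N + a) n)) (swap a N) ⟩
        pochhammer (N + a) (suc n)                 ≡⟨ pochhammer-front (N + a) n ⟩
        (N + a) * pochhammer (N + a + 1ℚ) n        ≡⟨ cong (λ z → (N + a) * pochhammer z n) (sym v≡) ⟩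
        (N + a) * pochhammer (1ℚ - v) n            ≡⟨ cong ((N + a) *_) (pochhammer-Π (1ℚ - v) n) ⟩
        (N + a) * Y                                ∎
        where
        swap : ∀ a N → a + N + N ≡ N + a + N
        swap = solve-∀ ring
      lemma : ∀ a N s P F E X A B C D Y → (a + N + N) * (s * (P * F) * (s * E * X) * (A * C * (B * D)))
        ≡ (N + a) * (P * D) * (A * B) + E * F * X * (a + N + N) * P * C * D * A * B * (s * s - 1ℚ)
          + X * (a + N + N) * P * C * D * A * B * (E * F - 1ℚ)
          + P * D * A * B * C * (X * (a + N + N) - (N + a) * Y)
          + P * D * A * B * (N + a) * (Y * C - 1ℚ)
      lemma = solve-∀ ring

-- A reciprocal sum and its recurrence in n

quot-front : ∀ y k → quot y 1ℚ (suc k) * (1ℚ + fromℕ k) ≡ y * quot (y + 1ℚ) 1ℚ k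
quot-front y zero    = by (y) (inv-inverse (1+fromℕ-≢0 0)) (lemma y (inv (1ℚ + 0ℚ)))
  where
  lemma : ∀ y ι → 1ℚ * ((y + 0ℚ) * ι) * (1ℚ + 0ℚ) ≡ y * 1ℚ + y * ((1ℚ + 0ℚ) * ι - 1ℚ)
  lemma = solve-∀ ring
quot-front y (suc k) = by (Q * (y + fromℕ (suc k))) (inv-inverse (1+fromℕ-≢0 (suc k)))
  (by Q (fromℕ-suc k)
    (by (- Q * (y + 1ℚ + K)) (inv-inverse (1+fromℕ-≢0 k))
      (by ((y + 1ℚ + K) * ι) (quot-front y k)
        (lemma y Q (quot (y + 1ℚ) 1ℚ k) K (fromℕ (suc k)) ι (inv (1ℚ + fromℕ (suc k)))))))
  where
  Q = quot y 1ℚ (suc k)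
  K = fromℕ k
  ι = inv (1ℚ + K)
  lemma : ∀ y Q R K K′ ι ι′ → Q * ((y + K′) * ι′) * (1ℚ + K′)
    ≡ y * (R * ((y + 1ℚ + K) * ι)) + Q * (y + K′) * ((1ℚ + K′) * ι′ - 1ℚ)
      + Q * (K′ - (K + 1ℚ))
      + - Q * (y + 1ℚ + K) * ((1ℚ + K) * ι - 1ℚ)
      + (y + 1ℚ + K) * ι * (Q * (1ℚ + K) - y * R)
  lemma = solve-∀ ring

quot-suc-front : ∀ y k → quot y 1ℚ (suc k) ≡ y * quot (y + 1ℚ) 1ℚ k * inv (1ℚ + fromℕ k)
quot-suc-front y k = by₂ (inv (1ℚ + fromℕ k)) (quot-front y k) (- quot y 1ℚ (suc k)) (inv-inverse (1+fromℕ-≢0 k))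
  (lemma y (quot y 1ℚ (suc k)) (quot (y + 1ℚ) 1ℚ k) (1ℚ + fromℕ k) (inv (1ℚ + fromℕ k)))
  where
  lemma : ∀ y Q R K ι → Q ≡ y * R * ι + ι * (Q * K - y * R) + - Q * (K * ι - 1ℚ)
  lemma = solve-∀ ring

-- The hockey-stick identity for generalised binomial coefficients.
Σ<-quot : ∀ y n → Σ< (suc n) (quot y 1ℚ) ≡ quot (y + 1ℚ) 1ℚ n
Σ<-quot y zero    = refl
Σ<-quot y (suc n) = trans (cong₂ _+_ (Σ<-quot y n) (quot-suc-front y n))
  (by (- quot (y + 1ℚ) 1ℚ n) (inv-inverse (1+fromℕ-≢0 n))
      (lemma y (quot (y + 1ℚ) 1ℚ n) (fromℕ n) (inv (1ℚ + fromℕ n))))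
  where
  lemma : ∀ y R N ι → R + y * R * ι ≡ R * ((y + 1ℚ + N) * ι) + - R * ((1ℚ + N) * ι - 1ℚ)
  lemma = solve-∀ ring

quot-reverse : ∀ x n → quot (x - fromℕ n) 1ℚ n ≡ (- 1ℚ) ^ n * quot (1ℚ - x) 1ℚ n
quot-reverse x n = begin
  quot (x - fromℕ n) 1ℚ n                           ≡⟨ Π<-* n _ _ ⟩
  Π< n (λ i → x - fromℕ n + fromℕ i) * F            ≡⟨ cong (_* F) (sym (pochhammer-Π (x - fromℕ n) n)) ⟩
  pochhammer (x - fromℕ n) n * F                    ≡⟨ cong (_* F) (pochhammer-reverse x n) ⟩
  (- 1ℚ) ^ n * pochhammer (1ℚ - x) n * F            ≡⟨ cong (λ z → (- 1ℚ) ^ n * z * F) (pochhammer-Π (1ℚ - x) n) ⟩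
  (- 1ℚ) ^ n * Π< n (λ i → 1ℚ - x + fromℕ i) * F    ≡⟨ *-assoc ((- 1ℚ) ^ n) _ F ⟩
  (- 1ℚ) ^ n * (Π< n (λ i → 1ℚ - x + fromℕ i) * F)  ≡⟨ cong ((- 1ℚ) ^ n *_) (sym (Π<-* n _ _)) ⟩
  (- 1ℚ) ^ n * quot (1ℚ - x) 1ℚ n                   ∎
  where
  open ≡-Reasoning
  F = Π< n (λ i → inv (1ℚ + fromℕ i))

module _ (x : ℚ) where

  private
    φ ψ : ℕ → ℚ
    φ i = inv (1ℚ - - x + fromℕ i)
    ψ i = inv (1ℚ - x + fromℕ i)

    s : ℕ → ℚ
    s = quot (1ℚ - x) 1ℚ

    g A : ℕ → ℚ
    g m = Σ< m (λ i → quot (x - fromℕ m) 1ℚ (suc i) * φ i)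
    A m = Σ< m (λ i → (- 1ℚ) ^ i * (φ i * ψ i))

    -- Passing from m to m + 1 lowers the upper parameter by one. In the combination with
    -- coefficients M and M - x, each numerator becomes a multiple of 1 + x + i and cancels `φ i`;
    -- the hockey-stick identity sums what is left.
    g-suc : ∀ m → (∀ i → i ℕ.≤ m → 1ℚ - - x + fromℕ i ≢ 0ℚ) →
      let M = fromℕ m + 1ℚ; T = quot (x - fromℕ m) 1ℚ (suc m) in
      M * g (suc m) ≡ (M - x) * (g m + T * φ m) + (T - 1ℚ)
    g-suc m x≢ = by 1ℚ sums (move (M * g (suc m)) ((M - x) * g′) (quot (x - fromℕ m) 1ℚ (suc m) - 1ℚ))
      where
      open ≡-Reasoning
      M = fromℕ m + 1ℚ
      z = x - fromℕ (suc m)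
      g′ = Σ< (suc m) (λ i → quot (x - fromℕ m) 1ℚ (suc i) * φ i)
      z+1 : z + 1ℚ ≡ x - fromℕ m
      z+1 = by (- 1ℚ) (fromℕ-suc m) (go x (fromℕ m) (fromℕ (suc m)))
        where
        go : ∀ x m m′ → x - m′ + 1ℚ ≡ x - m + - 1ℚ * (m′ - (m + 1ℚ))
        go = solve-∀ ring
      term : ∀ i → i ℕ.< suc m → M * (quot z 1ℚ (suc i) * φ i) - (M - x) * (quot (x - fromℕ m) 1ℚ (suc i) * φ i)
          ≡ quot z 1ℚ (suc i)
      term i i<1+m = trans
        (cong₂ (λ q b → M * (q * φ i) - (M - x) * (quot b 1ℚ i * ((b + fromℕ i) * inv (1ℚ + fromℕ i)) * φ i))
          (quot-suc-front z i) (sym z+1))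
        (trans (by (z * b * ι) (inv-inverse (x≢ i (ℕₚ.≤-pred i<1+m)))
          (by (b * ι * φ i * z - b * ι * φ i * (z + 1ℚ + fromℕ i))
              (by (- 1ℚ) (fromℕ-suc m) (Mx x (fromℕ m) (fromℕ (suc m))))
            (go x M z (fromℕ i) b ι (φ i)))) (sym (quot-suc-front z i)))
        where
        b = quot (z + 1ℚ) 1ℚ i
        ι = inv (1ℚ + fromℕ i)
        Mx : ∀ x m m′ → m + 1ℚ ≡ x - (x - m′) + - 1ℚ * (m′ - (m + 1ℚ))
        Mx = solve-∀ ring
        go : ∀ x M z i b ι φ → M * (z * b * ι * φ) - (M - x) * (b * ((z + 1ℚ + i) * ι) * φ)
          ≡ z * b * ι + z * b * ι * ((1ℚ - - x + i) * φ - 1ℚ)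
            + (b * ι * φ * z - b * ι * φ * (z + 1ℚ + i)) * (M - (x - z))
        go = solve-∀ ring
      sums : M * g (suc m) - (M - x) * g′ ≡ quot (x - fromℕ m) 1ℚ (suc m) - 1ℚ
      sums = begin
        M * g (suc m) - (M - x) * g′               ≡⟨ Σ<-linear (suc m) M (M - x) _ _ ⟩
        Σ< (suc m) _                               ≡⟨ Σ<-cong (suc m) term ⟩
        Σ< (suc m) (λ i → quot z 1ℚ (suc i))       ≡⟨ by (- 1ℚ) (Σ<-front (suc m) (quot z 1ℚ))
        (drop (Σ< (suc m) (λ i → quot z 1ℚ (suc i)))
        (Σ< (suc (suc m)) (quot z 1ℚ))) ⟩
        Σ< (suc (suc m)) (quot z 1ℚ) - 1ℚ          ≡⟨ cong (_- 1ℚ) (Σ<-quot z (suc m)) ⟩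
        quot (z + 1ℚ) 1ℚ (suc m) - 1ℚ              ≡⟨ cong (λ y → quot y 1ℚ (suc m) - 1ℚ) z+1 ⟩
        quot (x - fromℕ m) 1ℚ (suc m) - 1ℚ         ∎
        where
        drop : ∀ a b → a ≡ b - 1ℚ + - 1ℚ * (b - (1ℚ + a))
        drop = solve-∀ ring
      move : ∀ a b c → a ≡ b + c + 1ℚ * (a - b - c)
      move = solve-∀ ring

  -- The last factor of (x - m)ₘ₊₁ is x itself. It gives the second factor x of the correction in
  -- `reciprocal-sum`.
  central-term : ∀ m → quot (x - fromℕ m) 1ℚ (suc m) ≡ (- 1ℚ) ^ m * s m * (x * inv (1ℚ + fromℕ m))
  central-term m = cong₂ _*_ (quot-reverse x m) (cong (_* inv (1ℚ + fromℕ m)) (cancel x (fromℕ m)))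
    where
    cancel : ∀ x m → x - m + m ≡ x
    cancel = solve-∀ ring

  -- The upper parameter is x - n instead of a fixed a, so that the induction can vary n while x
  -- stays fixed. For x = n + a it is a again.
  reciprocal-sum : ∀ n → (∀ i → i ℕ.< n → 1ℚ - - x + fromℕ i ≢ 0ℚ) → (∀ i → i ℕ.< n → 1ℚ - x + fromℕ i ≢ 0ℚ) →
    1ℚ + x * Σ< n (λ i → quot (x - fromℕ n) 1ℚ (suc i) * inv (1ℚ - - x + fromℕ i))
    ≡ quot (1ℚ - x) 1ℚ n * (1ℚ + (1ℚ + 1ℚ) * x * x * Σ< n
        (λ i → (- 1ℚ) ^ i * (inv (1ℚ - - x + fromℕ i) * inv (1ℚ - x + fromℕ i))))
  reciprocal-sum zero    _   _   = lemma x
    where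
    lemma : ∀ x → 1ℚ + x * 0ℚ ≡ 1ℚ * (1ℚ + (1ℚ + 1ℚ) * x * x * 0ℚ)
    lemma = solve-∀ ring
  reciprocal-sum (suc m) x≢ x≢′ =
    *-cancelʳ-≡ (1ℚ + K) (1+fromℕ-≢0 m)
      (by x (g-suc m (λ i i≤m → x≢ i (s≤s i≤m)))
        (by (1ℚ + K - x) (reciprocal-sum m (λ i i<m → x≢ i (ℕₚ.m<n⇒m<1+n i<m)) (λ i i<m → x≢′ i (ℕₚ.m<n⇒m<1+n i<m)))
          (by (x * ((1ℚ + K - x) * φ m + 1ℚ)) (central-term m)
            (by (- (x * σ * s m * (x * ι))) (inv-inverse (x≢ m ℕₚ.≤-refl))
              (by (- (1ℚ - x + K) * s m * (1ℚ + (1ℚ + 1ℚ) * x * x * (A m + σ * (φ m * ψ m)))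
                   + (1ℚ + 1ℚ) * x * x * σ * s m * φ m) (inv-inverse (1+fromℕ-≢0 m))
                (by (- ((1ℚ + 1ℚ) * x * x * σ * s m * φ m)) (inv-inverse (x≢′ m ℕₚ.≤-refl))
                  (lemma x K (g (suc m)) (g m) (quot (x - fromℕ m) 1ℚ (suc m)) (φ m) (ψ m) ι σ (s m) (A m))))))))
    where
    K = fromℕ m
    ι = inv (1ℚ + K)
    σ = (- 1ℚ) ^ m
    lemma : ∀ x K g′ g T φ ψ ι σ s A → (1ℚ + x * g′) * (1ℚ + K)
      ≡ s * ((1ℚ - x + K) * ι) * (1ℚ + (1ℚ + 1ℚ) * x * x * (A + σ * (φ * ψ))) * (1ℚ + K)
        + x * ((K + 1ℚ) * g′ - ((K + 1ℚ - x) * (g + T * φ) + (T - 1ℚ)))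
        + (1ℚ + K - x) * (1ℚ + x * g - s * (1ℚ + (1ℚ + 1ℚ) * x * x * A))
        + x * ((1ℚ + K - x) * φ + 1ℚ) * (T - σ * s * (x * ι))
        + - (x * σ * s * (x * ι)) * ((1ℚ - - x + K) * φ - 1ℚ)
        + (- (1ℚ - x + K) * s * (1ℚ + (1ℚ + 1ℚ) * x * x * (A + σ * (φ * ψ)))
           + (1ℚ + 1ℚ) * x * x * σ * s * φ) * ((1ℚ + K) * ι - 1ℚ)
        + - ((1ℚ + 1ℚ) * x * x * σ * s * φ) * ((1ℚ - x + K) * ψ - 1ℚ)
    lemma = solve-∀ ring

-- Congruences between rational numbers

module _ {p : ℕ} (p-prime : Prime p) where

  p∤1 : p ∤ 1
  p∤1 p∣1 = ¬prime[1] (subst Prime (∣.∣1⇒≡1 p∣1) p-prime)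

  ∤-* : ∀ {m n} → p ∤ m → p ∤ n → p ∤ m ℕ.* n
  ∤-* {m} {n} p∤m p∤n p∣mn = [ p∤m , p∤n ]′ (euclidsLemma m n p-prime p∣mn)

  -- Before reduction, a sum or product has denominator ↧ x times ↧ y; d is the factor lost in
  -- reduction, so the reduced denominator divides that product.
  ∈-by-denominators : ∀ {x y z} d → ↧ z ℤ.* d ≡ ↧ x ℤ.* ↧ y → x ∈ℤ[ p ] → y ∈ℤ[ p ] → z ∈ℤ[ p ]
  ∈-by-denominators {x} {y} {z} d eq x∈ y∈ p∣z = ∤-* x∈ y∈
    (subst (p ∣_) (trans (sym (ℤₚ.abs-* (↧ z) d)) (trans (cong ℤ.∣_∣ eq) (ℤₚ.abs-* (↧ x) (↧ y))))
      (∣.∣m⇒∣m*n ℤ.∣ d ∣ p∣z))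

  ∈-+ : ∀ {x y} → x ∈ℤ[ p ] → y ∈ℤ[ p ] → x + y ∈ℤ[ p ]
  ∈-+ {x} {y} = ∈-by-denominators {x} {y} {x + y} _ (↧-+ x y)

  ∈-* : ∀ {x y} → x ∈ℤ[ p ] → y ∈ℤ[ p ] → x * y ∈ℤ[ p ]
  ∈-* {x} {y} = ∈-by-denominators {x} {y} {x * y} _ (↧-* x y)

  ∈-neg : ∀ {x} → x ∈ℤ[ p ] → - x ∈ℤ[ p ]
  ∈-neg {x} x∈ = subst (λ d → p ∤ ℤ.∣ d ∣) (sym (↧-neg x)) x∈

  ∈-fromℕ : ∀ n → fromℕ n ∈ℤ[ p ]
  ∈-fromℕ n = p∤1

  infix 4 _≋_

  -- Congruence modulo p on ℤ₍ₚ₎, as a partial equivalence relation on ℚ: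
  -- integrality of both sides is part of the relation.
  record _≋_ (x y : ℚ) : Set where
    constructor mk≋
    field
      ∈ˡ       : x ∈ℤ[ p ]
      ∈ʳ       : y ∈ℤ[ p ]
      cofactor : ℚ
      ∈-cof    : cofactor ∈ℤ[ p ]
      diff     : x - y ≡ fromℕ p * cofactor

  open _≋_ public

  -- The condition x ≢ 0 keeps out zero, whose `inv` is the integral number 0.
  Unit : ℚ → Set
  Unit x = x ≢ 0ℚ × x ∈ℤ[ p ] × inv x ∈ℤ[ p ]

  unit : ∀ {x} → x ∈ℤ[ p ] → ∀ y → y ∈ℤ[ p ] → x * y ≡ 1ℚ → Unit x
  unit x∈ y y∈ xy≡1 = *≡1⇒≢0 xy≡1 , x∈ , subst (_∈ℤ[ p ]) (sym (inv-unique xy≡1)) y∈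

  unit-fromℕ : ∀ n → p ∤ n → Unit (fromℕ n)
  unit-fromℕ zero    p∤0 = ⊥-elim (p∤0 (p ∣.∣0))
  unit-fromℕ (suc n) p∤n = unit (∈-fromℕ (suc n)) (1/ fromℕ (suc n)) p∤n (*-inverseʳ (fromℕ (suc n)))

  unit-* : ∀ {x y} → Unit x → Unit y → Unit (x * y)
  unit-* {x} {y} (x≢0 , x∈ , ix∈) (y≢0 , y∈ , iy∈) =
    *-≢0 x≢0 y≢0 , ∈-* {x} {y} x∈ y∈ , subst (_∈ℤ[ p ]) (sym (inv-* x≢0 y≢0)) (∈-* {inv x} {inv y} ix∈ iy∈)

  unit-neg : ∀ {x} → Unit x → Unit (- x)
  unit-neg {x} (x≢0 , x∈ , ix∈) = unit (∈-neg {x} x∈) (- inv x) (∈-neg {inv x} ix∈)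
      (trans (lemma x (inv x)) (inv-inverse x≢0))
    where
    lemma : ∀ x y → - x * - y ≡ x * y
    lemma = solve-∀ ring

  unit-Π : ∀ n {f} → (∀ i → i ℕ.< n → Unit (f i)) → Unit (Π< n f)
  unit-Π zero    u = unit (∈-fromℕ 1) 1ℚ (∈-fromℕ 1) refl
  unit-Π (suc n) u = unit-* (unit-Π n λ i i<n → u i (ℕₚ.m<n⇒m<1+n i<n)) (u n ℕₚ.≤-refl)

  ≋-refl : ∀ {x} → x ∈ℤ[ p ] → x ≋ x
  ≋-refl {x} x∈ = mk≋ x∈ x∈ 0ℚ (∈-fromℕ 0) (lemma x (fromℕ p))
    where
    lemma : ∀ x q → x - x ≡ q * 0ℚ
    lemma = solve-∀ ring

  ≋-fromℕ : ∀ n → fromℕ n ≋ fromℕ n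
  ≋-fromℕ n = ≋-refl (∈-fromℕ n)

  ≋-reflexive : ∀ {x y} → x ∈ℤ[ p ] → x ≡ y → x ≋ y
  ≋-reflexive x∈ refl = ≋-refl x∈

  ≋-sym : ∀ {x y} → x ≋ y → y ≋ x
  ≋-sym {x} {y} (mk≋ x∈ y∈ z z∈ eq) = mk≋ y∈ x∈ (- z) (∈-neg {z} z∈) (by (- 1ℚ) eq (lemma x y z (fromℕ p)))
    where
    lemma : ∀ x y z q → y - x ≡ q * - z + - 1ℚ * (x - y - q * z)
    lemma = solve-∀ ring

  ≋-trans : ∀ {x y z} → x ≋ y → y ≋ z → x ≋ z
  ≋-trans {x} {y} {z} (mk≋ x∈ y∈ u u∈ eq) (mk≋ _ z∈ v v∈ eq′) =
    mk≋ x∈ z∈ (u + v) (∈-+ {u} {v} u∈ v∈) (by₂ 1ℚ eq 1ℚ eq′ (lemma x y z u v (fromℕ p)))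
    where
    lemma : ∀ x y z u v q → x - z ≡ q * (u + v) + 1ℚ * (x - y - q * u) + 1ℚ * (y - z - q * v)
    lemma = solve-∀ ring

  ≋-+ : ∀ {x x′ y y′} → x ≋ x′ → y ≋ y′ → x + y ≋ x′ + y′
  ≋-+ {x} {x′} {y} {y′} (mk≋ x∈ x′∈ u u∈ eq) (mk≋ y∈ y′∈ v v∈ eq′) =
    mk≋ (∈-+ {x} x∈ y∈) (∈-+ {x′} x′∈ y′∈) (u + v) (∈-+ {u} {v} u∈ v∈)
      (by₂ 1ℚ eq 1ℚ eq′ (lemma x x′ y y′ u v (fromℕ p)))
    where
    lemma : ∀ x x′ y y′ u v q → x + y - (x′ + y′) ≡ q * (u + v) + 1ℚ * (x - x′ - q * u) + 1ℚ * (y - y′ - q * v)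
    lemma = solve-∀ ring

  ≋-* : ∀ {x x′ y y′} → x ≋ x′ → y ≋ y′ → x * y ≋ x′ * y′
  ≋-* {x} {x′} {y} {y′} (mk≋ x∈ x′∈ u u∈ eq) (mk≋ y∈ y′∈ v v∈ eq′) =
    mk≋ (∈-* {x} x∈ y∈) (∈-* {x′} x′∈ y′∈) (u * y + x′ * v) (∈-+ {u * y} (∈-* {u} u∈ y∈) (∈-* {x′} x′∈ v∈))
      (by₂ y eq x′ eq′ (lemma x x′ y y′ u v (fromℕ p)))
    where
    lemma : ∀ x x′ y y′ u v q → x * y - x′ * y′ ≡ q * (u * y + x′ * v) + y * (x - x′ - q * u) + x′ * (y - y′ - q * v)
    lemma = solve-∀ ring

  ≋-neg : ∀ {x x′} → x ≋ x′ → - x ≋ - x′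
  ≋-neg {x} {x′} (mk≋ x∈ x′∈ u u∈ eq) = mk≋ (∈-neg {x} x∈) (∈-neg {x′} x′∈) (- u) (∈-neg {u} u∈)
    (by (- 1ℚ) eq (lemma x x′ u (fromℕ p)))
    where
    lemma : ∀ x x′ u q → - x - - x′ ≡ q * - u + - 1ℚ * (x - x′ - q * u)
    lemma = solve-∀ ring

  ≋-- : ∀ {x x′ y y′} → x ≋ x′ → y ≋ y′ → x - y ≋ x′ - y′
  ≋-- x≋ y≋ = ≋-+ x≋ (≋-neg y≋)

  ≋-inv : ∀ {x y} → Unit x → Unit y → x ≋ y → inv x ≋ inv y
  ≋-inv {x} {y} (x≢0 , _ , ix∈) (y≢0 , _ , iy∈) (mk≋ _ _ u u∈ eq) =
    mk≋ ix∈ iy∈ (- u * (inv x * inv y)) (∈-* {(- u)} (∈-neg {u} u∈) (∈-* {inv x} ix∈ iy∈))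
      (by (- (inv x * inv y)) eq (by₂ (inv y) (inv-inverse x≢0) (- inv x) (inv-inverse y≢0)
          (lemma x y (inv x) (inv y) u (fromℕ p))))
    where
    lemma : ∀ x y i j u q → i - j ≡ q * (- u * (i * j)) + - (i * j) * (x - y - q * u) + j * (x * i - 1ℚ) + - i *
        (y * j - 1ℚ)
    lemma = solve-∀ ring

  ≋-cancel : ∀ {x y} z → Unit z → x ∈ℤ[ p ] → y ∈ℤ[ p ] → x * z ≋ y * z → x ≋ y
  ≋-cancel {x} {y} z (z≢0 , _ , iz∈) x∈ y∈ (mk≋ _ _ u u∈ eq) = mk≋ x∈ y∈ (u * inv z) (∈-* {u} u∈ iz∈)
    (by₂ (inv z) eq (- (x - y)) (inv-inverse z≢0) (lemma x y z (inv z) u (fromℕ p)))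
    where
    lemma : ∀ x y z i u q → x - y ≡ q * (u * i) + i * (x * z - y * z - q * u) + - (x - y) * (z * i - 1ℚ)
    lemma = solve-∀ ring

  ≋-p* : ∀ {x} → x ∈ℤ[ p ] → fromℕ p * x ≋ 0ℚ
  ≋-p* {x} x∈ = mk≋ (∈-* {fromℕ p} {x} (∈-fromℕ p) x∈) (∈-fromℕ 0) x x∈ (lemma x (fromℕ p))
    where
    lemma : ∀ x q → q * x - 0ℚ ≡ q * x
    lemma = solve-∀ ring

  ≋-Σ : ∀ n {f g} → (∀ i → i ℕ.< n → f i ≋ g i) → Σ< n f ≋ Σ< n g
  ≋-Σ zero    eq = ≋-refl (∈-fromℕ 0)
  ≋-Σ (suc n) eq = ≋-+ (≋-Σ n λ i i<n → eq i (ℕₚ.m<n⇒m<1+n i<n)) (eq n ℕₚ.≤-refl)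

  ≋-Π : ∀ n {f g} → (∀ i → i ℕ.< n → f i ≋ g i) → Π< n f ≋ Π< n g
  ≋-Π zero    eq = ≋-refl (∈-fromℕ 1)
  ≋-Π (suc n) eq = ≋-* (≋-Π n λ i i<n → eq i (ℕₚ.m<n⇒m<1+n i<n)) (eq n ℕₚ.≤-refl)

  ≋-^ : ∀ n {x y} → x ≋ y → x ^ n ≋ y ^ n
  ≋-^ zero    eq = ≋-refl (∈-fromℕ 1)
  ≋-^ (suc n) eq = ≋-* eq (≋-^ n eq)

  -- Reversing the order of summation gives S ≡ -S, and 2 is a unit.
  Σ-antisymmetric : p ∤ 2 → ∀ n {f} → (∀ i → i ℕ.< n → f (n ∸ suc i) ≋ - f i) → Σ< n f ≋ 0ℚ
  Σ-antisymmetric p∤2 n {f} anti = ≋-cancel (fromℕ 2) (unit-fromℕ 2 p∤2) S∈ (∈-fromℕ 0)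
    (mk≋ (∈-* {S} S∈ (∈-fromℕ 2)) (∈-fromℕ 0) (cofactor S≋-S) (∈-cof S≋-S)
        (by 1ℚ (diff S≋-S) (lemma S (fromℕ p) (cofactor S≋-S))))
    where
    S = Σ< n f
    S≋-S : S ≋ - S
    S≋-S = subst₂ _≋_ (sym (Σ<-reverse n f)) (trans (trans (Σ<-cong n λ i _ → neg (f i)) (Σ<-*ˡ n (- 1ℚ) f))
        (sym (neg S))) (≋-Σ n anti)
      where
      neg : ∀ x → - x ≡ - 1ℚ * x
      neg = solve-∀ ring
    S∈ = ∈ˡ S≋-S
    lemma : ∀ s q c → s * (1ℚ + 1ℚ) - 0ℚ ≡ q * c + 1ℚ * (s - - s - q * c)
    lemma = solve-∀ ring

-- Euler polynomials modulo p

*ₛ-Σ< : ∀ f g n → (f *ₛ g) n ≡ Σ< (suc n) (λ i → f i * g (n ∸ i))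
*ₛ-Σ< f g n = ∑≡Σ< n (λ i → f i * g (n ∸ i))

*ₛ-distribʳ : ∀ f g h n → ((f +ₛ g) *ₛ h) n ≡ (f *ₛ h) n + (g *ₛ h) n
*ₛ-distribʳ f g h n = trans (*ₛ-Σ< (f +ₛ g) h n) (trans
  (Σ<-cong (suc n) (λ i _ → *-distribʳ-+ (h (n ∸ i)) (f i) (g i)))
  (trans (Σ<-+ (suc n) _ _) (sym (cong₂ _+_ (*ₛ-Σ< f h n) (*ₛ-Σ< g h n)))))

*ₛ-distribˡ : ∀ f g h n → (f *ₛ (g +ₛ h)) n ≡ (f *ₛ g) n + (f *ₛ h) n
*ₛ-distribˡ f g h n = trans (*ₛ-Σ< f (g +ₛ h) n) (trans
  (Σ<-cong (suc n) (λ i _ → *-distribˡ-+ (f i) (g (n ∸ i)) (h (n ∸ i))))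
  (trans (Σ<-+ (suc n) _ _) (sym (cong₂ _+_ (*ₛ-Σ< f g n) (*ₛ-Σ< f h n)))))

·ₛ-*ₛ : ∀ c f g n → ((c ·ₛ f) *ₛ g) n ≡ c * (f *ₛ g) n
·ₛ-*ₛ c f g n = trans (*ₛ-Σ< (c ·ₛ f) g n) (trans
  (Σ<-cong (suc n) (λ i _ → *-assoc c (f i) (g (n ∸ i))))
  (trans (Σ<-*ˡ (suc n) c _) (cong (c *_) (sym (*ₛ-Σ< f g n)))))

*ₛ-identityʳ : ∀ f n → (f *ₛ 1ₛ) n ≡ f n
*ₛ-identityʳ f n = trans (*ₛ-Σ< f 1ₛ n) (trans
  (cong₂ _+_ (Σ<-0 n λ i i<n → trans (cong (λ m → f i * 1ₛ m) (ℕₚ.+-∸-assoc 1 i<n)) (*-zeroʳ (f i)))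
             (cong (λ m → f n * 1ₛ m) (ℕₚ.n∸n≡0 n)))
  (lemma (f n)))
  where
  lemma : ∀ y → 0ℚ + y * 1ℚ ≡ y
  lemma = solve-∀ ring

÷ₛ-unique : ∀ f g h .{{_ : NonZero (g 0)}} → (∀ n → f n ≡ (h *ₛ g) n) → ∀ n → (f ÷ₛ g) n ≡ h n
÷ₛ-unique f g h eq zero = begin
  f 0 ÷ g 0                    ≡⟨ cong (_÷ g 0) (trans (eq 0) (+-identityʳ (h 0 * g 0))) ⟩
  h 0 * g 0 * 1/ g 0           ≡⟨ *-assoc (h 0) (g 0) (1/ g 0) ⟩
  h 0 * (g 0 * 1/ g 0)         ≡⟨ cong (h 0 *_) (*-inverseʳ (g 0)) ⟩
  h 0 * 1ℚ                     ≡⟨ *-identityʳ (h 0) ⟩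
  h 0                          ∎
  where open ≡-Reasoning
÷ₛ-unique f g h eq (suc n) = ÷ₛ-unique _ g (λ m → h (suc m)) (λ m → begin
  f (suc m) - f 0 ÷ g 0 * g (suc m)
      ≡⟨ cong₂ (λ y c → y - c * g (suc m)) (eq (suc m)) (÷ₛ-unique f g h eq 0) ⟩
  h 0 * g (suc m) + ((λ i → h (suc i)) *ₛ g) m - h 0 * g (suc m)
      ≡⟨ lemma (h 0 * g (suc m)) (((λ i → h (suc i)) *ₛ g) m) ⟩
  ((λ i → h (suc i)) *ₛ g) m                                             ∎) n
  where
  open ≡-Reasoning
  lemma : ∀ y z → y + z - y ≡ z
  lemma = solve-∀ ring

fromℕ-!≢0 : ∀ n → fromℕ (n ℕ.!) ≢ 0ℚ
fromℕ-!≢0 n = fromℕ-≢0 (n ℕ.!) {{n ℕₚ.!≢0}}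

exp≡ : ∀ x n → exp x n ≡ x ^ n * inv (fromℕ (n ℕ.!))
exp≡ x n = ÷-*-inv (x ^ n) (fromℕ (n ℕ.!)) {{n ℕₚ.!≢0}}

exp-suc : ∀ x n → fromℕ (suc n) * exp x (suc n) ≡ x * exp x n
exp-suc x n = begin
  fromℕ (suc n) * exp x (suc n)
      ≡⟨ cong (fromℕ (suc n) *_) (trans (exp≡ x (suc n))
        (cong (λ y → x ^ suc n * inv y)
        (fromℕ-* (suc n) (n ℕ.!)))) ⟩
  fromℕ (suc n) * (x ^ suc n * inv (fromℕ (suc n) * fromℕ (n ℕ.!)))
      ≡⟨ cong (λ y → fromℕ (suc n) * (x ^ suc n * y)) (inv-* (fromℕ-≢0 (suc n)) (fromℕ-!≢0 n)) ⟩
  fromℕ (suc n) * (x ^ suc n * (inv (fromℕ (suc n)) * inv (fromℕ (n ℕ.!))))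
      ≡⟨ by (x * x ^ n * inv (fromℕ (n ℕ.!))) (inv-inverse (fromℕ-≢0 (suc n)))
        (lemma x (x ^ n) (fromℕ (suc n))
        (inv (fromℕ (suc n)))
        (inv (fromℕ (n ℕ.!)))) ⟩
  x * (x ^ n * inv (fromℕ (n ℕ.!)))                                      ≡⟨ cong (x *_) (sym (exp≡ x n)) ⟩
  x * exp x n                                                            ∎
  where
  open ≡-Reasoning
  lemma : ∀ x y k i f → k * (x * y * (i * f)) ≡ x * (y * f) + x * y * f * (k * i - 1ℚ)
  lemma = solve-∀ ring

-- The product rule on coefficients: multiplying by n + 1 = i + (n + 1 - i) differentiates both
-- factors, and each half is x or y times the coefficient of index n.
exp-+ : ∀ x y n → (exp x *ₛ exp y) n ≡ exp (x + y) n
exp-+ x y zero    = refl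
exp-+ x y (suc n) = *-cancelʳ-≡ (fromℕ (suc n)) (fromℕ-≢0 (suc n)) (begin
  (exp x *ₛ exp y) (suc n) * fromℕ (suc n)
    ≡⟨ trans (*-comm ((exp x *ₛ exp y) (suc n)) (fromℕ (suc n)))
        (cong (fromℕ (suc n) *_) (*ₛ-Σ< (exp x) (exp y) (suc n))) ⟩
  fromℕ (suc n) * Σ< (2 ℕ.+ n) (λ i → exp x i * exp y (suc n ∸ i))
    ≡⟨ sym (Σ<-*ˡ (2 ℕ.+ n) (fromℕ (suc n)) _) ⟩
  Σ< (2 ℕ.+ n) (λ i → fromℕ (suc n) * (exp x i * exp y (suc n ∸ i)))
    ≡⟨ Σ<-cong (2 ℕ.+ n) (λ i i<2+n → by (- (exp x i * exp y (suc n ∸ i))) (fromℕ-∸ (ℕₚ.≤-pred i<2+n))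
         (split (fromℕ (suc n)) (fromℕ i) (fromℕ (suc n ∸ i)) (exp x i) (exp y (suc n ∸ i)))) ⟩
  Σ< (2 ℕ.+ n) (λ i → fromℕ i * exp x i * exp y (suc n ∸ i) + exp x i * (fromℕ (suc n ∸ i) * exp y (suc n ∸ i)))
    ≡⟨ Σ<-+ (2 ℕ.+ n) _ _ ⟩
  Σ< (2 ℕ.+ n) (λ i → fromℕ i * exp x i * exp y (suc n ∸ i)) + Σ< (2 ℕ.+ n)
      (λ i → exp x i * (fromℕ (suc n ∸ i) * exp y (suc n ∸ i)))
    ≡⟨ cong₂ _+_ left right ⟩
  x * E + y * E
    ≡⟨ sym (*-distribʳ-+ E x y) ⟩
  (x + y) * E
    ≡⟨ cong ((x + y) *_) (trans (sym (*ₛ-Σ< (exp x) (exp y) n)) (exp-+ x y n)) ⟩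
  (x + y) * exp (x + y) n
    ≡⟨ sym (exp-suc (x + y) n) ⟩
  fromℕ (suc n) * exp (x + y) (suc n)
    ≡⟨ *-comm (fromℕ (suc n)) (exp (x + y) (suc n)) ⟩
  exp (x + y) (suc n) * fromℕ (suc n) ∎)
  where
  open ≡-Reasoning
  E = Σ< (suc n) (λ i → exp x i * exp y (n ∸ i))
  split : ∀ N i d u v → N * (u * v) ≡ i * u * v + u * (d * v) + - (u * v) * (d - (N - i))
  split = solve-∀ ring
  left : Σ< (2 ℕ.+ n) (λ i → fromℕ i * exp x i * exp y (suc n ∸ i)) ≡ x * E
  left = begin
    Σ< (2 ℕ.+ n) (λ i → fromℕ i * exp x i * exp y (suc n ∸ i))
      ≡⟨ Σ<-front (suc n) _ ⟩
    0ℚ * exp x 0 * exp y (suc n) + Σ< (suc n) (λ i → fromℕ (suc i) * exp x (suc i) * exp y (n ∸ i))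
      ≡⟨ cong₂ _+_ (zeros (exp x 0) (exp y (suc n)))
           (Σ<-cong (suc n) λ i _ → trans (cong (_* exp y (n ∸ i)) (exp-suc x i))
               (*-assoc x (exp x i) (exp y (n ∸ i)))) ⟩
    0ℚ + Σ< (suc n) (λ i → x * (exp x i * exp y (n ∸ i)))
      ≡⟨ trans (+-identityˡ _) (Σ<-*ˡ (suc n) x _) ⟩
    x * E ∎
    where
    zeros : ∀ u v → 0ℚ * u * v ≡ 0ℚ
    zeros = solve-∀ ring
  right : Σ< (2 ℕ.+ n) (λ i → exp x i * (fromℕ (suc n ∸ i) * exp y (suc n ∸ i))) ≡ y * E
  right = begin
    Σ< (suc n) (λ i → exp x i * (fromℕ (suc n ∸ i) * exp y (suc n ∸ i))) + exp x (suc n) *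
        (fromℕ (n ∸ n) * exp y (n ∸ n))
      ≡⟨ cong₂ _+_
           (Σ<-cong (suc n) λ i i<1+n → trans (cong (λ m → exp x i * (fromℕ m * exp y m))
               (ℕₚ.+-∸-assoc 1 (ℕₚ.≤-pred i<1+n)))
             (trans (cong (exp x i *_) (exp-suc y (n ∸ i))) (swap (exp x i) y (exp y (n ∸ i)))))
           (trans (cong (λ m → exp x (suc n) * (fromℕ m * exp y m)) (ℕₚ.n∸n≡0 n)) (zeros (exp x (suc n)) (exp y 0))) ⟩
    Σ< (suc n) (λ i → y * (exp x i * exp y (n ∸ i))) + 0ℚ
      ≡⟨ trans (+-identityʳ _) (Σ<-*ˡ (suc n) y _) ⟩
    y * E ∎
    where
    zeros : ∀ u v → u * (0ℚ * v) ≡ 0ℚ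
    zeros = solve-∀ ring
    swap : ∀ u y v → u * (y * v) ≡ y * (u * v)
    swap = solve-∀ ring

eulerSeries : ℚ → Series
eulerSeries x = (fromℕ 2 ·ₛ exp x) ÷ₛ (exp 1ℚ +ₛ 1ₛ)

-- The series 2 e^{xt} + 2 e^{(x+1)t} = 2 e^{xt} (e^t + 1) is divided by e^t + 1 in two ways;
-- quotients are unique.
eulerSeries-shift : ∀ x n → eulerSeries x n + eulerSeries (x + 1ℚ) n ≡ fromℕ 2 * exp x n
eulerSeries-shift x n = trans (sym (÷ₛ-unique f D (eulerSeries x +ₛ eulerSeries (x + 1ℚ)) sum n))
    (÷ₛ-unique f D (fromℕ 2 ·ₛ exp x) product n)
  where
  D f : Series
  D = exp 1ℚ +ₛ 1ₛ
  f = (fromℕ 2 ·ₛ exp x) +ₛ (fromℕ 2 ·ₛ exp (x + 1ℚ))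
  sum : ∀ n → f n ≡ ((eulerSeries x +ₛ eulerSeries (x + 1ℚ)) *ₛ D) n
  sum n = sym (trans (*ₛ-distribʳ (eulerSeries x) (eulerSeries (x + 1ℚ)) D n)
    (cong₂ _+_ (÷ₛ-*ₛ-cancel (fromℕ 2 ·ₛ exp x) D n) (÷ₛ-*ₛ-cancel (fromℕ 2 ·ₛ exp (x + 1ℚ)) D n)))
  product : ∀ n → f n ≡ ((fromℕ 2 ·ₛ exp x) *ₛ D) n
  product n = sym (begin
    ((fromℕ 2 ·ₛ exp x) *ₛ D) n                                   ≡⟨ ·ₛ-*ₛ (fromℕ 2) (exp x) D n ⟩
    fromℕ 2 * (exp x *ₛ D) n
        ≡⟨ cong (fromℕ 2 *_) (*ₛ-distribˡ (exp x) (exp 1ℚ) 1ₛ n) ⟩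
    fromℕ 2 * ((exp x *ₛ exp 1ℚ) n + (exp x *ₛ 1ₛ) n)
        ≡⟨ cong₂ (λ u v → fromℕ 2 * (u + v)) (exp-+ x 1ℚ n) (*ₛ-identityʳ (exp x) n) ⟩
    fromℕ 2 * (exp (x + 1ℚ) n + exp x n)                          ≡⟨ lemma (fromℕ 2) (exp (x + 1ℚ) n) (exp x n) ⟩
    fromℕ 2 * exp x n + fromℕ 2 * exp (x + 1ℚ) n                  ∎)
    where
    open ≡-Reasoning
    lemma : ∀ t u v → t * (u + v) ≡ t * v + t * u
    lemma = solve-∀ ring

euler-shift : ∀ n x → euler n x + euler n (x + 1ℚ) ≡ fromℕ 2 * x ^ n
euler-shift n x = begin
  fromℕ (n ℕ.!) * eulerSeries x n + fromℕ (n ℕ.!) * eulerSeries (x + 1ℚ) n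
      ≡⟨ sym (*-distribˡ-+ (fromℕ (n ℕ.!)) (eulerSeries x n) (eulerSeries (x + 1ℚ) n)) ⟩
  fromℕ (n ℕ.!) * (eulerSeries x n + eulerSeries (x + 1ℚ) n)
      ≡⟨ cong (fromℕ (n ℕ.!) *_) (trans (eulerSeries-shift x n) (cong (fromℕ 2 *_) (exp≡ x n))) ⟩
  fromℕ (n ℕ.!) * (fromℕ 2 * (x ^ n * inv (fromℕ (n ℕ.!))))
      ≡⟨ by (fromℕ 2 * x ^ n) (inv-inverse (fromℕ-!≢0 n))
      (lemma (fromℕ (n ℕ.!)) (inv (fromℕ (n ℕ.!))) (fromℕ 2) (x ^ n)) ⟩
  fromℕ 2 * x ^ n                                                            ∎
  where
  open ≡-Reasoning
  lemma : ∀ f i t y → f * (t * (y * i)) ≡ t * y + t * y * (f * i - 1ℚ)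
  lemma = solve-∀ ring

euler-telescope : ∀ n x m → euler n x ≡ Σ< m (λ k → (- 1ℚ) ^ k * (fromℕ 2 * (x + fromℕ k) ^ n)) + (- 1ℚ) ^ m *
    euler n (x + fromℕ m)
euler-telescope n x zero    = trans (cong (euler n) (sym (+-identityʳ x))) (lemma (euler n (x + 0ℚ)))
  where
  lemma : ∀ y → y ≡ 0ℚ + 1ℚ * y
  lemma = solve-∀ ring
euler-telescope n x (suc m) = begin
  euler n x
    ≡⟨ euler-telescope n x m ⟩
  S + s * euler n (x + fromℕ m)
    ≡⟨ by s (euler-shift n (x + fromℕ m)) (lemma S s (euler n (x + fromℕ m)) (euler n (x + fromℕ m + 1ℚ))
        (fromℕ 2 * (x + fromℕ m) ^ n)) ⟩
  S + s * (fromℕ 2 * (x + fromℕ m) ^ n) + - 1ℚ * s * euler n (x + fromℕ m + 1ℚ)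
    ≡⟨ cong (λ y → S + s * (fromℕ 2 * (x + fromℕ m) ^ n) + - 1ℚ * s * euler n y)
         (trans (+-assoc x (fromℕ m) 1ℚ) (cong (_+_ x) (sym (fromℕ-suc m)))) ⟩
  S + s * (fromℕ 2 * (x + fromℕ m) ^ n) + - 1ℚ * s * euler n (x + fromℕ (suc m)) ∎
  where
  open ≡-Reasoning
  s = (- 1ℚ) ^ m
  S = Σ< m (λ k → (- 1ℚ) ^ k * (fromℕ 2 * (x + fromℕ k) ^ n))
  lemma : ∀ S s e e′ t → S + s * e ≡ S + s * t + - 1ℚ * s * e′ + s * (e + e′ - t)
  lemma = solve-∀ ring

1^n≡1 : ∀ n → 1ℚ ^ n ≡ 1ℚ
1^n≡1 zero    = refl
1^n≡1 (suc n) = trans (*-identityˡ (1ℚ ^ n)) (1^n≡1 n)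

*-^ : ∀ n x y → (x * y) ^ n ≡ x ^ n * y ^ n
*-^ zero    x y = refl
*-^ (suc n) x y = trans (cong (x * y *_) (*-^ n x y)) (lemma x y (x ^ n) (y ^ n))
  where
  lemma : ∀ x y u v → x * y * (u * v) ≡ x * u * (y * v)
  lemma = solve-∀ ring

neg-^-even : ∀ n → (- 1ℚ) ^ n ≡ 1ℚ → ∀ x → (- x) ^ n ≡ x ^ n
neg-^-even n even x = trans (cong (_^ n) (lemma x)) (trans (*-^ n (- 1ℚ) x)
  (trans (cong (_* x ^ n) even) (*-identityˡ (x ^ n))))
  where
  lemma : ∀ x → - x ≡ - 1ℚ * x
  lemma = solve-∀ ring

!*exp : ∀ x n → fromℕ (n ℕ.!) * exp x n ≡ x ^ n
!*exp x n = trans (cong (fromℕ (n ℕ.!) *_) (exp≡ x n)) (by (x ^ n) (inv-inverse (fromℕ-!≢0 n))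
    (lemma (fromℕ (n ℕ.!)) (inv (fromℕ (n ℕ.!))) (x ^ n)))
  where
  lemma : ∀ f i y → f * (y * i) ≡ y + y * (f * i - 1ℚ)
  lemma = solve-∀ ring

module _ {p : ℕ} (p-prime : Prime p) where

  private
    infix 4 _≈_
    _≈_ : ℚ → ℚ → Set
    _≈_ = _≋_ p-prime

  -- Long division inverts only the constant term of g, so integrality and congruences pass to the
  -- quotient when that term is a unit.
  ÷ₛ-≋ : ∀ n f f′ g .{{_ : NonZero (g 0)}} → Unit p-prime (g 0) → (∀ i → i ℕ.≤ n → g i ≈ g i) →
    (∀ i → i ℕ.≤ n → f i ≈ f′ i) → (f ÷ₛ g) n ≈ (f′ ÷ₛ g) n
  ÷ₛ-≋ n f f′ g u@(_ , _ , ig∈) g≈ f≈ = go n f f′ f≈ ℕₚ.≤-refl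
    where
    head : ∀ f f′ → f 0 ≈ f′ 0 → f 0 ÷ g 0 ≈ f′ 0 ÷ g 0
    head f f′ f₀≈ = subst₂ _≈_ (sym (÷-*-inv (f 0) (g 0))) (sym (÷-*-inv (f′ 0) (g 0)))
        (≋-* p-prime f₀≈ (≋-refl p-prime ig∈))
    go : ∀ m f f′ → (∀ i → i ℕ.≤ m → f i ≈ f′ i) → m ℕ.≤ n → (f ÷ₛ g) m ≈ (f′ ÷ₛ g) m
    go zero    f f′ f≈ _   = head f f′ (f≈ 0 z≤n)
    go (suc m) f f′ f≈ m<n = go m _ _ (λ i i≤m → ≋-- p-prime (f≈ (suc i) (s≤s i≤m))
      (≋-* p-prime (head f f′ (f≈ 0 z≤n)) (g≈ (suc i) (ℕₚ.≤-trans (s≤s i≤m) m<n)))) (ℕₚ.<⇒≤ m<n)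

  unit-! : ∀ n → n ℕ.< p → Unit p-prime (fromℕ (n ℕ.!))
  unit-! zero    _     = unit-fromℕ p-prime 1 (p∤1 p-prime)
  unit-! (suc n) 1+n<p = subst (Unit p-prime) (sym (fromℕ-* (suc n) (n ℕ.!)))
    (unit-* p-prime (unit-fromℕ p-prime (suc n) (∣.>⇒∤ 1+n<p)) (unit-! n (ℕₚ.<⇒≤ 1+n<p)))

  exp-≋ : ∀ {x y} i → i ℕ.< p → x ≈ y → exp x i ≈ exp y i
  exp-≋ {x} {y} i i<p x≈y = subst₂ _≈_ (sym (exp≡ x i)) (sym (exp≡ y i))
    (≋-* p-prime (≋-^ p-prime i x≈y) (≋-refl p-prime (proj₂ (proj₂ (unit-! i i<p)))))

  -- Up to index n < p the factorials in the denominators are units, and the divisor e^t + 1 has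
  -- constant term 2.
  euler-≋ : p ∤ 2 → ∀ {x y} n → n ℕ.< p → x ≈ y → euler n x ≈ euler n y
  euler-≋ p∤2 {x} {y} n n<p x≈y = ≋-* p-prime (≋-fromℕ p-prime (n ℕ.!))
    (÷ₛ-≋ n (fromℕ 2 ·ₛ exp x) (fromℕ 2 ·ₛ exp y) (exp 1ℚ +ₛ 1ₛ) (unit-fromℕ p-prime 2 p∤2)
      (λ i i≤n → ≋-+ p-prime (exp-≋ i (ℕₚ.≤-<-trans i≤n n<p) (≋-fromℕ p-prime 1)) (1ₛ≈ i))
      (λ i i≤n → ≋-* p-prime (≋-fromℕ p-prime 2) (exp-≋ i (ℕₚ.≤-<-trans i≤n n<p) x≈y)))
    where
    1ₛ≈ : ∀ i → 1ₛ i ≈ 1ₛ i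
    1ₛ≈ zero    = ≋-refl p-prime (∈-fromℕ p-prime 1)
    1ₛ≈ (suc i) = ≋-refl p-prime (∈-fromℕ p-prime 0)

-- Induction on k by the binomial theorem, which is `exp-+` multiplied by p!. The inner terms have
-- denominators i! (p - i)! prime to p, so the factor p of p! survives in them.
fermat : ∀ {p} (p-prime : Prime p) k → _≋_ p-prime (fromℕ k ^ p) (fromℕ k)
fermat {zero}  p-prime k       = ⊥-elim (¬prime[0] p-prime)
fermat {suc q} p-prime zero    = subst (_≈ 0ℚ) (sym (*-zeroˡ (0ℚ ^ q))) (≋-fromℕ p-prime 0)
  where _≈_ = _≋_ p-prime
fermat {suc q} p-prime (suc k) = subst₂ _≈_ (sym expansion) (trans (lemma y) (sym (fromℕ-suc k)))
  (≋-+ p-prime (≋-+ p-prime (≋-fromℕ p-prime 1) middle) (fermat p-prime k))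
  where
  infix 4 _≈_
  _≈_ = _≋_ p-prime
  y = fromℕ k
  P = fromℕ (suc q ℕ.!)
  T : ℕ → ℚ
  T i = exp y (suc i) * exp 1ℚ (q ∸ i)
  lemma : ∀ y → 1ℚ + 0ℚ + y ≡ y + 1ℚ
  lemma = solve-∀ ring
  middle : P * Σ< q T ≈ 0ℚ
  middle = subst (_≈ 0ℚ) (trans (sym (*-assoc (fromℕ (suc q)) (fromℕ (q ℕ.!)) (Σ< q T)))
      (cong (_* Σ< q T) (sym (fromℕ-* (suc q) (q ℕ.!)))))
    (≋-p* p-prime {fromℕ (q ℕ.!) * Σ< q T} (∈ˡ integral))
    where
    integral : fromℕ (q ℕ.!) * Σ< q T ≈ fromℕ (q ℕ.!) * Σ< q T
    integral = ≋-* p-prime (≋-fromℕ p-prime (q ℕ.!)) (≋-Σ p-prime q λ i i<q →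
      ≋-* p-prime (exp-≋ p-prime (suc i) (s≤s i<q) (≋-fromℕ p-prime k))
        (exp-≋ p-prime (q ∸ i) (s≤s (ℕₚ.m∸n≤m q i)) (≋-fromℕ p-prime 1)))
  expansion : fromℕ (suc k) ^ suc q ≡ 1ℚ + P * Σ< q T + y ^ suc q
  expansion = begin
    fromℕ (suc k) ^ suc q
      ≡⟨ cong (_^ suc q) (fromℕ-suc k) ⟩
    (y + 1ℚ) ^ suc q
      ≡⟨ sym (!*exp (y + 1ℚ) (suc q)) ⟩
    P * exp (y + 1ℚ) (suc q)
      ≡⟨ cong (P *_) (trans (sym (exp-+ y 1ℚ (suc q))) (*ₛ-Σ< (exp y) (exp 1ℚ) (suc q))) ⟩
    P * (Σ< (suc q) (λ i → exp y i * exp 1ℚ (suc q ∸ i)) + exp y (suc q) * exp 1ℚ (q ∸ q))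
      ≡⟨ cong₂ (λ S m → P * (S + exp y (suc q) * exp 1ℚ m)) (Σ<-front q _) (ℕₚ.n∸n≡0 q) ⟩
    P * (exp y 0 * exp 1ℚ (suc q) + Σ< q T + exp y (suc q) * exp 1ℚ 0)
      ≡⟨ distribute P (exp 1ℚ (suc q)) (Σ< q T) (exp y (suc q)) ⟩
    P * exp 1ℚ (suc q) + P * Σ< q T + P * exp y (suc q)
      ≡⟨ cong₂ (λ u v → u + P * Σ< q T + v) (trans (!*exp 1ℚ (suc q)) (1^n≡1 (suc q))) (!*exp y (suc q)) ⟩
    1ℚ + P * Σ< q T + y ^ suc q ∎
    where
    open ≡-Reasoning
    distribute : ∀ P u S v → P * (1ℚ * u + S + v * 1ℚ) ≡ P * u + P * S + P * v
    distribute = solve-∀ ring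

factorial : ℕ → ℚ
factorial k = Π< k (λ i → 1ℚ + fromℕ i)

factorial-falling : ∀ n k → k ℕ.≤ n → Π< k (λ i → fromℕ i - fromℕ n) * factorial (n ∸ k) ≡ (- 1ℚ) ^ k * factorial n
factorial-falling n zero    _   = refl
factorial-falling n (suc k) k<n = by (- 1ℚ) (trans (cong (λ m → Π< k (λ i → fromℕ i - fromℕ n) * factorial m)
    (sym (ℕₚ.+-∸-assoc 1 k<n))) (factorial-falling n k (ℕₚ.<⇒≤ k<n)))
  (by (Π< k (λ i → fromℕ i - fromℕ n) * factorial (n ∸ suc k))
      (trans (fromℕ-∸ k<n) (cong (_-_ (fromℕ n)) (fromℕ-suc k)))
    (lemma (Π< k (λ i → fromℕ i - fromℕ n)) (factorial (n ∸ suc k)) (fromℕ k) (fromℕ n) (fromℕ (n ∸ suc k))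
        ((- 1ℚ) ^ k) (factorial n)))
  where
  lemma : ∀ P f k n d s F → P * (k - n) * f ≡ - 1ℚ * s * F + - 1ℚ * (P * (f * (1ℚ + d)) - s * F) + P * f *
      (d - (n - (k + 1ℚ)))
  lemma = solve-∀ ring

quot-factorial : ∀ y k → quot y 1ℚ k * factorial k ≡ Π< k (λ i → y + fromℕ i)
quot-factorial y k = trans (cong (_* factorial k) (Π<-* k _ _))
  (by (Π< k (λ i → y + fromℕ i)) (Π<-inv k (λ i _ → 1+fromℕ-≢0 i))
    (lemma (Π< k (λ i → y + fromℕ i)) (Π< k (λ i → inv (1ℚ + fromℕ i))) (factorial k)))
  where
  lemma : ∀ P F E → P * F * E ≡ P + P * (E * F - 1ℚ)
  lemma = solve-∀ ring

factorial-! : ∀ k → fromℕ (k ℕ.!) ≡ factorial k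
factorial-! zero    = refl
factorial-! (suc k) = trans (fromℕ-* (suc k) (k ℕ.!)) (trans (*-comm (fromℕ (suc k)) (fromℕ (k ℕ.!)))
  (cong₂ _*_ (factorial-! k) (fromℕ-+ 1 k)))

-- The sum modulo p⁴

module Supercongruence {p : ℕ} (p-prime : Prime p) (n : ℕ) (p≡ : p ≡ suc (3 ℕ.* n)) (p∤2 : p ∤ 2) (p∤3 : p ∤ 3)
                       (n-even : (- 1ℚ) ^ n ≡ 1ℚ) (a : ℚ) (3a≡1 : fromℕ 3 * a ≡ 1ℚ) where

  infix 4 _≈_
  _≈_ : ℚ → ℚ → Set
  _≈_ = _≋_ p-prime

  N x : ℚ
  N = fromℕ n
  x = N + a

  fromℕ-p : fromℕ p ≡ 1ℚ + fromℕ 3 * N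
  fromℕ-p = trans (cong fromℕ p≡) (trans (fromℕ-+ 1 (3 ℕ.* n)) (cong (_+_ 1ℚ) (fromℕ-* 3 n)))

  p*a : fromℕ p * a ≡ x
  p*a = by₂ a fromℕ-p N 3a≡1 (lemma (fromℕ p) N a (fromℕ 3))
    where
    lemma : ∀ q N a t → q * a ≡ N + a + a * (q - (1ℚ + t * N)) + N * (t * a - 1ℚ)
    lemma = solve-∀ ring

  3*x : fromℕ 3 * x ≡ fromℕ p
  3*x = by₂ (- 1ℚ) fromℕ-p 1ℚ 3a≡1 (lemma (fromℕ p) N a (fromℕ 3))
    where
    lemma : ∀ q N a t → t * (N + a) ≡ q + - 1ℚ * (q - (1ℚ + t * N)) + 1ℚ * (t * a - 1ℚ)
    lemma = solve-∀ ring

  unit-a : Unit p-prime a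
  unit-a = unit p-prime (subst (_∈ℤ[ p ]) i3 (proj₂ (proj₂ u3))) (fromℕ 3) (∈-fromℕ p-prime 3)
      (trans (*-comm a (fromℕ 3)) 3a≡1)
    where
    u3 = unit-fromℕ p-prime 3 p∤3
    i3 : inv (fromℕ 3) ≡ a
    i3 = inv-unique 3a≡1

  ≈-unit : ∀ {y} → Unit p-prime y → y ≈ y
  ≈-unit (_ , y∈ , _) = ≋-refl p-prime y∈

  ≈-inv : ∀ {y} → Unit p-prime y → inv y ≈ inv y
  ≈-inv (_ , _ , iy∈) = ≋-refl p-prime iy∈

  ≈-fromℕ : ∀ k → fromℕ k ≈ fromℕ k
  ≈-fromℕ = ≋-fromℕ p-prime

  ≈-1 : 1ℚ ≈ 1ℚ
  ≈-1 = ≈-fromℕ 1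

  x≈0 : x ≈ 0ℚ
  x≈0 = subst (_≈ 0ℚ) p*a (≋-p* p-prime {a} (proj₁ (proj₂ unit-a)))

  x≈x : x ≈ x
  x≈x = ≋-trans p-prime x≈0 (≋-sym p-prime x≈0)

  -- Because x = p a, a polynomial identity in n and a with an integral multiple of n + a as error
  -- is already a congruence modulo p.
  ≈-mod-x : ∀ {y z} w → w ≈ w → z ≈ z → y ≡ z + w * x → y ≈ z
  ≈-mod-x {z = z} w w≈ z≈ eq = subst₂ _≈_ (sym eq) (lemma z w)
    (≋-+ p-prime z≈ (≋-* p-prime w≈ x≈0))
    where
    lemma : ∀ z w → z + w * 0ℚ ≡ z
    lemma = solve-∀ ring

  -1^≈ : ∀ k → ((- 1ℚ) ^ k) ≈ ((- 1ℚ) ^ k)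
  -1^≈ k = ≋-^ p-prime k (≋-neg p-prime ≈-1)

  <p⇒∤ : ∀ {k} → 0 ℕ.< k → k ℕ.< p → p ∤ k
  <p⇒∤ {suc k} _ k<p = ∣.>⇒∤ k<p

  n<p : n ℕ.< p
  n<p = subst (n ℕ.<_) (sym p≡) (s≤s (ℕₚ.m≤m+n n (2 ℕ.* n)))

  unit-suc : ∀ i → suc i ℕ.< p → Unit p-prime (1ℚ + fromℕ i)
  unit-suc i 1+i<p = subst (Unit p-prime) (fromℕ-+ 1 i) (unit-fromℕ p-prime (suc i) (<p⇒∤ (s≤s z≤n) 1+i<p))

  3n<p : 3 ℕ.* n ℕ.< p
  3n<p = subst (3 ℕ.* n ℕ.<_) (sym p≡) ℕₚ.≤-refl

  ≤3n⇒<p : ∀ {i m} → i ℕ.< m → m ℕ.≤ 3 ℕ.* n → suc i ℕ.< p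
  ≤3n⇒<p i<m m≤3n = ℕₚ.≤-<-trans (ℕₚ.≤-trans i<m m≤3n) 3n<p

  unit-factorial : ∀ m → m ℕ.≤ 3 ℕ.* n → Unit p-prime (factorial m)
  unit-factorial m m≤3n = unit-Π p-prime m λ i i<m → unit-suc i (≤3n⇒<p i<m m≤3n)

  n≤3n : n ℕ.≤ 3 ℕ.* n
  n≤3n = ℕₚ.m≤m+n n (2 ℕ.* n)

  unit-1+ : ∀ i → i ℕ.< n → Unit p-prime (1ℚ + fromℕ i)
  unit-1+ i i<n = unit-suc i (ℕₚ.<-≤-trans (s≤s i<n) n<p)

  unit-a+ : ∀ i → i ℕ.< n → Unit p-prime (a + fromℕ i)
  unit-a+ i i<n = subst (Unit p-prime) eq (unit-* p-prime unit-a (unit-fromℕ p-prime (suc (3 ℕ.* i))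
      (<p⇒∤ (s≤s z≤n) (subst (suc (3 ℕ.* i) ℕ.<_) (sym p≡) (s≤s (ℕₚ.*-monoʳ-< 3 i<n))))))
    where
    eq : a * fromℕ (suc (3 ℕ.* i)) ≡ a + fromℕ i
    eq = by₂ a (trans (fromℕ-+ 1 (3 ℕ.* i)) (cong (_+_ 1ℚ) (fromℕ-* 3 i))) (fromℕ i) 3a≡1
      (lemma a (fromℕ i) (fromℕ 3) (fromℕ (suc (3 ℕ.* i))))
      where
      lemma : ∀ a i t q → a * q ≡ a + i + a * (q - (1ℚ + t * i)) + i * (t * a - 1ℚ)
      lemma = solve-∀ ring

  -- With j = i + 1 this is (p + 3j) / 3, and p divides neither 3 nor j.
  unit+x : ∀ i → i ℕ.< n → Unit p-prime (1ℚ - - x + fromℕ i)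
  unit+x i i<n = subst (Unit p-prime) eq (unit-* p-prime unit-a (unit-fromℕ p-prime (p ℕ.+ 3 ℕ.* suc i) ∤))
    where
    ∤ : p ∤ p ℕ.+ 3 ℕ.* suc i
    ∤ p∣ = ∤-* p-prime p∤3 (<p⇒∤ (s≤s z≤n) (ℕₚ.<-≤-trans (s≤s i<n) n<p)) (∣.∣m+n∣m⇒∣n p∣ ∣.∣-refl)
    eq : a * fromℕ (p ℕ.+ 3 ℕ.* suc i) ≡ 1ℚ - - x + fromℕ i
    eq = by a (trans (fromℕ-+ p (3 ℕ.* suc i)) (cong (_+_ (fromℕ p))
        (trans (fromℕ-* 3 (suc i)) (cong (fromℕ 3 *_) (fromℕ-suc i)))))
      (by₂ (fromℕ i + 1ℚ) 3a≡1 1ℚ p*a (lemma a (fromℕ i) (fromℕ 3) (fromℕ p) x (fromℕ (p ℕ.+ 3 ℕ.* suc i))))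
      where
      lemma : ∀ a i t p x q → a * q ≡ 1ℚ - - x + i + a * (q - (p + t * (i + 1ℚ))) + (i + 1ℚ) * (t * a - 1ℚ) + 1ℚ
          * (p * a - x)
      lemma = solve-∀ ring

  unit-x : ∀ i → i ℕ.< n → Unit p-prime (1ℚ - x + fromℕ i)
  unit-x i i<n = subst (Unit p-prime) eq (unit-neg p-prime
      (unit-* p-prime unit-a (unit-fromℕ p-prime (p ∸ 3 ℕ.* suc i) ∤)))
    where
    3i<p : 3 ℕ.* suc i ℕ.< p
    3i<p = subst (3 ℕ.* suc i ℕ.<_) (sym p≡) (s≤s (ℕₚ.*-monoʳ-≤ 3 i<n))
    ∤ : p ∤ p ∸ 3 ℕ.* suc i
    ∤ = <p⇒∤ (ℕₚ.m<n⇒0<n∸m 3i<p) (ℕₚ.∸-monoʳ-< {p} {3 ℕ.* suc i} {0} (s≤s z≤n) (ℕₚ.<⇒≤ 3i<p))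
    eq : - (a * fromℕ (p ∸ 3 ℕ.* suc i)) ≡ 1ℚ - x + fromℕ i
    eq = by (- a) (trans (fromℕ-∸ (ℕₚ.<⇒≤ 3i<p)) (cong (_-_ (fromℕ p))
        (trans (fromℕ-* 3 (suc i)) (cong (fromℕ 3 *_) (fromℕ-suc i)))))
      (by₂ (fromℕ i + 1ℚ) 3a≡1 (- 1ℚ) p*a (lemma a (fromℕ i) (fromℕ 3) (fromℕ p) x (fromℕ (p ∸ 3 ℕ.* suc i))))
      where
      lemma : ∀ a i t p x q → - (a * q) ≡ 1ℚ - x + i + - a * (q - (p - t * (i + 1ℚ))) + (i + 1ℚ) * (t * a - 1ℚ) +
          - 1ℚ * (p * a - x)
      lemma = solve-∀ ring

  -- Symmetry under k ↦ n - k modulo p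

  private
    r : ℕ → ℚ
    r = quot a 1ℚ

    φ ψ : ℕ → ℚ
    φ i = inv (1ℚ - - x + fromℕ i)
    ψ i = inv (1ℚ - x + fromℕ i)

    c : ℚ → ℕ → ℚ
    c K i = saalschützTerm a K (suc i)

    U V W : ℕ → ℚ
    U k = saalschützSum a (- x) n (fromℕ k)
    V k = saalschützSum a x n (fromℕ k)
    W k = Σ< n (λ i → c (fromℕ k) i * (φ i * ψ i))

  term : ℕ → ℚ
  term k = (- 1ℚ) ^ k * (fromℕ 3 * (a + fromℕ k + fromℕ k)) * (r k * r k * r k)

  private
    φ≈ : ∀ i → i ℕ.< n → φ i ≈ φ i
    φ≈ i i<n = ≈-inv (unit+x i i<n)

    ψ≈ : ∀ i → i ℕ.< n → ψ i ≈ ψ i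
    ψ≈ i i<n = ≈-inv (unit-x i i<n)

    a≈ : a ≈ a
    a≈ = ≈-unit unit-a

    weight≈ : ∀ j → j ℕ.≤ n → weight a j ≈ weight a j
    weight≈ j j≤n = ≋-Π p-prime j λ i i<j →
      ≈-inv (unit-* p-prime (unit-1+ i (ℕₚ.<-≤-trans i<j j≤n)) (unit-a+ i (ℕₚ.<-≤-trans i<j j≤n)))

    -- Modulo p, n ≡ -a, so the reflection interchanges the two factors i - k and k + a + i.
    poch₂-symmetric : ∀ k → k ℕ.≤ n → ∀ j → poch₂ a (fromℕ (n ∸ k)) j ≈ poch₂ a (fromℕ k) j
    poch₂-symmetric k k≤n j = ≋-Π p-prime j λ i _ → ≈-mod-x (fromℕ k + a + fromℕ i - (fromℕ i - fromℕ k) - x)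
      (≋-- p-prime (≋-- p-prime (K+a+i i) (≋-- p-prime (≈-fromℕ i) (≈-fromℕ k))) x≈x)
      (≋-* p-prime (≋-- p-prime (≈-fromℕ i) (≈-fromℕ k)) (K+a+i i) )
      (trans (cong (λ m → (fromℕ i - m) * (m + a + fromℕ i)) (fromℕ-∸ k≤n)) (flip (fromℕ i) (fromℕ k) N a))
      where
      K+a+i : ∀ i → (fromℕ k + a + fromℕ i) ≈ (fromℕ k + a + fromℕ i)
      K+a+i i = ≋-+ p-prime (≋-+ p-prime (≈-fromℕ k) a≈) (≈-fromℕ i)
      flip : ∀ i k N a → (i - (N - k)) * (N - k + a + i)
        ≡ (i - k) * (k + a + i) + (k + a + i - (i - k) - (N + a)) * (N + a)
      flip = solve-∀ ring

    c-symmetric : ∀ k → k ℕ.≤ n → ∀ i → i ℕ.< n → c (fromℕ (n ∸ k)) i ≈ c (fromℕ k) i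
    c-symmetric k k≤n i i<n = ≋-* p-prime (poch₂-symmetric k k≤n (suc i)) (weight≈ (suc i) i<n)

    U-symmetric : ∀ k → k ℕ.≤ n → U (n ∸ k) ≈ U k
    U-symmetric k k≤n = ≋-Σ p-prime n λ i i<n → ≋-* p-prime (c-symmetric k k≤n i i<n) (φ≈ i i<n)

    V-symmetric : ∀ k → k ℕ.≤ n → V (n ∸ k) ≈ V k
    V-symmetric k k≤n = ≋-Σ p-prime n λ i i<n → ≋-* p-prime (c-symmetric k k≤n i i<n) (ψ≈ i i<n)

    W-symmetric : ∀ k → k ℕ.≤ n → W (n ∸ k) ≈ W k
    W-symmetric k k≤n = ≋-Σ p-prime n λ i i<n →
      ≋-* p-prime (c-symmetric k k≤n i i<n) (≋-* p-prime (φ≈ i i<n) (ψ≈ i i<n))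

    a+≈ : ∀ i → (a + fromℕ i) ≈ (a + fromℕ i)
    a+≈ i = ≋-+ p-prime a≈ (≈-fromℕ i)

    r≈ : ∀ k → k ℕ.≤ n → r k ≈ r k
    r≈ k k≤n = ≋-Π p-prime k λ i i<k → ≋-* p-prime (a+≈ i) (≈-inv (unit-1+ i (ℕₚ.<-≤-trans i<k k≤n)))

    -- Modulo p, a ≡ -n, hence `r k` is congruent to (-n)ₖ / k!, a signed binomial coefficient.
    r-binomial : ∀ k → k ℕ.≤ n → (r k * (factorial k * factorial (n ∸ k))) ≈ ((- 1ℚ) ^ k * factorial n)
    r-binomial k k≤n = subst₂ _≈_
      (trans (cong (_* factorial (n ∸ k)) (sym (quot-factorial a k)))
          (*-assoc (r k) (factorial k) (factorial (n ∸ k))))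
      (factorial-falling n k k≤n)
      (≋-* p-prime (≋-Π p-prime k λ i _ → ≈-mod-x 1ℚ ≈-1 (≋-- p-prime (≈-fromℕ i) (≈-fromℕ n)) (flip (fromℕ i) N a))
        (≈-unit (unit-factorial (n ∸ k) (ℕₚ.≤-trans (ℕₚ.m∸n≤m n k) n≤3n))))
      where
      flip : ∀ i N a → a + i ≡ i - N + 1ℚ * (N + a)
      flip = solve-∀ ring

    -1^-symmetric : ∀ k → k ℕ.≤ n → (- 1ℚ) ^ (n ∸ k) ≡ (- 1ℚ) ^ k
    -1^-symmetric k k≤n = trans (-1^-∸ k≤n) (trans (cong (_* (- 1ℚ) ^ k) n-even) (*-identityˡ ((- 1ℚ) ^ k)))

    r-symmetric : ∀ k → k ℕ.≤ n → r (n ∸ k) ≈ r k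
    r-symmetric k k≤n = ≋-cancel p-prime (factorial k * factorial (n ∸ k))
      (unit-* p-prime (unit-factorial k (ℕₚ.≤-trans k≤n n≤3n)) (unit-factorial (n ∸ k) (ℕₚ.≤-trans n∸k≤n n≤3n)))
      (∈ˡ (r≈ (n ∸ k) n∸k≤n)) (∈ˡ (r≈ k k≤n))
      (≋-trans p-prime (subst₂ (λ f s → (r (n ∸ k) * f) ≈ (s * factorial n))
          (trans (cong (λ m → factorial (n ∸ k) * factorial m) (ℕₚ.m∸[m∸n]≡n k≤n))
              (*-comm (factorial (n ∸ k)) (factorial k)))
          (-1^-symmetric k k≤n) (r-binomial (n ∸ k) n∸k≤n))
        (≋-sym p-prime (r-binomial k k≤n)))
      where
      n∸k≤n = ℕₚ.m∸n≤m n k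

    term-antisymmetric : ∀ k → k ℕ.≤ n → term (n ∸ k) ≈ - term k
    term-antisymmetric k k≤n = subst (term (n ∸ k) ≈_) (pull ((- 1ℚ) ^ k) (fromℕ 3) (a + fromℕ k + fromℕ k)
        (r k * r k * r k))
      (≋-* p-prime (≋-* p-prime (subst (_≈ ((- 1ℚ) ^ k)) (sym (-1^-symmetric k k≤n)) (-1^≈ k))
          (≋-* p-prime (≈-fromℕ 3) middle))
        (≋-* p-prime (≋-* p-prime (r-symmetric k k≤n) (r-symmetric k k≤n)) (r-symmetric k k≤n)))
      where
      pull : ∀ s t b q → s * (t * - b) * q ≡ - (s * (t * b) * q)
      pull = solve-∀ ring
      middle : (a + fromℕ (n ∸ k) + fromℕ (n ∸ k)) ≈ (- (a + fromℕ k + fromℕ k))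
      middle = ≈-mod-x (1ℚ + 1ℚ) (≋-+ p-prime ≈-1 ≈-1) (≋-neg p-prime (≋-+ p-prime (a+≈ k) (≈-fromℕ k)))
        (trans (cong (λ m → a + m + m) (fromℕ-∸ k≤n)) (flip (fromℕ k) N a))
        where
        flip : ∀ k N a → a + (N - k) + (N - k) ≡ - (a + k + k) + (1ℚ + 1ℚ) * (N + a)
        flip = solve-∀ ring

    -- The cofactor of -x³ in the third part: 1 - ρ(-x) = -x U, and 1 - ρ(x) ρ(-x) = -x (U - V) + x²
    -- U V with U - V = -2 x W.
    Z : ℕ → ℚ
    Z k = U k * ((1ℚ + 1ℚ) * W k + U k * V k)

    Σ-term-Z : Σ< (suc n) (λ k → term k * Z k) ≈ 0ℚ
    Σ-term-Z = Σ-antisymmetric p-prime p∤2 (suc n) λ k k<1+n → let k≤n = ℕₚ.≤-pred k<1+n in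
      subst ((term (n ∸ k) * Z (n ∸ k)) ≈_) (neg-distribˡ k) (≋-* p-prime (term-antisymmetric k k≤n)
        (≋-* p-prime (U-symmetric k k≤n) (≋-+ p-prime (≋-* p-prime (≋-+ p-prime ≈-1 ≈-1) (W-symmetric k k≤n))
          (≋-* p-prime (U-symmetric k k≤n) (V-symmetric k k≤n)))))
      where
      neg-distribˡ : ∀ k → - term k * Z k ≡ - (term k * Z k)
      neg-distribˡ k = sym (neg-distribˡ-* (term k) (Z k))

    φ≢ : ∀ i → i ℕ.< n → 1ℚ - - x + fromℕ i ≢ 0ℚ
    φ≢ i i<n = proj₁ (unit+x i i<n)

    ψ≢ : ∀ i → i ℕ.< n → 1ℚ - x + fromℕ i ≢ 0ℚ
    ψ≢ i i<n = proj₁ (unit-x i i<n)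

    a≢ : ∀ i → i ℕ.< n → a + fromℕ i ≢ 0ℚ
    a≢ i i<n = proj₁ (unit-a+ i i<n)

    quot-neg : ∀ k → k ℕ.≤ n → quot (a + - x) (1ℚ - - x) k ≡ r k * (1ℚ + x * U k)
    quot-neg k k≤n = trans (saalschütz a (- x) n a≢ φ≢ k k≤n) (cong (r k *_) (lemma x (U k)))
      where
      lemma : ∀ x U → 1ℚ - - x * U ≡ 1ℚ + x * U
      lemma = solve-∀ ring

    quot-pos : ∀ k → k ℕ.≤ n → quot (a + x) (1ℚ - x) k ≡ r k * (1ℚ - x * V k)
    quot-pos k k≤n = saalschütz a x n a≢ ψ≢ k k≤n

    -- From 1/(j + x) - 1/(j - x) = -2x / (j² - x²). This extra factor x raises the order of the
    -- third part from x² to x³.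
    U-V : ∀ k → U k - V k ≡ - ((1ℚ + 1ℚ) * x) * W k
    U-V k = begin
      U k - V k
        ≡⟨ sym (cong₂ _-_ (*-identityˡ (U k)) (*-identityˡ (V k))) ⟩
      1ℚ * U k - 1ℚ * V k
        ≡⟨ Σ<-linear n 1ℚ 1ℚ _ _ ⟩
      Σ< n (λ i → 1ℚ * (c (fromℕ k) i * φ i) - 1ℚ * (c (fromℕ k) i * ψ i))
        ≡⟨ Σ<-cong n (λ i i<n → by₂ (c (fromℕ k) i * ψ i) (inv-inverse (φ≢ i i<n)) (- (c (fromℕ k) i * φ i))
            (inv-inverse (ψ≢ i i<n))
             (lemma x (fromℕ i) (c (fromℕ k) i) (φ i) (ψ i))) ⟩
      Σ< n (λ i → - ((1ℚ + 1ℚ) * x) * (c (fromℕ k) i * (φ i * ψ i)))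
        ≡⟨ Σ<-*ˡ n (- ((1ℚ + 1ℚ) * x)) _ ⟩
      - ((1ℚ + 1ℚ) * x) * W k ∎
      where
      open ≡-Reasoning
      lemma : ∀ x i c φ ψ → 1ℚ * (c * φ) - 1ℚ * (c * ψ)
        ≡ - ((1ℚ + 1ℚ) * x) * (c * (φ * ψ)) + c * ψ * ((1ℚ - - x + i) * φ - 1ℚ) + - (c * φ) * ((1ℚ - x + i) * ψ - 1ℚ)
      lemma = solve-∀ ring

    -- Exact evaluation of the first two parts

    b : ℕ → ℚ
    b k = a + fromℕ k + fromℕ k

    -- Here and in `y₁`, v = -x makes the series terminate; w = 0 and w = x give the products R(-x)
    -- R(0) and R(-x) R(x) of the first two parts.
    y₀ : ℕ → ℚ
    y₀ = wellPoised a (- x) 0ℚ 0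

    y₁ : ℕ → ℕ → ℚ
    y₁ = wellPoised a (- x) x

    -- Reassembles the partial fractions of 1 - ρ(-x): the weight (-k)ⱼ (k + a)ⱼ inside `y₁`, with j
    -- = i + 1, supplies the numerators of `U k`.
    Σ-y₁ : ∀ k → k ℕ.≤ n → Σ< n (λ i → weight a (suc i) * φ i * (b k * y₁ (suc i) k))
      ≡ b k * ((- 1ℚ) ^ k * r k * (r k * (1ℚ + x * U k) * (r k * (1ℚ - x * V k)))) * U k
    Σ-y₁ k k≤n = trans (Σ<-cong n λ i _ → trans
        (cong₂ (λ R R′ → weight a (suc i) * φ i * (b k *
            ((- 1ℚ) ^ k * r k * poch₂ a (fromℕ k) (suc i) * (R * R′)))) (quot-neg k k≤n) (quot-pos k k≤n))
        (lemma (b k) ((- 1ℚ) ^ k * r k) (r k * (1ℚ + x * U k) * (r k * (1ℚ - x * V k))) (weight a (suc i)) (φ i)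
            (poch₂ a (fromℕ k) (suc i))))
      (Σ<-*ˡ n (b k * ((- 1ℚ) ^ k * r k * (r k * (1ℚ + x * U k) * (r k * (1ℚ - x * V k))))) _)
      where
      lemma : ∀ b s R w φ q → w * φ * (b * (s * q * R)) ≡ b * (s * R) * (q * w * φ)
      lemma = solve-∀ ring

    y₀≡ : ∀ k → k ℕ.≤ n → y₀ k ≡ (- 1ℚ) ^ k * r k * 1ℚ * (r k * (1ℚ + x * U k) * r k)
    y₀≡ k k≤n = cong₂ (λ R R′ → (- 1ℚ) ^ k * r k * 1ℚ * (R * R′)) (quot-neg k k≤n)
      (cong (λ α → quot α 1ℚ k) (+-identityʳ a))

    -- With ρ(u) = quot (a + u) (1 - u) k / r k, the three parts come from
    -- 1 = ρ(-x) + ρ(-x) ρ(x) (1 - ρ(-x)) + (1 - ρ(-x)) (1 - ρ(x) ρ(-x)).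
    term-split : ∀ k → k ℕ.≤ n → term k ≡ fromℕ 3 * (b k * y₀ k)
      + - (x * fromℕ 3) * Σ< n (λ i → weight a (suc i) * φ i * (b k * y₁ (suc i) k)) + - (x * x * x) * (term k * Z k)
    term-split k k≤n = by (x * x * U k * ((- 1ℚ) ^ k * (fromℕ 3 * b k) * (r k * r k * r k))) (U-V k)
      (trans (lemma x ((- 1ℚ) ^ k) (fromℕ 3) (b k) (r k) (U k) (V k) (W k))
        (cong (λ z → z + x * x * U k * ((- 1ℚ) ^ k * (fromℕ 3 * b k) * (r k * r k * r k)) *
            (U k - V k - - ((1ℚ + 1ℚ) * x) * W k))
          (cong₂ (λ y S → fromℕ 3 * (b k * y) + - (x * fromℕ 3) * S + - (x * x * x) * (term k * Z k))
            (sym (y₀≡ k k≤n)) (sym (Σ-y₁ k k≤n)))))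
      where
      lemma : ∀ x s t b r U V W → s * (t * b) * (r * r * r)
        ≡ t * (b * (s * r * 1ℚ * (r * (1ℚ + x * U) * r)))
          + - (x * t) * (b * (s * r * (r * (1ℚ + x * U) * (r * (1ℚ - x * V)))) * U)
          + - (x * x * x) * (s * (t * b) * (r * r * r) * (U * ((1ℚ + 1ℚ) * W + U * V)))
          + x * x * U * (s * (t * b) * (r * r * r)) * (U - V - - ((1ℚ + 1ℚ) * x) * W)
      lemma = solve-∀ ring

    a-x+N : a + - x + N ≡ 0ℚ
    a-x+N = lemma a N
      where
      lemma : ∀ a N → a + - (N + a) + N ≡ 0ℚ
      lemma = solve-∀ ring

    x-N : x - N ≡ a
    x-N = lemma a N
      where
      lemma : ∀ a N → N + a - N ≡ a
      lemma = solve-∀ ring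

    a+x≢ : ∀ k → k ℕ.< n → a + x + fromℕ k ≢ 0ℚ
    a+x≢ k _ eq = fromℕ-≢0 (suc (p ℕ.+ 3 ℕ.* k)) (begin
      fromℕ (suc (p ℕ.+ 3 ℕ.* k))
        ≡⟨ trans (fromℕ-+ 1 (p ℕ.+ 3 ℕ.* k)) (cong (_+_ 1ℚ)
            (trans (fromℕ-+ p (3 ℕ.* k)) (cong (_+_ (fromℕ p)) (fromℕ-* 3 k)))) ⟩
      1ℚ + (fromℕ p + fromℕ 3 * fromℕ k)
        ≡⟨ by (- 1ℚ) 3a≡1 (by (- 1ℚ) 3*x (by (fromℕ 3) eq (lemma a x (fromℕ k) (fromℕ 3) (fromℕ p)))) ⟩
      0ℚ ∎)
      where
      open ≡-Reasoning
      lemma : ∀ a x k t p → 1ℚ + (p + t * k) ≡ 0ℚ + - 1ℚ * (t * a - 1ℚ) + - 1ℚ * (t * x - p) + t * (a + x + k - 0ℚ)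
      lemma = solve-∀ ring

    r-n : r n ≡ quot (1ℚ - x) 1ℚ n
    r-n = trans (cong (λ y → quot y 1ℚ n) (sym x-N)) (trans (quot-reverse x n)
      (trans (cong (_* quot (1ℚ - x) 1ℚ n) n-even) (*-identityˡ (quot (1ℚ - x) 1ℚ n))))

    Σ-y₀ : wellPoisedSum a (- x) 0ℚ n 0 ≡ x * r n
    Σ-y₀ = wellPoisedSum-0 a (- x) 0ℚ n a-x+N φ≢ (λ k _ → 1+fromℕ-≢0 k)
      (λ k k<n → subst (λ y → y + fromℕ k ≢ 0ℚ) (sym (+-identityʳ a)) (a≢ k k<n))

    D : ℕ → ℚ
    D j = Π< j (λ i → a + - x + fromℕ i) * Π< j (λ i → a + x + fromℕ i)

    -- The closed form contains (a)ₙ / (1 - x)ₙ, which is 1 by reversal, since a = x - n and n is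
    -- even.
    Σ-y₁-0 : wellPoisedSum a (- x) x n 0 ≡ x
    Σ-y₁-0 = begin
      wellPoisedSum a (- x) x n 0
        ≡⟨ wellPoisedSum-0 a (- x) x n a-x+N φ≢ ψ≢ a+x≢ ⟩
      x * Π< n (λ i → (a + fromℕ i) * ψ i)
        ≡⟨ cong (x *_) (Π<-* n _ _) ⟩
      x * (Π< n (λ i → a + fromℕ i) * Π< n ψ)
        ≡⟨ cong (λ P → x * (P * Π< n ψ)) numerators ⟩
      x * (Π< n (λ i → 1ℚ - x + fromℕ i) * Π< n ψ)
        ≡⟨ cong (x *_) (Π<-inv n ψ≢) ⟩
      x * 1ℚ
        ≡⟨ *-identityʳ x ⟩
      x ∎
      where
      open ≡-Reasoning
      numerators : Π< n (λ i → a + fromℕ i) ≡ Π< n (λ i → 1ℚ - x + fromℕ i)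
      numerators = begin
        Π< n (λ i → a + fromℕ i)               ≡⟨ sym (pochhammer-Π a n) ⟩
        pochhammer a n                         ≡⟨ cong (λ y → pochhammer y n) (sym x-N) ⟩
        pochhammer (x - N) n                   ≡⟨ pochhammer-reverse x n ⟩
        (- 1ℚ) ^ n * pochhammer (1ℚ - x) n     ≡⟨ cong (_* pochhammer (1ℚ - x) n) n-even ⟩
        1ℚ * pochhammer (1ℚ - x) n             ≡⟨ *-identityˡ (pochhammer (1ℚ - x) n) ⟩
        pochhammer (1ℚ - x) n                  ≡⟨ pochhammer-Π (1ℚ - x) n ⟩
        Π< n (λ i → 1ℚ - x + fromℕ i)          ∎

    Σ-y₁-j : ∀ j → wellPoisedSum a (- x) x n j ≡ D j * x
    Σ-y₁-j j = trans (wellPoisedSum-Π a (- x) x n a-x+N φ≢ ψ≢ j) (cong (D j *_) Σ-y₁-0)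

    -- The factors of `D j` pair up to (a + i)² - x², so the error against (a)ⱼ / j! is divisible by
    -- x². The clause `f ≈ f` says that its cofactor is integral; the recurrence for the cofactor
    -- has only unit denominators.
    D-weight : ∀ j → j ℕ.≤ n → Σ[ f ∈ ℚ ] f ≈ f × D j * weight a j ≡ r j + x * x * f
    D-weight zero    _   = 0ℚ , ≈-fromℕ 0 , lemma x
      where
      lemma : ∀ x → 1ℚ * 1ℚ * 1ℚ ≡ 1ℚ + x * x * 0ℚ
      lemma = solve-∀ ring
    D-weight (suc j) j<n with D-weight j (ℕₚ.<⇒≤ j<n)
    ... | f , f≈ , eq = f * ((α - x) * (α + x)) * w - r j * w
        , ≋-- p-prime (≋-* p-prime (≋-* p-prime f≈ (≋-* p-prime (≋-- p-prime α≈ x≈x) (≋-+ p-prime α≈ x≈x))) w≈)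
            (≋-* p-prime (r≈ j (ℕₚ.<⇒≤ j<n)) w≈)
        , by (w * ((α - x) * (α + x))) eq (by₂ (r j * α * ι)
            (inv-inverse (proj₁ (unit-* p-prime (unit-1+ j j<n) (unit-a+ j j<n))))
            (- (r j * α * α * w)) (inv-inverse (1+fromℕ-≢0 j))
            (lemma a x (fromℕ j) ι w (r j) f (Π< j (λ i → a + - x + fromℕ i)) (Π< j (λ i → a + x + fromℕ i))
                (weight a j)))
      where
      α = a + fromℕ j
      α≈ = a+≈ j
      ι = inv (1ℚ + fromℕ j)
      w = inv ((1ℚ + fromℕ j) * (a + fromℕ j))
      w≈ = ≈-inv (unit-* p-prime (unit-1+ j j<n) (unit-a+ j j<n))
      lemma : ∀ a x j ι w r f P Q m → P * (a + - x + j) * (Q * (a + x + j)) * (m * w)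
        ≡ r * ((a + j) * ι) + x * x * (f * ((a + j - x) * (a + j + x)) * w - r * w)
          + w * ((a + j - x) * (a + j + x)) * (P * Q * m - (r + x * x * f))
          + r * (a + j) * ι * ((1ℚ + j) * (a + j) * w - 1ℚ)
          + - (r * (a + j) * (a + j) * w) * ((1ℚ + j) * ι - 1ℚ)
      lemma = solve-∀ ring

    A B : ℚ
    A = Σ< n (λ i → (- 1ℚ) ^ i * (φ i * ψ i))
    B = Σ< n (λ i → (- 1ℚ) ^ i * (inv (1ℚ + fromℕ i) * inv (1ℚ + fromℕ i)))

    1-x+i : ∀ i → (1ℚ - x + fromℕ i) ≈ (1ℚ + fromℕ i)
    1-x+i i = ≈-mod-x (- 1ℚ) (≋-neg p-prime ≈-1) (≋-+ p-prime ≈-1 (≈-fromℕ i)) (lemma x (fromℕ i))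
      where
      lemma : ∀ x i → 1ℚ - x + i ≡ 1ℚ + i + - 1ℚ * x
      lemma = solve-∀ ring

    1+x+i : ∀ i → (1ℚ - - x + fromℕ i) ≈ (1ℚ + fromℕ i)
    1+x+i i = ≈-mod-x 1ℚ ≈-1 (≋-+ p-prime ≈-1 (≈-fromℕ i)) (lemma x (fromℕ i))
      where
      lemma : ∀ x i → 1ℚ - - x + i ≡ 1ℚ + i + 1ℚ * x
      lemma = solve-∀ ring

    A≈B : A ≈ B
    A≈B = ≋-Σ p-prime n λ i i<n → ≋-* p-prime (-1^≈ i) (≋-* p-prime
      (≋-inv p-prime (unit+x i i<n) (unit-1+ i i<n) (1+x+i i))
          (≋-inv p-prime (unit-x i i<n) (unit-1+ i i<n) (1-x+i i)))

    r-n≈1 : r n ≈ 1ℚ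
    r-n≈1 = subst₂ _≈_ (sym r-n) (trans (Π<-cong n λ i _ → inv-inverse (1+fromℕ-≢0 i)) (ones n))
      (≋-Π p-prime n λ i i<n → ≋-* p-prime (1-x+i i) (≈-inv (unit-1+ i i<n)))
      where
      ones : ∀ n → Π< n (λ _ → 1ℚ) ≡ 1ℚ
      ones zero    = refl
      ones (suc n) = cong (_* 1ℚ) (ones n)

    -- The cofactors of `D-weight` as a total function, with default 0 outside the range, so that
    -- they can be summed.
    f : ℕ → ℚ
    f i with i ℕₚ.<? n
    ... | yes i<n = proj₁ (D-weight (suc i) i<n)
    ... | no _    = 0ℚ

    f-spec : ∀ i → i ℕ.< n → f i ≈ f i × D (suc i) * weight a (suc i) ≡ r (suc i) + x * x * f i
    f-spec i i<n with i ℕₚ.<? n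
    ... | yes i<n′ = proj₂ (D-weight (suc i) i<n′)
    ... | no i≮n   = ⊥-elim (i≮n i<n)

    F G : ℚ
    F = Σ< n (λ i → φ i * f i)
    G = Σ< n (λ i → r (suc i) * φ i)

    F≈ : F ≈ F
    F≈ = ≋-Σ p-prime n λ i i<n → ≋-* p-prime (φ≈ i i<n) (proj₁ (f-spec i i<n))

    Σ-weight : Σ< n (λ i → weight a (suc i) * φ i * wellPoisedSum a (- x) x n (suc i)) ≡ x * (G + x * x * F)
    Σ-weight = begin
      Σ< n (λ i → weight a (suc i) * φ i * wellPoisedSum a (- x) x n (suc i))
        ≡⟨ Σ<-cong n (λ i i<n → trans (cong (λ S → weight a (suc i) * φ i * S) (Σ-y₁-j (suc i)))
             (by (φ i * x) (proj₂ (f-spec i i<n)) (lemma x (D (suc i)) (weight a (suc i)) (φ i) (r (suc i)) (f i)))) ⟩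
      Σ< n (λ i → x * (r (suc i) * φ i + x * x * (φ i * f i)))
        ≡⟨ Σ<-*ˡ n x _ ⟩
      x * Σ< n (λ i → r (suc i) * φ i + x * x * (φ i * f i))
        ≡⟨ cong (x *_) (trans (Σ<-+ n _ _) (cong (_+_ G) (Σ<-*ˡ n (x * x) _))) ⟩
      x * (G + x * x * F) ∎
      where
      open ≡-Reasoning
      lemma : ∀ x D w φ r f → w * φ * (D * x) ≡ x * (r * φ + x * x * (φ * f)) + φ * x * (D * w - (r + x * x * f))
      lemma = solve-∀ ring

    G≡ : 1ℚ + x * G ≡ r n * (1ℚ + (1ℚ + 1ℚ) * x * x * A)
    G≡ = trans (cong (λ y → 1ℚ + x * Σ< n (λ i → quot y 1ℚ (suc i) * φ i)) (sym x-N))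
      (trans (reciprocal-sum x n φ≢ ψ≢) (cong (_* (1ℚ + (1ℚ + 1ℚ) * x * x * A)) (sym r-n)))

    Σ-term-split : Σ< (suc n) term ≡ fromℕ 3 * wellPoisedSum a (- x) 0ℚ n 0
      + - (x * fromℕ 3) * (x * (G + x * x * F)) + - (x * x * x) * Σ< (suc n) (λ k → term k * Z k)
    Σ-term-split = begin
      Σ< (suc n) term
        ≡⟨ Σ<-cong (suc n) (λ k k<1+n → term-split k (ℕₚ.≤-pred k<1+n)) ⟩
      Σ< (suc n) (λ k → fromℕ 3 * (b k * y₀ k)
        + - (x * fromℕ 3) * Σ< n (λ i → weight a (suc i) * φ i * (b k * y₁ (suc i) k)) + - (x * x * x) *
            (term k * Z k))
        ≡⟨ trans (Σ<-+ (suc n) _ _) (cong₂ _+_ (Σ<-+ (suc n) _ _) (Σ<-*ˡ (suc n) (- (x * x * x)) _)) ⟩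
      Σ< (suc n) (λ k → fromℕ 3 * (b k * y₀ k))
        + Σ< (suc n) (λ k → - (x * fromℕ 3) * Σ< n (λ i → weight a (suc i) * φ i * (b k * y₁ (suc i) k)))
        + - (x * x * x) * Σ< (suc n) (λ k → term k * Z k)
        ≡⟨ cong₂ (λ u v → u + v + - (x * x * x) * Σ< (suc n) (λ k → term k * Z k))
             (Σ<-*ˡ (suc n) (fromℕ 3) _) (trans (Σ<-*ˡ (suc n) (- (x * fromℕ 3)) _)
               -- Exchanging the sums over k and i leaves, for each i, a well-poised sum of index i
               -- + 1.
               (cong (- (x * fromℕ 3) *_) (trans (Σ<-swap (suc n) n _)
                 (trans (Σ<-cong n (λ i _ → Σ<-*ˡ (suc n) (weight a (suc i) * φ i) _)) Σ-weight)))) ⟩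
      fromℕ 3 * wellPoisedSum a (- x) 0ℚ n 0
        + - (x * fromℕ 3) * (x * (G + x * x * F)) + - (x * x * x) * Σ< (suc n) (λ k → term k * Z k) ∎
      where open ≡-Reasoning

  alternatingSum : ℚ
  alternatingSum = B

  -- The leading factor is p because 3x = p. In Y the contributions of `F` and of the third part
  -- (where x³ = p a x²) vanish modulo p, and `r n` ≡ 1 and `A` ≡ `B` leave -2 `B`.
  Σ-term : Σ[ Y ∈ ℚ ] Y ≈ - (1ℚ + 1ℚ) * alternatingSum × Σ< (suc n) term ≡ fromℕ p + fromℕ p * (x * x) * Y
  Σ-term = - (1ℚ + 1ℚ) * (r n * A) + - x * F + - a * T
    , subst (- (1ℚ + 1ℚ) * (r n * A) + - x * F + - a * T ≈_) (collapse B F a)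
        (≋-+ p-prime (≋-+ p-prime (≋-* p-prime (≋-neg p-prime (≋-+ p-prime ≈-1 ≈-1)) (≋-* p-prime r-n≈1 A≈B))
          (≋-* p-prime (≋-neg p-prime x≈0) F≈)) (≋-* p-prime (≋-neg p-prime a≈) Σ-term-Z))
    , trans Σ-term-split (trans (cong (λ S → fromℕ 3 * S + - (x * fromℕ 3) * (x * (G + x * x * F)) + -
        (x * x * x) * T) Σ-y₀)
        (by (r n - x * (G + x * x * F)) 3*x (by (- fromℕ p) G≡
            (by (x * x * T) p*a (lemma (fromℕ p) x (fromℕ 3) a (r n) G F A T)))))
    where
    T = Σ< (suc n) (λ k → term k * Z k)
    collapse : ∀ B F a → - (1ℚ + 1ℚ) * (1ℚ * B) + - 0ℚ * F + - a * 0ℚ ≡ - (1ℚ + 1ℚ) * B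
    collapse = solve-∀ ring
    lemma : ∀ p x t a r G F A T → t * (x * r) + - (x * t) * (x * (G + x * x * F)) + - (x * x * x) * T
      ≡ p + p * (x * x) * (- (1ℚ + 1ℚ) * (r * A) + - x * F + - a * T)
        + (r - x * (G + x * x * F)) * (t * x - p)
        + - p * (1ℚ + x * G - r * (1ℚ + (1ℚ + 1ℚ) * x * x * A))
        + x * x * T * (p * a - x)
    lemma = solve-∀ ring

  -- The Euler polynomial of degree p - 3 modulo p

  -1^3n : (- 1ℚ) ^ (3 ℕ.* n) ≡ 1ℚ
  -1^3n = begin
    (- 1ℚ) ^ (3 ℕ.* n)                                       ≡⟨ -1^-+ n (n ℕ.+ (n ℕ.+ 0)) ⟩
    (- 1ℚ) ^ n * (- 1ℚ) ^ (n ℕ.+ (n ℕ.+ 0))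
        ≡⟨ cong ((- 1ℚ) ^ n *_) (trans (-1^-+ n (n ℕ.+ 0)) (cong ((- 1ℚ) ^ n *_) (-1^-+ n 0))) ⟩
    (- 1ℚ) ^ n * ((- 1ℚ) ^ n * ((- 1ℚ) ^ n * 1ℚ))            ≡⟨ cong (λ s → s * (s * (s * 1ℚ))) n-even ⟩
    1ℚ                                                       ∎
    where open ≡-Reasoning

  module _ (e : ℕ) (p≡3+e : p ≡ 4 ℕ.+ e) where

    private
      -- The degree p - 3, in successor form so that its power of 0 exposes a factor 0.
      N′ : ℕ
      N′ = suc e

      p≡3+N′ : p ≡ 3 ℕ.+ N′
      p≡3+N′ = p≡3+e

      N′<p : N′ ℕ.< p
      N′<p = subst (N′ ℕ.<_) (sym p≡3+N′) (s≤s (ℕₚ.m≤n+m N′ 2))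

      N′-even : (- 1ℚ) ^ N′ ≡ 1ℚ
      N′-even = trans (lemma ((- 1ℚ) ^ N′)) (cong (λ s → - s) (trans
        (cong ((- 1ℚ) ^_) (trans (sym p≡3+N′) p≡)) (cong (- 1ℚ *_) -1^3n)))
        where
        lemma : ∀ s → s ≡ - (- 1ℚ * (- 1ℚ * (- 1ℚ * s)))
        lemma = solve-∀ ring

    -1^p : (- 1ℚ) ^ p ≡ - 1ℚ
    -1^p = trans (cong ((- 1ℚ) ^_) p≡) (cong (- 1ℚ *_) -1^3n)

    -- The summand k = 0 is zero. For the others, k ↦ p - k keeps the even power modulo p and
    -- changes the sign, as p is odd.
    power-sum≈0 : Σ< p (λ k → (- 1ℚ) ^ k * (fromℕ 2 * (0ℚ + fromℕ k) ^ N′)) ≈ 0ℚ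
    power-sum≈0 = subst (_≈ 0ℚ) (sym (begin
        Σ< p summands                                          ≡⟨ cong (λ m → Σ< m summands) p≡ ⟩
        Σ< (suc (3 ℕ.* n)) summands                            ≡⟨ Σ<-front (3 ℕ.* n) summands ⟩
        summands 0 + Σ< (3 ℕ.* n) (λ i → summands (suc i))
            ≡⟨ cong (_+ Σ< (3 ℕ.* n) (λ i → summands (suc i))) (zeros ((0ℚ + 0ℚ) ^ e)) ⟩
        0ℚ + Σ< (3 ℕ.* n) (λ i → summands (suc i))             ≡⟨ +-identityˡ _ ⟩
        Σ< (3 ℕ.* n) (λ i → summands (suc i))                  ∎))
      (Σ-antisymmetric p-prime p∤2 (3 ℕ.* n) anti)
      where
      open ≡-Reasoning
      summands : ℕ → ℚ
      summands k = (- 1ℚ) ^ k * (fromℕ 2 * (0ℚ + fromℕ k) ^ N′)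
      zeros : ∀ z → 1ℚ * (fromℕ 2 * ((0ℚ + 0ℚ) * z)) ≡ 0ℚ
      zeros z = lemma (fromℕ 2) z
        where
        lemma : ∀ t z → 1ℚ * (t * ((0ℚ + 0ℚ) * z)) ≡ 0ℚ
        lemma = solve-∀ ring
      anti : ∀ i → i ℕ.< 3 ℕ.* n → summands (suc (3 ℕ.* n ∸ suc i)) ≈ - summands (suc i)
      anti i i<3n = subst₂ _≈_ (sym (cong summands (sym (ℕₚ.+-∸-assoc 1 i<3n))))
        (pull ((- 1ℚ) ^ i) (fromℕ 2) ((0ℚ + fromℕ (suc i)) ^ N′))
        (≋-* p-prime (≋-reflexive p-prime (∈ˡ (-1^≈ (3 ℕ.* n ∸ i)))
            (trans (-1^-∸ (ℕₚ.<⇒≤ i<3n)) (cong (_* (- 1ℚ) ^ i) -1^3n)))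
          (≋-* p-prime (≈-fromℕ 2) (subst (((0ℚ + fromℕ (3 ℕ.* n ∸ i)) ^ N′) ≈_)
              (neg-^-even N′ N′-even (0ℚ + fromℕ (suc i)))
            (≋-^ p-prime N′ base))))
        where
        pull : ∀ s t z → 1ℚ * s * (t * z) ≡ - (- 1ℚ * s * (t * z))
        pull = solve-∀ ring
        base : 0ℚ + fromℕ (3 ℕ.* n ∸ i) ≈ - (0ℚ + fromℕ (suc i))
        base = ≈-mod-x (fromℕ 3) (≈-fromℕ 3) (≋-neg p-prime (≋-+ p-prime (≈-fromℕ 0) (≈-fromℕ (suc i))))
          (by 1ℚ (fromℕ-∸ (ℕₚ.<⇒≤ i<3n)) (by₂ 1ℚ (fromℕ-* 3 n) (- 1ℚ) 3a≡1
            (trans (lemma (fromℕ 3) N a (fromℕ i) (fromℕ (3 ℕ.* n)) (fromℕ (3 ℕ.* n ∸ i)))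
              (cong (λ j → - (0ℚ + j) + fromℕ 3 * (N + a) + 1ℚ * (fromℕ (3 ℕ.* n ∸ i) - (fromℕ (3 ℕ.* n) - fromℕ i))
                + 1ℚ * (fromℕ (3 ℕ.* n) - fromℕ 3 * N) + - 1ℚ * (fromℕ 3 * a - 1ℚ)) (sym (fromℕ-suc i))))))
          where
          lemma : ∀ t N a i m d → 0ℚ + d ≡ - (0ℚ + (i + 1ℚ)) + t * (N + a) + 1ℚ * (d - (m - i)) + 1ℚ *
              (m - t * N) + - 1ℚ * (t * a - 1ℚ)
          lemma = solve-∀ ring

    -- Telescoping from 0 to p gives E(0) ≡ -E(p) ≡ -E(0), and 2 is a unit.
    euler-0 : euler N′ 0ℚ ≈ 0ℚ
    euler-0 = ≋-cancel p-prime (fromℕ 2) (unit-fromℕ p-prime 2 p∤2) (∈ˡ ε≈ε) (∈-fromℕ p-prime 0)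
      (subst₂ _≈_ (double (euler N′ 0ℚ)) (cancel (euler N′ 0ℚ)) (≋-+ p-prime ε≈-ε ε≈ε))
      where
      S = Σ< p (λ k → (- 1ℚ) ^ k * (fromℕ 2 * (0ℚ + fromℕ k) ^ N′))
      0+p≈0 : 0ℚ + fromℕ p ≈ 0ℚ
      0+p≈0 = subst (_≈ 0ℚ) (lemma (fromℕ p)) (≋-p* p-prime {1ℚ} (∈-fromℕ p-prime 1))
        where
        lemma : ∀ q → q * 1ℚ ≡ 0ℚ + q
        lemma = solve-∀ ring
      ε-p : euler N′ (0ℚ + fromℕ p) ≈ euler N′ 0ℚ
      ε-p = euler-≋ p-prime p∤2 N′ N′<p 0+p≈0
      ε≈ε : euler N′ 0ℚ ≈ euler N′ 0ℚ
      ε≈ε = euler-≋ p-prime p∤2 N′ N′<p (≈-fromℕ 0)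
      ε≈-ε : euler N′ 0ℚ ≈ 0ℚ + - 1ℚ * euler N′ 0ℚ
      ε≈-ε = subst (_≈ (0ℚ + - 1ℚ * euler N′ 0ℚ)) (sym (trans (euler-telescope N′ 0ℚ p)
          (cong (λ s → S + s * euler N′ (0ℚ + fromℕ p)) -1^p)))
        (≋-+ p-prime power-sum≈0 (≋-* p-prime (≋-neg p-prime ≈-1) ε-p))
      double : ∀ e → e + e ≡ e * (1ℚ + 1ℚ)
      double = solve-∀ ring
      cancel : ∀ e → 0ℚ + - 1ℚ * e + e ≡ 0ℚ * (1ℚ + 1ℚ)
      cancel = solve-∀ ring

    fermat-inv : ∀ i → i ℕ.< n → (1ℚ + fromℕ i) ^ N′ ≈ inv (1ℚ + fromℕ i) * inv (1ℚ + fromℕ i)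
    fermat-inv i i<n = ≋-cancel p-prime (y * y * y) (unit-* p-prime (unit-* p-prime u u) u)
      (∈ˡ (≋-^ p-prime N′ (≈-unit u))) (∈ˡ (≋-* p-prime (≈-inv u) (≈-inv u)))
      (subst₂ _≈_ (lemma y (y ^ N′))
        (by₂ (- (y * (1ℚ + y * inv y))) (inv-inverse (proj₁ u)) 0ℚ (inv-inverse (proj₁ u)) (lemma′ y (inv y)))
        (subst (λ q → y ^ q ≈ y) p≡3+N′ (subst (λ z → z ^ p ≈ z) (fromℕ-+ 1 i) (fermat p-prime (suc i)))))
      where
      y = 1ℚ + fromℕ i
      u = unit-1+ i i<n
      lemma : ∀ y z → y * (y * (y * z)) ≡ z * (y * y * y)
      lemma = solve-∀ ring
      lemma′ : ∀ y j → y ≡ j * j * (y * y * y) + - (y * (1ℚ + y * j)) * (y * j - 1ℚ) + 0ℚ * (y * j - 1ℚ)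
      lemma′ = solve-∀ ring

    -- After n steps the telescoping arrives at a + n = x ≡ 0, where E vanishes modulo p. Read
    -- backwards, its arguments are congruent to -(1 + i), and Fermat turns their power p - 3 into
    -- the inverse square.
    euler-a : euler N′ a ≈ - (1ℚ + 1ℚ) * alternatingSum
    euler-a = subst₂ _≈_ (sym (trans (euler-telescope N′ a n)
        (cong (_+ (- 1ℚ) ^ n * euler N′ (a + fromℕ n)) (Σ<-reverse n summands))))
      (trans (+-identityʳ _) (Σ<-*ˡ n (- (1ℚ + 1ℚ)) _))
      (≋-+ p-prime (≋-Σ p-prime n summand≈) tail≈0)
      where
      summands : ℕ → ℚ
      summands k = (- 1ℚ) ^ k * (fromℕ 2 * (a + fromℕ k) ^ N′)
      tail≈0 : (- 1ℚ) ^ n * euler N′ (a + fromℕ n) ≈ 0ℚ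
      tail≈0 = subst ((- 1ℚ) ^ n * euler N′ (a + fromℕ n) ≈_) (*-zeroʳ ((- 1ℚ) ^ n))
        (≋-* p-prime (-1^≈ n) (≋-trans p-prime (euler-≋ p-prime p∤2 N′ N′<p (subst (_≈ 0ℚ) (+-comm N a) x≈0))
            euler-0))
      summand≈ : ∀ i → i ℕ.< n → summands (n ∸ suc i) ≈ - (1ℚ + 1ℚ) *
          ((- 1ℚ) ^ i * (inv (1ℚ + fromℕ i) * inv (1ℚ + fromℕ i)))
      summand≈ i i<n = subst (summands (n ∸ suc i) ≈_) (pull (1ℚ + 1ℚ) ((- 1ℚ) ^ i)
          (inv (1ℚ + fromℕ i) * inv (1ℚ + fromℕ i)))
        (≋-* p-prime (≋-reflexive p-prime (∈ˡ (-1^≈ (n ∸ suc i)))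
            (trans (-1^-∸ i<n) (cong (_* (- 1ℚ) ^ suc i) n-even)))
          (≋-* p-prime (≈-fromℕ 2) (≋-trans p-prime (subst (((a + fromℕ (n ∸ suc i)) ^ N′) ≈_)
              (neg-^-even N′ N′-even (1ℚ + fromℕ i))
            (≋-^ p-prime N′ base)) (fermat-inv i i<n))))
        where
        pull : ∀ t s z → 1ℚ * (- 1ℚ * s) * (t * z) ≡ - t * (s * z)
        pull = solve-∀ ring
        base : a + fromℕ (n ∸ suc i) ≈ - (1ℚ + fromℕ i)
        base = ≈-mod-x 1ℚ ≈-1 (≋-neg p-prime (≋-+ p-prime ≈-1 (≈-fromℕ i)))
          (by₂ 1ℚ (fromℕ-∸ i<n) (- 1ℚ) (fromℕ-suc i) (lemma N a (fromℕ i) (fromℕ (suc i)) (fromℕ (n ∸ suc i))))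
          where
          lemma : ∀ N a i j d → a + d ≡ - (1ℚ + i) + 1ℚ * (N + a) + 1ℚ * (d - (N - j)) + - 1ℚ * (j - (i + 1ℚ))
          lemma = solve-∀ ring

  -- The terms with n < k < p

  private
    lead : ℚ
    lead = Π< n (λ i → a + fromℕ i) * a

    -- For n < k < p the factor a + n = x of (a)ₖ is p a, and q collects the
    -- remaining factors: quot a 1 (n + 1 + i) = p q(i).
    q : ℕ → ℚ
    q i = lead * Π< i (λ l → x + 1ℚ + fromℕ l) * Π< (suc n ℕ.+ i) (λ l → inv (1ℚ + fromℕ l))

    a+n+1+ : ∀ l → a + fromℕ (suc n ℕ.+ l) ≡ x + 1ℚ + fromℕ l
    a+n+1+ l = trans (cong (_+_ a) (trans (fromℕ-+ (suc n) l) (cong (_+ fromℕ l) (fromℕ-suc n))))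
        (lemma a N (fromℕ l))
      where
      lemma : ∀ a N l → a + (N + 1ℚ + l) ≡ N + a + 1ℚ + l
      lemma = solve-∀ ring

    quot-q : ∀ i → quot a 1ℚ (suc n ℕ.+ i) ≡ fromℕ p * q i
    quot-q i = begin
      quot a 1ℚ (suc n ℕ.+ i)
        ≡⟨ Π<-* (suc n ℕ.+ i) _ _ ⟩
      Π< (suc n ℕ.+ i) (λ l → a + fromℕ l) * I
        ≡⟨ cong (_* I) (trans (Π<-++ (suc n) i _) (cong (Π< (suc n) (λ l → a + fromℕ l) *_)
            (Π<-cong i λ l _ → a+n+1+ l))) ⟩
      Π< n (λ l → a + fromℕ l) * (a + N) * X * I
        ≡⟨ by (- (Π< n (λ l → a + fromℕ l) * X * I)) p*a (lemma (fromℕ p) a N (Π< n (λ l → a + fromℕ l)) X I) ⟩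
      fromℕ p * q i ∎
      where
      open ≡-Reasoning
      X = Π< i (λ l → x + 1ℚ + fromℕ l)
      I = Π< (suc n ℕ.+ i) (λ l → inv (1ℚ + fromℕ l))
      lemma : ∀ p a N P X I → P * (a + N) * X * I ≡ p * (P * a * X * I) + - (P * X * I) * (p * a - (N + a))
      lemma = solve-∀ ring

    lead≈ : lead ≈ lead
    lead≈ = ≋-* p-prime (≈-unit (unit-Π p-prime n unit-a+)) (≈-unit unit-a)

    k≤3n : ∀ i → i ℕ.< 2 ℕ.* n → suc n ℕ.+ i ℕ.≤ 3 ℕ.* n
    k≤3n i i<2n = subst (ℕ._≤ 3 ℕ.* n) (ℕₚ.+-suc n i) (ℕₚ.+-monoʳ-≤ n i<2n)

    x+1+ : ∀ l → x + 1ℚ + fromℕ l ≈ 1ℚ + fromℕ l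
    x+1+ l = ≈-mod-x 1ℚ ≈-1 (≋-+ p-prime ≈-1 (≈-fromℕ l)) (lemma x (fromℕ l))
      where
      lemma : ∀ x l → x + 1ℚ + l ≡ 1ℚ + l + 1ℚ * x
      lemma = solve-∀ ring

    q≈ : ∀ i → i ℕ.< 2 ℕ.* n → q i ≈ q i
    q≈ i i<2n = ≋-* p-prime (≋-* p-prime lead≈ (≋-trans p-prime X≈ (≋-sym p-prime X≈)))
      (≋-Π p-prime (suc n ℕ.+ i) λ l l<k → ≈-inv (unit-suc l (≤3n⇒<p l<k (k≤3n i i<2n))))
      where
      X≈ = ≋-Π p-prime i λ l _ → x+1+ l

    -- Modulo p the factors x + 1 + l become 1 + l, so that up to the constant `lead` q is a
    -- quotient of two factorials.
    q-factorial : ∀ i → i ℕ.< 2 ℕ.* n → q i * factorial (suc n ℕ.+ i) ≈ lead * factorial i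
    q-factorial i i<2n = subst (_≈ (lead * factorial i))
        (by (- (lead * X)) (Π<-inv (suc n ℕ.+ i) (λ l _ → 1+fromℕ-≢0 l))
        (lemma lead X (Π< (suc n ℕ.+ i) (λ l → inv (1ℚ + fromℕ l))) (factorial (suc n ℕ.+ i))))
      (≋-* p-prime lead≈ (≋-Π p-prime i λ l _ → x+1+ l))
      where
      X = Π< i (λ l → x + 1ℚ + fromℕ l)
      lemma : ∀ lead X I E → lead * X ≡ lead * X * I * E + - (lead * X) * (E * I - 1ℚ)
      lemma = solve-∀ ring

    -- Modulo p = 3n + 1 we have 1 + l ≡ l - 3n, so i! is congruent to (-3n)ᵢ.
    factorial-reflect : ∀ i → i ℕ.≤ 3 ℕ.* n → factorial i * factorial (3 ℕ.* n ∸ i) ≈ (- 1ℚ) ^ i * factorial (3 ℕ.* n)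
    factorial-reflect i i≤3n = subst (factorial i * factorial (3 ℕ.* n ∸ i) ≈_) (factorial-falling (3 ℕ.* n) i i≤3n)
      (≋-* p-prime (≋-Π p-prime i λ l _ → ≈-mod-x (fromℕ 3) (≈-fromℕ 3) (≋-- p-prime (≈-fromℕ l) (≈-fromℕ (3 ℕ.* n)))
        (by₂ 1ℚ (fromℕ-* 3 n) (- 1ℚ) 3a≡1 (lemma (fromℕ 3) N a (fromℕ l) (fromℕ (3 ℕ.* n)))))
        (≈-unit (unit-factorial (3 ℕ.* n ∸ i) (ℕₚ.m∸n≤m (3 ℕ.* n) i))))
      where
      lemma : ∀ t N a l m → 1ℚ + l ≡ l - m + t * (N + a) + 1ℚ * (m - t * N) + - 1ℚ * (t * a - 1ℚ)
      lemma = solve-∀ ring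

    module Reflect (i : ℕ) (i<2n : i ℕ.< 2 ℕ.* n) where
      -- For k = n + 1 + i and k′ = n + 1 + i′ this makes k + k′ = p + n; equivalently 3n - k = i′
      -- and 3n - i = k′.
      i′ : ℕ
      i′ = 2 ℕ.* n ∸ suc i

      i′<2n : i′ ℕ.< 2 ℕ.* n
      i′<2n = ℕₚ.∸-monoʳ-< {2 ℕ.* n} {suc i} {0} (s≤s z≤n) i<2n

      i≤3n : i ℕ.≤ 3 ℕ.* n
      i≤3n = ℕₚ.≤-trans (ℕₚ.<⇒≤ i<2n) (ℕₚ.m≤n+m (2 ℕ.* n) n)

      i′≡ : 3 ℕ.* n ∸ (suc n ℕ.+ i) ≡ i′
      i′≡ = trans (cong (3 ℕ.* n ∸_) (sym (ℕₚ.+-suc n i))) (ℕₚ.[m+n]∸[m+o]≡n∸o n (2 ℕ.* n) (suc i))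

      k′≡ : suc n ℕ.+ i′ ≡ 3 ℕ.* n ∸ i
      k′≡ = begin
        suc n ℕ.+ (2 ℕ.* n ∸ suc i)    ≡⟨ sym (ℕₚ.+-suc n _) ⟩
        n ℕ.+ suc (2 ℕ.* n ∸ suc i)    ≡⟨ cong (n ℕ.+_) (sym (ℕₚ.+-∸-assoc 1 i<2n)) ⟩
        n ℕ.+ (2 ℕ.* n ∸ i)            ≡⟨ sym (ℕₚ.+-∸-assoc n (ℕₚ.<⇒≤ i<2n)) ⟩
        3 ℕ.* n ∸ i                    ∎
        where open ≡-Reasoning

      sign : (- 1ℚ) ^ (suc n ℕ.+ i) ≡ - 1ℚ * (- 1ℚ) ^ i
      sign = cong (- 1ℚ *_) (trans (-1^-+ n i) (trans (cong (_* (- 1ℚ) ^ i) n-even) (*-identityˡ ((- 1ℚ) ^ i))))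

      sign′ : (- 1ℚ) ^ (suc n ℕ.+ i′) ≡ (- 1ℚ) ^ i
      sign′ = trans (cong ((- 1ℚ) ^_) k′≡) (trans (-1^-∸ i≤3n)
          (trans (cong (_* (- 1ℚ) ^ i) -1^3n) (*-identityˡ ((- 1ℚ) ^ i))))

      -- Multiplied by k! k′!, the values of q become `lead` times i′! k! ≡ (-1)ᵏ (3n)! and `lead`
      -- times i! k′! ≡ (-1)ⁱ (3n)!. The signs are opposite since k = n + 1 + i with n even.
      q-antisymmetric : q i′ ≈ - q i
      q-antisymmetric = ≋-cancel p-prime (factorial (suc n ℕ.+ i′) * factorial (suc n ℕ.+ i))
        (unit-* p-prime (unit-factorial (suc n ℕ.+ i′) (k≤3n i′ i′<2n)) (unit-factorial (suc n ℕ.+ i) (k≤3n i i<2n)))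
        (∈ˡ (q≈ i′ i′<2n)) (∈ˡ (≋-neg p-prime (q≈ i i<2n)))
        (≋-trans p-prime left (≋-sym p-prime right))
        where
        middle : ℚ
        middle = lead * (- 1ℚ * (- 1ℚ) ^ i * factorial (3 ℕ.* n))
        factorial≈ : ∀ m → m ℕ.≤ 3 ℕ.* n → factorial m ≈ factorial m
        factorial≈ m m≤ = ≈-unit (unit-factorial m m≤)
        left : q i′ * (factorial (suc n ℕ.+ i′) * factorial (suc n ℕ.+ i)) ≈ middle
        left = subst₂ _≈_ (*-assoc (q i′) (factorial (suc n ℕ.+ i′)) (factorial (suc n ℕ.+ i))) refl
          (≋-trans p-prime (≋-* p-prime (q-factorial i′ i′<2n) (factorial≈ (suc n ℕ.+ i) (k≤3n i i<2n)))
            (subst (_≈ middle) (trans (cong (lead *_) (*-comm (factorial (suc n ℕ.+ i)) (factorial i′)))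
                (sym (*-assoc lead (factorial i′) (factorial (suc n ℕ.+ i)))))
              (≋-* p-prime lead≈ (subst₂ _≈_ (cong (λ m → factorial (suc n ℕ.+ i) * factorial m) i′≡)
                  (cong (_* factorial (3 ℕ.* n)) sign)
                (factorial-reflect (suc n ℕ.+ i) (k≤3n i i<2n))))))
        right : - q i * (factorial (suc n ℕ.+ i′) * factorial (suc n ℕ.+ i)) ≈ middle
        right = subst₂ _≈_ (shuffle (q i) (factorial (suc n ℕ.+ i)) (factorial (suc n ℕ.+ i′)))
            (pull lead ((- 1ℚ) ^ i) (factorial (3 ℕ.* n)))
          (≋-neg p-prime (≋-trans p-prime (≋-* p-prime (q-factorial i i<2n)
              (factorial≈ (suc n ℕ.+ i′) (k≤3n i′ i′<2n)))
            (subst (_≈ (lead * ((- 1ℚ) ^ i * factorial (3 ℕ.* n))))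
                (trans (cong (λ m → lead * (factorial i * factorial m)) (sym k′≡))
                (sym (*-assoc lead (factorial i) (factorial (suc n ℕ.+ i′)))))
              (≋-* p-prime lead≈ (factorial-reflect i i≤3n)))))
          where
          shuffle : ∀ q f g → - (q * f * g) ≡ - q * (g * f)
          shuffle = solve-∀ ring
          pull : ∀ lead s f → - (lead * (s * f)) ≡ lead * (- 1ℚ * s * f)
          pull = solve-∀ ring

      -- The coefficient of x is 8: k + k′ = 4n + 1, and 2a + 2(4n + 1) = 8(n + a) because 3a = 1.
      linear : a + fromℕ (suc n ℕ.+ i′) + fromℕ (suc n ℕ.+ i′) ≈ - (a + fromℕ (suc n ℕ.+ i) + fromℕ (suc n ℕ.+ i))
      linear = ≈-mod-x (fromℕ 3 * (1ℚ + 1ℚ) + (1ℚ + 1ℚ))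
          (≋-+ p-prime (≋-* p-prime (≈-fromℕ 3) (≋-+ p-prime ≈-1 ≈-1)) (≋-+ p-prime ≈-1 ≈-1))
        (≋-neg p-prime (≋-+ p-prime (≋-+ p-prime (≈-unit unit-a) (≈-fromℕ _)) (≈-fromℕ _)))
        (trans (cong (λ k′ → a + k′ + k′) (trans (cong fromℕ k′≡)
            (trans (fromℕ-∸ i≤3n) (cong (_- fromℕ i) (fromℕ-* 3 n)))))
          (by (- (1ℚ + 1ℚ)) 3a≡1 (trans (lemma (fromℕ 3) N a (fromℕ i))
            (cong (λ k → - (a + k + k) + (fromℕ 3 * (1ℚ + 1ℚ) + (1ℚ + 1ℚ)) * x + - (1ℚ + 1ℚ) * (fromℕ 3 * a - 1ℚ))
              (sym (trans (fromℕ-+ (suc n) i) (cong (_+ fromℕ i) (fromℕ-suc n))))))))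
        where
        lemma : ∀ t N a i → a + (t * N - i) + (t * N - i)
          ≡ - (a + (N + 1ℚ + i) + (N + 1ℚ + i)) + (t * (1ℚ + 1ℚ) + (1ℚ + 1ℚ)) * (N + a) + - (1ℚ + 1ℚ) * (t * a - 1ℚ)
        lemma = solve-∀ ring

    τ : ℕ → ℚ
    τ i = (- 1ℚ) ^ (suc n ℕ.+ i) * (fromℕ 3 * (a + fromℕ (suc n ℕ.+ i) + fromℕ (suc n ℕ.+ i))) * (q i * q i * q i)

    -- The sign (-1)ᵏ, the linear factor and the cube of q each change sign under the reflection,
    -- hence so does their product.
    Σ-τ : Σ< (2 ℕ.* n) τ ≈ 0ℚ
    Σ-τ = Σ-antisymmetric p-prime p∤2 (2 ℕ.* n) λ i i<2n → let open Reflect i i<2n; b = a + fromℕ (suc n ℕ.+ i) + fromℕ (suc n ℕ.+ i) in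
      subst₂ _≈_ (cong (λ s → s * (fromℕ 3 * (a + fromℕ (suc n ℕ.+ i′) + fromℕ (suc n ℕ.+ i′))) *
          (q i′ * q i′ * q i′)) (sym sign′))
        (trans (pull ((- 1ℚ) ^ i) (fromℕ 3) b (q i)) (cong (λ s → - (s * (fromℕ 3 * b) * (q i * q i * q i)))
            (sym sign)))
        (≋-* p-prime (≋-* p-prime (-1^≈ i) (≋-* p-prime (≈-fromℕ 3) linear))
          (≋-* p-prime (≋-* p-prime q-antisymmetric q-antisymmetric) q-antisymmetric))
      where
      pull : ∀ s t b q → s * (t * - b) * (- q * - q * - q) ≡ - (- 1ℚ * s * (t * b) * (q * q * q))
      pull = solve-∀ ring

  Σ-tail : Σ[ T ∈ ℚ ] T ≈ 0ℚ × Σ< p term ≡ Σ< (suc n) term + fromℕ p * fromℕ p * fromℕ p * T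
  Σ-tail = Σ< (2 ℕ.* n) τ , Σ-τ , trans (cong (λ m → Σ< m term) p≡) (trans (Σ<-++ (suc n) (2 ℕ.* n) term)
    (cong (_+_ (Σ< (suc n) term)) (trans (Σ<-cong (2 ℕ.* n) λ i _ → trans
        (cong (λ r → (- 1ℚ) ^ (suc n ℕ.+ i) * (fromℕ 3 * (a + fromℕ (suc n ℕ.+ i) + fromℕ (suc n ℕ.+ i))) *
            (r * r * r)) (quot-q i))
        (lemma (fromℕ p) ((- 1ℚ) ^ (suc n ℕ.+ i) * (fromℕ 3 * (a + fromℕ (suc n ℕ.+ i) + fromℕ (suc n ℕ.+ i))))
            (q i)))
      (Σ<-*ˡ (2 ℕ.* n) (fromℕ p * fromℕ p * fromℕ p) τ))))
    where
    lemma : ∀ p s q → s * (p * q * (p * q) * (p * q)) ≡ p * p * p * (s * (q * q * q))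
    lemma = solve-∀ ring

  summand≡term : a ≡ + 1 / 3 → ∀ k → summand k ≡ term k
  summand≡term refl k = cong₂ (λ u v → (- 1ℚ) ^ k * u * v) linear cubes
    where
    k! = fromℕ (k ℕ.!)
    P = pochhammer a k
    ρ = quot a 1ℚ k
    ρ*k! : ρ * k! ≡ P
    ρ*k! = trans (cong (ρ *_) (factorial-! k)) (trans (quot-factorial a k) (sym (pochhammer-Π a k)))
    linear : fromℕ (6 ℕ.* k ℕ.+ 1) ≡ fromℕ 3 * (a + fromℕ k + fromℕ k)
    linear = trans (trans (fromℕ-+ (6 ℕ.* k) 1) (cong (_+ 1ℚ) (fromℕ-* 6 k)))
        (by (- 1ℚ) 3a≡1 (lemma (fromℕ 3) a (fromℕ k)))
      where
      lemma : ∀ t a k → (t + t) * k + 1ℚ ≡ t * (a + k + k) + - 1ℚ * (t * a - 1ℚ)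
      lemma = solve-∀ ring
    k!³ : fromℕ ((k ℕ.!) ℕ.^ 3) ≡ k! * (k! * (k! * 1ℚ))
    k!³ = trans (fromℕ-* (k ℕ.!) _) (cong (k! *_) (trans (fromℕ-* (k ℕ.!) _) (cong (k! *_) (fromℕ-* (k ℕ.!) 1))))
    k!³≢0 : fromℕ ((k ℕ.!) ℕ.^ 3) ≢ 0ℚ
    k!³≢0 = fromℕ-≢0 ((k ℕ.!) ℕ.^ 3) {{ℕₚ.m^n≢0 (k ℕ.!) 3 {{k ℕₚ.!≢0}}}}
    cubes : (pochhammer a k ^ 3 ÷ fromℕ ((k ℕ.!) ℕ.^ 3)) {{ℕₚ.m^n≢0 (k ℕ.!) 3 {{k ℕₚ.!≢0}}}} ≡ ρ * ρ * ρ
    cubes = trans (÷-*-inv (P ^ 3) (fromℕ ((k ℕ.!) ℕ.^ 3)) {{ℕₚ.m^n≢0 (k ℕ.!) 3 {{k ℕₚ.!≢0}}}})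
      (*-cancelʳ-≡ _ k!³≢0 (trans (by (P ^ 3) (inv-inverse k!³≢0)
          (lemma (P ^ 3) (fromℕ ((k ℕ.!) ℕ.^ 3)) (inv (fromℕ ((k ℕ.!) ℕ.^ 3)))))
        (trans (cong (_^ 3) (sym ρ*k!)) (trans (cube ρ k!) (cong (ρ * ρ * ρ *_) (sym k!³))))))
      where
      lemma : ∀ P c i → P * i * c ≡ P + P * (c * i - 1ℚ)
      lemma = solve-∀ ring
      cube : ∀ ρ k! → ρ * k! * (ρ * k! * (ρ * k! * 1ℚ)) ≡ ρ * ρ * ρ * (k! * (k! * (k! * 1ℚ)))
      cube = solve-∀ ring

-- The two congruences and the parity of n

-1^-double : ∀ m → (- 1ℚ) ^ (m ℕ.* 2) ≡ 1ℚ
-1^-double zero    = refl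
-1^-double (suc m) = cong (λ s → - 1ℚ * (- 1ℚ * s)) (-1^-double m)

third : ℚ
third = + 1 / 3

congruences : ∀ {p} e (p-prime : Prime p) n → p ≡ 4 ℕ.+ e → p ≡ suc (3 ℕ.* n) → (- 1ℚ) ^ n ≡ 1ℚ →
  let E = euler (p ∸ 3) third in
  (∑[0⋯ n ] summand ≡ fromℕ p + (fromℕ p ^ 3 * (+ 1 / 9)) * E [mod p ^ 4 ])
  × (∑[0⋯ p ∸ 1 ] summand ≡ fromℕ p + (fromℕ p ^ 3 * (+ 1 / 9)) * E [mod p ^ 4 ])
congruences {p} e p-prime n refl p≡ n-even = finish 0ℚ (≋-fromℕ p-prime 0)
    (trans (to-terms n) (sym (trans (cong (_+_ S) (*-zeroʳ (fromℕ p * fromℕ p * fromℕ p))) (+-identityʳ S))))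
  , finish (proj₁ Σ-tail) (proj₁ (proj₂ Σ-tail)) (trans (to-terms (p ∸ 1)) (proj₂ (proj₂ Σ-tail)))
  where
  p∤2 : p ∤ 2
  p∤2 = ∣.>⇒∤ (s≤s (s≤s (s≤s z≤n)))
  p∤3 : p ∤ 3
  p∤3 = ∣.>⇒∤ (s≤s (s≤s (s≤s (s≤s z≤n))))
  open Supercongruence p-prime n p≡ p∤2 p∤3 n-even third refl
  S Y ε : ℚ
  S = Σ< (suc n) term
  Y = proj₁ Σ-term
  ε = euler (suc e) third
  Y≈ε : Y ≈ ε
  Y≈ε = ≋-trans p-prime (proj₁ (proj₂ Σ-term)) (≋-sym p-prime (euler-a e refl))
  to-terms : ∀ m → (∑[0⋯ m ] summand) ≡ Σ< (suc m) term
  to-terms m = trans (∑≡Σ< m summand) (Σ<-cong (suc m) λ k _ → summand≡term refl k)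
  -- One computation for both bounds: T is the cofactor of p³ in the terms beyond k = n, and is 0
  -- for the short sum.
  finish : ∀ {s} T → T ≈ 0ℚ → s ≡ S + fromℕ p * fromℕ p * fromℕ p * T → s ≡ fromℕ p + (fromℕ p ^ 3 * (+ 1 / 9)) *
      ε [mod p ^ 4 ]
  -- Since p x² = p³ / 9, replacing Y by ε contributes a² times the cofactor of Y ≡ ε; the other
  -- summand comes from p³ T.
  finish {s} T T≈0 eq = third * third * cofactor Y≈ε + cofactor T≈0 , integral
    , by 1ℚ eq (by 1ℚ (proj₂ (proj₂ Σ-term)) (by (- (fromℕ p * Y * (x + fromℕ p * third))) p*a
        (by (fromℕ p * fromℕ p * fromℕ p * third * third) (diff Y≈ε) (by (fromℕ p * fromℕ p * fromℕ p) (diff T≈0)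
          (by (fromℕ p * fromℕ p * fromℕ p * ε) third² (lemma (fromℕ p) x third (+ 1 / 9) Y ε T s S
              (cofactor Y≈ε) (cofactor T≈0)))))))
    where
    third² : third * third ≡ + 1 / 9
    third² = refl
    integral : third * third * cofactor Y≈ε + cofactor T≈0 ∈ℤ[ p ]
    integral = ∈ˡ {p-prime = p-prime} (≋-+ p-prime (≋-* p-prime (≋-* p-prime (≈-unit unit-a) (≈-unit unit-a))
        (≋-refl p-prime {cofactor Y≈ε} (∈-cof Y≈ε)))
      (≋-refl p-prime {cofactor T≈0} (∈-cof T≈0)))
    lemma : ∀ p x a b Y ε T s S w t → s - (p + (p * (p * (p * 1ℚ)) * b) * ε)
      ≡ p * (p * (p * (p * 1ℚ))) * (a * a * w + t)
        + 1ℚ * (s - (S + p * p * p * T)) + 1ℚ * (S - (p + p * (x * x) * Y))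
        + - (p * Y * (x + p * a)) * (p * a - x)
        + p * p * p * a * a * (Y - ε - p * w) + p * p * p * (T - 0ℚ - p * t)
        + p * p * p * ε * (a * a - b)
    lemma = solve-∀ ring

-- For odd n the number 3n + 1 is even, and a prime of at least 4 is not.
even-index : ∀ {e n} → Prime (4 ℕ.+ e) → 4 ℕ.+ e ≡ suc (3 ℕ.* n) → (- 1ℚ) ^ n ≡ 1ℚ
even-index {e} {n} p-prime p≡ = parity (n % 2) refl
  where
  parity : ∀ b → n % 2 ≡ b → (- 1ℚ) ^ n ≡ 1ℚ
  parity 0 eq = trans (cong ((- 1ℚ) ^_) (trans (m≡m%n+[m/n]*n n 2) (cong (ℕ._+ n ℕ./ 2 ℕ.* 2) eq)))
      (-1^-double (n ℕ./ 2))
  parity 1 eq with prime⇒irreducible p-prime (divides {2} (2 ℕ.+ 3 ℕ.* (n ℕ./ 2)) (trans p≡ (trans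
    (cong (λ m → suc (3 ℕ.* m)) (trans (m≡m%n+[m/n]*n n 2) (cong (ℕ._+ n ℕ./ 2 ℕ.* 2) eq))) (lemma (n ℕ./ 2)))))
    where
    lemma : ∀ m → suc (3 ℕ.* (1 ℕ.+ m ℕ.* 2)) ≡ (2 ℕ.+ 3 ℕ.* m) ℕ.* 2
    lemma = ℕ-solve-∀
  ... | inj₁ ()
  ... | inj₂ ()
  parity (suc (suc b)) eq = ⊥-elim (ℕₚ.<⇒≱ (m%n<n n 2) (subst (2 ℕ.≤_) (sym eq) (s≤s (s≤s z≤n))))

theorem1p1 : ∀ (p : ℕ) → Prime p → p % 3 ≡ 1 →
    (∑[0⋯ (p ∸ 1) ℕ./ 3 ] summand
    ≡ fromℕ p + (fromℕ p ^ 3 * (+ 1 / 9)) * euler (p ∸ 3) (+ 1 / 3) [mod p ^ 4 ])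
    × (∑[0⋯ p ∸ 1 ] summand
    ≡ fromℕ p + (fromℕ p ^ 3 * (+ 1 / 9)) * euler (p ∸ 3) (+ 1 / 3) [mod p ^ 4 ])
theorem1p1 0 p-prime ()
theorem1p1 1 p-prime p%3≡1 = ⊥-elim (¬prime[1] p-prime)
theorem1p1 2 p-prime ()
theorem1p1 3 p-prime ()
theorem1p1 p@(suc (suc (suc (suc e)))) p-prime p%3≡1 =
  subst (λ m → (∑[0⋯ m ] summand ≡ fromℕ p + (fromℕ p ^ 3 * (+ 1 / 9)) * euler (p ∸ 3) (+ 1 / 3) [mod p ^ 4 ])
    × (∑[0⋯ p ∸ 1 ] summand ≡ fromℕ p + (fromℕ p ^ 3 * (+ 1 / 9)) * euler (p ∸ 3) (+ 1 / 3) [mod p ^ 4 ]))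
    (sym (trans (cong (λ m → (m ∸ 1) ℕ./ 3) p≡) (trans (cong (ℕ._/ 3) (ℕₚ.*-comm 3 n)) (m*n/n≡m n 3))))
    (congruences e p-prime n refl p≡ (even-index {e} {n} p-prime p≡))
  where
  n : ℕ
  n = p ℕ./ 3
  p≡ : p ≡ suc (3 ℕ.* n)
  p≡ = trans (m≡m%n+[m/n]*n p 3) (cong₂ ℕ._+_ p%3≡1 (ℕₚ.*-comm n 3))
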